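{- For each of the groups $\mathbb{Z}/15\mathbb{Z}\oplus\mathbb{Z}$, $\mathbb{Z}/18\mathbb{Z}\oplus\mathbb{Z}^2$, $\mathbb{Z}/2\mathbb{Z}\oplus\mathbb{Z}/10\mathbb{Z}\oplus\mathbb{Z}^4$, and $\mathbb{Z}/2\mathbb{Z}\oplus\mathbb{Z}/12\mathbb{Z}\oplus\mathbb{Z}^4$, there exist a quadratic number field $K$ and an elliptic curve $E$ over $K$ whose Mordell--Weil group $E(K)$ contains a subgroup isomorphic to that group. -}

module Defs where

open import Data.Nat as ℕ using (ℕ; zero; suc)
open import Data.Nat.Primality using (Prime)
open import Data.Nat.Divisibility as ℕD using ()
open import Data.Integer as ℤ using (ℤ; +_; -[1+_]; ∣_∣)
open import Data.Integer.Divisibility as ℤD using ()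
open import Data.Rational as ℚ using (ℚ; 0ℚ; 1ℚ)
open import Data.Rational.Properties using (_≟_)
open import Data.Product using (_×_; _,_; proj₁; proj₂)
open import Data.List using (List; []; _∷_)
open import Data.Vec using (Vec; []; _∷_)
open import Data.Bool using (Bool; true; false; if_then_else_)
open import Relation.Nullary using (¬_; yes; no; does)
open import Relation.Binary.PropositionalEquality using (_≡_; _≢_)

-- Quadratic number fields  K = ℚ(√d),  d a squarefree integer ≠ 0, 1.
-- Every quadratic number field is of this form (up to isomorphism).

record SquarefreeNonUnit (d : ℤ) : Set where
  field
    d≢0 : d ≢ + 0
    d≢1 : d ≢ + 1
    sqfree : ∀ (p : ℕ) → Prime p → ¬ ((p ℕ.* p) ℕD.∣ ∣ d ∣)

-- Elements x + y√d of ℚ(√d), represented by the pair (x , y).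
QF : ℤ → Set
QF d = ℚ × ℚ

module Field (d : ℤ) where
  dq : ℚ
  dq = d ℚ./ 1

  0K 1K : QF d
  0K = 0ℚ , 0ℚ
  1K = 1ℚ , 0ℚ

  fromℚ : ℚ → QF d
  fromℚ q = q , 0ℚ

  infixl 6 _+K_ _-K_
  infixl 7 _*K_ _/K_
  _+K_ _-K_ _*K_ : QF d → QF d → QF d
  (a , b) +K (c , e) = a ℚ.+ c , b ℚ.+ e
  (a , b) -K (c , e) = a ℚ.- c , b ℚ.- e
  (a , b) *K (c , e) = a ℚ.* c ℚ.+ dq ℚ.* (b ℚ.* e) , a ℚ.* e ℚ.+ b ℚ.* c

  -K_ : QF d → QF d
  -K (a , b) = ℚ.- a , ℚ.- b

  -- 1/q in ℚ, with the junk value 0 at q = 0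
  invℚ : ℚ → ℚ
  invℚ q with q ≟ 0ℚ
  ... | yes _ = 0ℚ
  ... | no q≢0 = ℚ.1/_ q {{ℚ.≢-nonZero q≢0}}

  -- (a + b√d)⁻¹ = (a - b√d)/(a² - d b²); junk value 0 at 0.
  invK : QF d → QF d
  invK (a , b) = let n = invℚ (a ℚ.* a ℚ.- dq ℚ.* (b ℚ.* b)) in
                 a ℚ.* n , ℚ.- (b ℚ.* n)

  _/K_ : QF d → QF d → QF d
  x /K y = x *K invK y

  eqK : QF d → QF d → Bool
  eqK (a , b) (c , e) with a ≟ c | b ≟ e
  ... | yes _ | yes _ = true
  ... | _     | _     = false

-- Elliptic curves over K in short Weierstrass form y² = x³ + A x + B
-- with nonzero discriminant (every elliptic curve over a field of
-- characteristic 0 has such a model).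

record EllipticCurve (d : ℤ) : Set where
  constructor weierstrass
  open Field d
  field
    A B : QF d
    nonsingular : (fromℚ (+ 4 ℚ./ 1) *K (A *K (A *K A)))
                  +K (fromℚ (+ 27 ℚ./ 1) *K (B *K B)) ≢ 0K

data Point (d : ℤ) : Set where
  O  : Point d
  pt : QF d → QF d → Point d

module Curve {d : ℤ} (E : EllipticCurve d) where
  open Field d
  open EllipticCurve E

  OnCurve : Point d → Set
  OnCurve O = Data.Unit.⊤ where import Data.Unit
  OnCurve (pt x y) = y *K y ≡ (x *K (x *K x)) +K ((A *K x) +K B)

  negP : Point d → Point d
  negP O = O
  negP (pt x y) = pt x (-K y)

  addP : Point d → Point d → Point d
  addP O Q = Q
  addP P O = P
  addP (pt x₁ y₁) (pt x₂ y₂) =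
    if eqK x₁ x₂
    then (if eqK (y₁ +K y₂) 0K then O
          else third ((fromℚ (+ 3 ℚ./ 1) *K (x₁ *K x₁) +K A) /K (fromℚ (+ 2 ℚ./ 1) *K y₁)))
    else third ((y₂ -K y₁) /K (x₂ -K x₁))
    where
    third : QF d → Point d
    third λ' = let x₃ = ((λ' *K λ') -K x₁) -K x₂ in
               pt x₃ ((λ' *K (x₁ -K x₃)) -K y₁)

  mulℕ : ℕ → Point d → Point d
  mulℕ zero P = O
  mulℕ (suc n) P = addP P (mulℕ n P)

  mulℤ : ℤ → Point d → Point d
  mulℤ (+ n) P = mulℕ n P
  mulℤ -[1+ n ] P = negP (mulℕ (suc n) P)

  lincomb : ∀ {k} → Vec ℤ k → Vec (Point d) k → Point d
  lincomb [] [] = O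
  lincomb (a ∷ as) (P ∷ Ps) = addP (mulℤ a P) (lincomb as Ps)

  data AllOnCurve : ∀ {k} → Vec (Point d) k → Set where
    []  : AllOnCurve []
    _∷_ : ∀ {k P} {Ps : Vec (Point d) k} → OnCurve P → AllOnCurve Ps → AllOnCurve (P ∷ Ps)

  data Killed : ∀ {k} → Vec ℕ k → Vec (Point d) k → Set where
    []  : Killed [] []
    _∷_ : ∀ {k n T} {ns : Vec ℕ k} {Ts} → mulℕ n T ≡ O → Killed ns Ts → Killed (n ∷ ns) (T ∷ Ts)

  data AllDiv : ∀ {k} → Vec ℕ k → Vec ℤ k → Set where
    []  : AllDiv [] []
    _∷_ : ∀ {k n a} {ns : Vec ℕ k} {as} → (+ n) ℤD.∣ a → AllDiv ns as → AllDiv (n ∷ ns) (a ∷ as)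

  data AllZero : ∀ {k} → Vec ℤ k → Set where
    []  : AllZero []
    _∷_ : ∀ {k} {bs : Vec ℤ k} → AllZero bs → AllZero (+ 0 ∷ bs)

  -- E(K) contains a subgroup isomorphic to  ⊕ᵢ ℤ/nᵢℤ ⊕ ℤ^r :
  -- there are points Tᵢ, Pⱼ ∈ E(K) with nᵢ Tᵢ = O such that the induced
  -- homomorphism (a, b) ↦ Σ aᵢ Tᵢ + Σ bⱼ Pⱼ  from ⊕ᵢ ℤ/nᵢℤ ⊕ ℤ^r is injective.
  record ContainsSubgroup {k : ℕ} (ns : Vec ℕ k) (r : ℕ) : Set where
    field
      Ts : Vec (Point d) k
      Ps : Vec (Point d) r
      Ts-on : AllOnCurve Ts
      Ps-on : AllOnCurve Ps
      Ts-order : Killed ns Ts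
      injective : ∀ (as : Vec ℤ k) (bs : Vec ℤ r) →
                  addP (lincomb as Ts) (lincomb bs Ps) ≡ O →
                  AllDiv ns as × AllZero bs

open import Data.Product using (Σ; ∃)

Realizable : ∀ {k} → Vec ℕ k → ℕ → Set
Realizable ns r =
  Σ ℤ λ d → SquarefreeNonUnit d × Σ (EllipticCurve d) λ E →
    Curve.ContainsSubgroup E ns r

{-# OPTIONS --safe #-}

-- Associativity of the chord-tangent law comes from the coordinate ring R = K[x] ⊕ K[x]y: the ideal I_P of
-- functions vanishing at P satisfies I_P I_Q ~ I_{P+Q} up to nonzero factors, and I_P ~ I_Q forces P = Q because
-- the norm of a nonzero element of R never has degree 1.
--
-- Independence of the points is a descent. If P₁, …, P_r together with generators of E(K)[ℓ^∞] are independent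
-- modulo ℓE(K), then every relation has all coefficients divisible by ℓ up to torsion, and dividing by ℓ
-- repeatedly makes the coefficients of the P_i vanish. Independence modulo ℓ is seen by the Kummer maps to
-- K*/K*^ℓ: x - e at a 2-torsion point (e , 0) for ℓ = 2, and y - L(x) with L a flex tangent for ℓ = 3. That a
-- value is not an ℓ-th power is read off modulo a small integer from the equations satisfied by the norm and
-- the trace of a root.
--
-- The curve for ℤ/2 ⊕ ℤ/12 is y² = x(x + M)(x + N) over ℚ with torsion ℤ/2 ⊕ ℤ/6, where M = a³(a + 2), N = 2a + 1
-- and a = (s² - 1)/2, s = 19/8. It and its quadratic twist by (s² - 1)(s² + 3) both have rank 2 over ℚ. Its
-- coordinates below are rescaled by 135 + √d: the test modulo small integers never detects a rational number.

module Submission where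

open import Algebra.Bundles using (CommutativeRing)
open import Algebra.Solver.Ring.AlmostCommutativeRing using (fromCommutativeRing; _-Raw-AlmostCommutative⟶_)
open import Algebra.Structures using (IsCommutativeRing)
open import Data.Integer as ℤ using (ℤ; +_; -[1+_])
import Data.Integer.Properties as ℤₚ
open import Data.Maybe using (Maybe; just; nothing)
open import Data.Nat as ℕ using (ℕ; zero; suc)
open import Data.Product using (_×_; _,_)
open import Data.Sign as Sign using (Sign)
open import Level using (0ℓ)
open import Relation.Binary.Definitions using (DecidableEquality)
open import Relation.Binary.PropositionalEquality as ≡ using (_≡_; _≢_; cong; cong₂)
open import Relation.Nullary using (yes; no)

-- A direct check of associativity would run through all combinations of the branches of `addP`;
-- with ideal classes each branch is treated once. Classes are compared as g I = h J, which stays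
-- inside R. The descent hinges on an exact list of the ℓ-torsion of E(K), because dividing a
-- relation by ℓ leaves an unknown ℓ-torsion point. For ℓ = 2 the cubic splits in K and its roots
-- give the list. For ℓ = 3 the 3-division polynomial is x - x₀ times a cubic that a substitution
-- turns into z³ = κ, so a nonpower certificate settles it too. The prime follows the torsion: 15
-- and 18 provide a flex, the other two groups provide full 2-torsion. All numerical work takes
-- place in ℤ[√d]. The curves are scaled so that the points, their multiples and the slopes are
-- pairs of integers. The checks are closed Boolean terms that evaluate to `true`, and `embed`
-- carries the conclusions to K. In this way the divisions and zero tests in `addP` and `invK` are
-- reasoned about but never evaluated on the large coordinates.

module IntegerSolver {c ℓ} (R : CommutativeRing c ℓ) where
  open CommutativeRing R
  open import Algebra.Properties.Semiring.Mult.TCOptimised semiring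
    renaming (_×_ to _·_)
  open import Algebra.Properties.Ring ring
  open import Algebra.Properties.AbelianGroup +-abelianGroup using (⁻¹-∙-comm)
  open import Relation.Binary.Reasoning.Setoid setoid

  -- The optimised multiples make `⟦ + 0 ⟧` and `⟦ + 1 ⟧` reduce to `0#` and `1#`, so the constants
  -- of a solver polynomial meet those of the goal by computation.
  ⟦_⟧ : ℤ → Carrier
  ⟦ + n ⟧ = n · 1#
  ⟦ -[1+ n ] ⟧ = - (suc n · 1#)

  ⟦⟧-neg : ∀ i → ⟦ ℤ.- i ⟧ ≈ - ⟦ i ⟧
  ⟦⟧-neg (+ zero) = sym -0#≈0#
  ⟦⟧-neg (+ suc n) = refl
  ⟦⟧-neg -[1+ n ] = sym (-‿involutive _)

  ⟦⟧-⊖ : ∀ m n → ⟦ m ℤ.⊖ n ⟧ ≈ m · 1# - n · 1#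
  ⟦⟧-⊖ m zero = begin
    m · 1#       ≈⟨ +-identityʳ _ ⟨
    m · 1# + 0#  ≈⟨ +-congˡ -0#≈0# ⟨
    m · 1# - 0#  ∎
  ⟦⟧-⊖ zero (suc n) = sym (+-identityˡ _)
  ⟦⟧-⊖ (suc m) (suc n) = begin
    ⟦ suc m ℤ.⊖ suc n ⟧                     ≈⟨ reflexive (cong ⟦_⟧ (ℤₚ.[1+m]⊖[1+n]≡m⊖n m n)) ⟩
    ⟦ m ℤ.⊖ n ⟧                             ≈⟨ ⟦⟧-⊖ m n ⟩
    m · 1# - n · 1#                         ≈⟨ +-identityˡ _ ⟨
    0# + (m · 1# - n · 1#)                  ≈⟨ +-congʳ (-‿inverseʳ 1#) ⟨
    (1# - 1#) + (m · 1# - n · 1#)           ≈⟨ +-assoc _ _ _ ⟩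
    1# + (- 1# + (m · 1# - n · 1#))         ≈⟨ +-congˡ (+-assoc _ _ _) ⟨
    1# + ((- 1# + m · 1#) - n · 1#)         ≈⟨ +-congˡ (+-congʳ (+-comm _ _)) ⟩
    1# + ((m · 1# - 1#) - n · 1#)           ≈⟨ +-congˡ (+-assoc _ _ _) ⟩
    1# + (m · 1# + (- 1# - n · 1#))         ≈⟨ +-assoc _ _ _ ⟨
    (1# + m · 1#) + (- 1# - n · 1#)         ≈⟨ +-congˡ (⁻¹-∙-comm _ _) ⟩
    (1# + m · 1#) - (1# + n · 1#)           ≈⟨ +-cong (1+× m 1#) (-‿cong (1+× n 1#)) ⟨
    suc m · 1# - suc n · 1#                 ∎

  ⟦⟧-+ : ∀ i j → ⟦ i ℤ.+ j ⟧ ≈ ⟦ i ⟧ + ⟦ j ⟧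
  ⟦⟧-+ (+ m) (+ n) = ×-homo-+ 1# m n
  ⟦⟧-+ (+ m) -[1+ n ] = ⟦⟧-⊖ m (suc n)
  ⟦⟧-+ -[1+ m ] (+ n) = trans (⟦⟧-⊖ n (suc m)) (+-comm _ _)
  ⟦⟧-+ -[1+ m ] -[1+ n ] = begin
    - (suc (suc (m ℕ.+ n)) · 1#)       ≈⟨ -‿cong (reflexive (cong (λ k → suc k · 1#) (≡.sym (ℕ-+-suc m n)))) ⟩
    - ((suc m ℕ.+ suc n) · 1#)         ≈⟨ -‿cong (×-homo-+ 1# (suc m) (suc n)) ⟩
    - (suc m · 1# + suc n · 1#)        ≈⟨ ⁻¹-∙-comm _ _ ⟨
    - (suc m · 1#) - suc n · 1#        ∎
    where open import Data.Nat.Properties using () renaming (+-suc to ℕ-+-suc)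

  signed : Sign → Carrier → Carrier
  signed Sign.+ x = x
  signed Sign.- x = - x

  ⟦⟧-◃ : ∀ s n → ⟦ s ℤ.◃ n ⟧ ≈ signed s (n · 1#)
  ⟦⟧-◃ Sign.+ zero = refl
  ⟦⟧-◃ Sign.- zero = sym -0#≈0#
  ⟦⟧-◃ Sign.+ (suc n) = refl
  ⟦⟧-◃ Sign.- (suc n) = refl

  ⟦⟧-signAbs : ∀ i → ⟦ i ⟧ ≈ signed (ℤ.sign i) (ℤ.∣ i ∣ · 1#)
  ⟦⟧-signAbs (+ n) = refl
  ⟦⟧-signAbs -[1+ n ] = refl

  signed-* : ∀ s t x y → signed (s Sign.* t) (x * y) ≈ signed s x * signed t y
  signed-* Sign.+ Sign.+ x y = refl
  signed-* Sign.+ Sign.- x y = -‿distribʳ-* x y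
  signed-* Sign.- Sign.+ x y = -‿distribˡ-* x y
  signed-* Sign.- Sign.- x y = begin
    x * y          ≈⟨ -‿involutive _ ⟨
    - - (x * y)    ≈⟨ -‿cong (-‿distribˡ-* x y) ⟩
    - (- x * y)    ≈⟨ -‿distribʳ-* (- x) y ⟩
    - x * - y      ∎

  signed-cong : ∀ s {x y} → x ≈ y → signed s x ≈ signed s y
  signed-cong Sign.+ eq = eq
  signed-cong Sign.- eq = -‿cong eq

  ⟦⟧-* : ∀ i j → ⟦ i ℤ.* j ⟧ ≈ ⟦ i ⟧ * ⟦ j ⟧
  ⟦⟧-* i j = begin
    ⟦ i ℤ.* j ⟧
      ≈⟨ ⟦⟧-◃ (ℤ.sign i Sign.* ℤ.sign j) (ℤ.∣ i ∣ ℕ.* ℤ.∣ j ∣) ⟩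
    signed (ℤ.sign i Sign.* ℤ.sign j) ((ℤ.∣ i ∣ ℕ.* ℤ.∣ j ∣) · 1#)
      ≈⟨ signed-cong (ℤ.sign i Sign.* ℤ.sign j) (×1-homo-* ℤ.∣ i ∣ ℤ.∣ j ∣) ⟩
    signed (ℤ.sign i Sign.* ℤ.sign j) (ℤ.∣ i ∣ · 1# * ℤ.∣ j ∣ · 1#)
      ≈⟨ signed-* (ℤ.sign i) (ℤ.sign j) _ _ ⟩
    signed (ℤ.sign i) (ℤ.∣ i ∣ · 1#) * signed (ℤ.sign j) (ℤ.∣ j ∣ · 1#)
      ≈⟨ *-cong (⟦⟧-signAbs i) (⟦⟧-signAbs j) ⟨
    ⟦ i ⟧ * ⟦ j ⟧ ∎

  morphism : ℤ.+-*-rawRing -Raw-AlmostCommutative⟶ fromCommutativeRing R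
  morphism = record
    { ⟦_⟧ = ⟦_⟧ ; +-homo = ⟦⟧-+ ; *-homo = ⟦⟧-* ; -‿homo = ⟦⟧-neg ; 0-homo = refl ; 1-homo = refl }

  coeff≟ : ∀ i j → Maybe (⟦ i ⟧ ≈ ⟦ j ⟧)
  coeff≟ i j with i ℤₚ.≟ j
  ... | yes i≡j = just (reflexive (cong ⟦_⟧ i≡j))
  ... | no _ = nothing

  open import Algebra.Solver.Ring ℤ.+-*-rawRing (fromCommutativeRing R) morphism coeff≟ public
    using (Polynomial; solve; _:=_; _:+_; _:*_; _:-_; :-_; con)

  :0 :1 : ∀ {n} → Polynomial n
  :0 = con (+ 0)
  :1 = con (+ 1)

-- Discrete fields of characteristic zero and rings S[√s]

record DiscreteField : Set₁ where
  infixl 6 _+_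
  infixl 7 _*_
  infix 8 -_
  infix 9 _⁻¹
  field
    Carrier : Set
    _+_ _*_ : Carrier → Carrier → Carrier
    -_ : Carrier → Carrier
    0# 1# : Carrier
    isCommutativeRing : IsCommutativeRing _≡_ _+_ _*_ -_ 0# 1#
    _≟_ : DecidableEquality Carrier
    _⁻¹ : Carrier → Carrier
    *-inverseʳ : ∀ {x} → x ≢ 0# → x * x ⁻¹ ≡ 1#

    -- The natural numbers in the field. They are pairwise distinct in characteristic zero and give
    -- an endless supply of arguments at which a polynomial function can be tested.
    ι : ℕ → Carrier
    ι-zero : ι 0 ≡ 0#
    ι-suc : ∀ n → ι (suc n) ≡ 1# + ι n
    ι-suc≢0 : ∀ n → ι (suc n) ≢ 0#

  commutativeRing : CommutativeRing 0ℓ 0ℓ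
  commutativeRing = record { isCommutativeRing = isCommutativeRing }

  open CommutativeRing commutativeRing public
    using (_-_; +-assoc; +-comm; +-identityˡ; +-identityʳ; -‿inverseʳ; -‿inverseˡ; *-assoc; *-comm;
           *-identityˡ; *-identityʳ; zeroˡ; zeroʳ; distribˡ; distribʳ)

  open IntegerSolver commutativeRing public using (solve; _:=_; _:+_; _:*_; _:-_; :-_; :0; :1)

  *-cancelˡ-0 : ∀ {x y} → x ≢ 0# → x * y ≡ 0# → y ≡ 0#
  *-cancelˡ-0 {x} {y} x≢0 xy≡0 = begin
    y                 ≡⟨ *-identityˡ y ⟨
    1# * y            ≡⟨ cong (_* y) (*-inverseʳ x≢0) ⟨
    x * x ⁻¹ * y      ≡⟨ solve 3 (λ x i y → x :* i :* y := i :* (x :* y)) ≡.refl x (x ⁻¹) y ⟩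
    x ⁻¹ * (x * y)    ≡⟨ cong (x ⁻¹ *_) xy≡0 ⟩
    x ⁻¹ * 0#         ≡⟨ zeroʳ _ ⟩
    0#                ∎
    where open ≡.≡-Reasoning

  x-y≡0⇒x≡y : ∀ {x y} → x - y ≡ 0# → x ≡ y
  x-y≡0⇒x≡y {x} {y} eq = begin
    x            ≡⟨ solve 2 (λ x y → x := (x :- y) :+ y) ≡.refl x y ⟩
    (x - y) + y  ≡⟨ cong (_+ y) eq ⟩
    0# + y       ≡⟨ +-identityˡ y ⟩
    y            ∎
    where open ≡.≡-Reasoning

  x≡y⇒x-y≡0 : ∀ {x y} → x ≡ y → x - y ≡ 0#
  x≡y⇒x-y≡0 {x} ≡.refl = -‿inverseʳ x

  *-≢0 : ∀ {x y} → x ≢ 0# → y ≢ 0# → x * y ≢ 0#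
  *-≢0 x≢0 y≢0 xy≡0 = y≢0 (*-cancelˡ-0 x≢0 xy≡0)

  ι-one : ι 1 ≡ 1#
  ι-one = ≡.trans (ι-suc 0) (≡.trans (cong (λ z → 1# + z) ι-zero) (+-identityʳ 1#))

  1≢0 : 1# ≢ 0#
  1≢0 eq = ι-suc≢0 0 (≡.trans ι-one eq)

  2≢0 : 1# + 1# ≢ 0#
  2≢0 eq = ι-suc≢0 1 (≡.trans (ι-suc 1) (≡.trans (cong (λ z → 1# + z) ι-one) eq))

  ι-+ : ∀ m n → ι (m ℕ.+ n) ≡ ι m + ι n
  ι-+ zero n = ≡.sym (≡.trans (cong (_+ ι n) ι-zero) (+-identityˡ (ι n)))
  ι-+ (suc m) n = begin
    ι (suc (m ℕ.+ n))    ≡⟨ ι-suc (m ℕ.+ n) ⟩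
    1# + ι (m ℕ.+ n)     ≡⟨ cong (λ z → 1# + z) (ι-+ m n) ⟩
    1# + (ι m + ι n)     ≡⟨ +-assoc _ _ _ ⟨
    (1# + ι m) + ι n     ≡⟨ cong (_+ ι n) (ι-suc m) ⟨
    ι (suc m) + ι n      ∎
    where open ≡.≡-Reasoning

-- S[√s] for a commutative ring S.
module Quadratic
  {C : Set} {_+_ _*_ : C → C → C} { -_ : C → C} {0# 1# : C}
  (isCommutativeRing : IsCommutativeRing _≡_ _+_ _*_ -_ 0# 1#) (s : C)
  where

  private
    ring : CommutativeRing 0ℓ 0ℓ
    ring = record { isCommutativeRing = isCommutativeRing }
    open IntegerSolver ring

  infixl 6 _⊕_
  infixl 7 _⊛_

  _⊕_ _⊛_ : C × C → C × C → C × C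
  (a , b) ⊕ (c , e) = a + c , b + e
  (a , b) ⊛ (c , e) = (a * c) + (s * (b * e)) , (a * e) + (b * c)

  ⊝_ : C × C → C × C
  ⊝ (a , b) = - a , - b

  ⊕-⊛-isCommutativeRing : IsCommutativeRing _≡_ _⊕_ _⊛_ ⊝_ (0# , 0#) (1# , 0#)
  ⊕-⊛-isCommutativeRing = record
    { isRing = record
      { +-isAbelianGroup = record
        { isGroup = record
          { isMonoid = record
            { isSemigroup = record
              { isMagma = record { isEquivalence = ≡.isEquivalence ; ∙-cong = cong₂ _⊕_ }
              ; assoc = λ { (a , b) (c , e) (g , h) → cong₂ _,_ (R.+-assoc a c g) (R.+-assoc b e h) } }
            ; identity = (λ { (a , b) → cong₂ _,_ (R.+-identityˡ a) (R.+-identityˡ b) })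
                       , (λ { (a , b) → cong₂ _,_ (R.+-identityʳ a) (R.+-identityʳ b) }) }
          ; inverse = (λ { (a , b) → cong₂ _,_ (R.-‿inverseˡ a) (R.-‿inverseˡ b) })
                    , (λ { (a , b) → cong₂ _,_ (R.-‿inverseʳ a) (R.-‿inverseʳ b) })
          ; ⁻¹-cong = cong ⊝_ }
        ; comm = λ { (a , b) (c , e) → cong₂ _,_ (R.+-comm a c) (R.+-comm b e) } }
      ; *-cong = cong₂ _⊛_
      ; *-assoc = λ { (a , b) (c , e) (g , h) → cong₂ _,_
          (solve 7 (λ s a b c e g h →
            (a :* c :+ s :* (b :* e)) :* g :+ s :* ((a :* e :+ b :* c) :* h)
            := a :* (c :* g :+ s :* (e :* h)) :+ s :* (b :* (c :* h :+ e :* g))) ≡.refl s a b c e g h)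
          (solve 7 (λ s a b c e g h →
            (a :* c :+ s :* (b :* e)) :* h :+ (a :* e :+ b :* c) :* g
            := a :* (c :* h :+ e :* g) :+ b :* (c :* g :+ s :* (e :* h))) ≡.refl s a b c e g h) }
      ; *-identity = (λ { (a , b) → cong₂ _,_
            (solve 3 (λ s a b → :1 :* a :+ s :* (:0 :* b) := a) ≡.refl s a b)
            (solve 2 (λ a b → :1 :* b :+ :0 :* a := b) ≡.refl a b) })
        , (λ { (a , b) → cong₂ _,_
            (solve 3 (λ s a b → a :* :1 :+ s :* (b :* :0) := a) ≡.refl s a b)
            (solve 2 (λ a b → a :* :0 :+ b :* :1 := b) ≡.refl a b) })
      ; distrib = (λ { (a , b) (c , e) (g , h) → cong₂ _,_
            (solve 7 (λ s a b c e g h → a :* (c :+ g) :+ s :* (b :* (e :+ h))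
              := (a :* c :+ s :* (b :* e)) :+ (a :* g :+ s :* (b :* h))) ≡.refl s a b c e g h)
            (solve 6 (λ a b c e g h → a :* (e :+ h) :+ b :* (c :+ g)
              := (a :* e :+ b :* c) :+ (a :* h :+ b :* g)) ≡.refl a b c e g h) })
        , (λ { (a , b) (c , e) (g , h) → cong₂ _,_
            (solve 7 (λ s a b c e g h → (c :+ g) :* a :+ s :* ((e :+ h) :* b)
              := (c :* a :+ s :* (e :* b)) :+ (g :* a :+ s :* (h :* b))) ≡.refl s a b c e g h)
            (solve 6 (λ a b c e g h → (c :+ g) :* b :+ (e :+ h) :* a
              := (c :* b :+ e :* a) :+ (g :* b :+ h :* a)) ≡.refl a b c e g h) }) }
    ; *-comm = λ { (a , b) (c , e) → cong₂ _,_
          (solve 5 (λ s a b c e → a :* c :+ s :* (b :* e) := c :* a :+ s :* (e :* b)) ≡.refl s a b c e)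
          (solve 4 (λ a b c e → a :* e :+ b :* c := c :* b :+ e :* a) ≡.refl a b c e) } }
    where module R = CommutativeRing ring

  commutativeRing : CommutativeRing 0ℓ 0ℓ
  commutativeRing = record { isCommutativeRing = ⊕-⊛-isCommutativeRing }

  norm : C × C → C
  norm (a , b) = (a * a) + (- (s * (b * b)))

  norm-* : ∀ x y → norm (x ⊛ y) ≡ norm x * norm y
  norm-* (a , b) (c , e) = solve 5 (λ s a b c e →
    (a :* c :+ s :* (b :* e)) :* (a :* c :+ s :* (b :* e)) :- s :* ((a :* e :+ b :* c) :* (a :* e :+ b :* c))
    := (a :* a :- s :* (b :* b)) :* (c :* c :- s :* (e :* e))) ≡.refl s a b c e

open import Data.Empty using (⊥; ⊥-elim)
open import Data.Nat using (z≤n; s≤s)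
import Data.Nat.Properties as ℕₚ
open import Data.Nat.Solver using (module +-*-Solver)
open import Data.Product using (proj₁; proj₂; ∃; ∃₂)
open import Data.Sum using (_⊎_; inj₁; inj₂)
open import Data.Unit using (⊤; tt)
open import Relation.Binary.Definitions using (tri<; tri≈; tri>)
open import Relation.Binary.PropositionalEquality using (refl; sym; trans; subst)
open import Relation.Nullary using (¬_; Dec)

-- Polynomial functions in one variable and their degrees

module PolynomialFunctions (F : DiscreteField) where
  open DiscreteField F
  open ≡.≡-Reasoning

  -- a is a polynomial function of formal degree n whose coefficient at tⁿ is c; c may vanish.
  data Poly : (Carrier → Carrier) → ℕ → Carrier → Set where
    constant : ∀ {a c} → (∀ t → a t ≡ c) → Poly a 0 c
    step : ∀ {a b n c} r k → (∀ t → a t ≡ (t - r) * b t + k) → Poly b n c → Poly a (suc n) c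

  Poly-ext : ∀ {a b n c} → (∀ t → a t ≡ b t) → Poly a n c → Poly b n c
  Poly-ext eq (constant h) = constant (λ t → trans (sym (eq t)) (h t))
  Poly-ext eq (step r k h p) = step r k (λ t → trans (sym (eq t)) (h t)) p

  -- Sums are formed at equal formal degree; the smaller summand is padded with zero leading
  -- coefficients.
  Poly-raise : ∀ {a n c} → Poly a n c → Poly a (suc n) 0#
  Poly-raise {c = c} (constant h) = step 0# c
    (λ t → trans (h t) (solve 2 (λ t c → c := (t :- :0) :* :0 :+ c) refl t c)) (constant λ _ → refl)
  Poly-raise (step r k h p) = step r k h (Poly-raise p)

  Poly-raise-by : ∀ {a n c} k → Poly a n c → Poly a (suc k ℕ.+ n) 0#
  Poly-raise-by zero p = Poly-raise p
  Poly-raise-by (suc k) p = Poly-raise (Poly-raise-by k p)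

  -- The centres inside a `Poly` are arbitrary. Moving `r` to the front is division by t - r, and
  -- the leading coefficient survives.
  Poly-divide : ∀ {a n c} → Poly a (suc n) c → ∀ r →
                ∃ λ b → Poly b n c × (∀ t → a t ≡ (t - r) * b t + a r)
  Poly-divide {a} (step {b = b} r₀ k h (constant {c = c} hb)) r = b , constant hb , λ t → begin
    a t                                 ≡⟨ h t ⟩
    (t - r₀) * b t + k                  ≡⟨ cong (λ z → (t - r₀) * z + k) (hb t) ⟩
    (t - r₀) * c + k                    ≡⟨ solve 5 (λ t r r₀ c k →
                                             (t :- r₀) :* c :+ k := (t :- r) :* c :+ ((r :- r₀) :* c :+ k)) refl t r r₀ c k ⟩
    (t - r) * c + ((r - r₀) * c + k)    ≡⟨ cong₂ (λ z w → (t - r) * z + ((r - r₀) * w + k)) (hb t) (hb r) ⟨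
    (t - r) * b t + ((r - r₀) * b r + k) ≡⟨ cong (λ z → (t - r) * b t + z) (h r) ⟨
    (t - r) * b t + a r                 ∎
  Poly-divide {a} (step {b = b} r₀ k h p@(step _ _ _ _)) r with Poly-divide p r
  ... | b′ , p′ , h′ = (λ t → (t - r₀) * b′ t + b r) , step r₀ (b r) (λ _ → refl) p′ , λ t → begin
    a t                                                      ≡⟨ h t ⟩
    (t - r₀) * b t + k                                       ≡⟨ cong (λ z → (t - r₀) * z + k) (h′ t) ⟩
    (t - r₀) * ((t - r) * b′ t + b r) + k                    ≡⟨ solve 6 (λ t r r₀ b′ b k →
        (t :- r₀) :* ((t :- r) :* b′ :+ b) :+ k
        := (t :- r) :* ((t :- r₀) :* b′ :+ b) :+ ((r :- r₀) :* b :+ k)) refl t r r₀ (b′ t) (b r) k ⟩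
    (t - r) * ((t - r₀) * b′ t + b r) + ((r - r₀) * b r + k) ≡⟨ cong (λ z → (t - r) * ((t - r₀) * b′ t + b r) + z) (h r) ⟨
    (t - r) * ((t - r₀) * b′ t + b r) + a r                  ∎

  Poly-+ : ∀ {a b n c e} → Poly a n c → Poly b n e → Poly (λ t → a t + b t) n (c + e)
  Poly-+ (constant h) (constant h′) = constant (λ t → cong₂ _+_ (h t) (h′ t))
  Poly-+ {b = b} (step {b = a′} r k h p) q@(step _ _ _ _) with Poly-divide q r
  ... | b′ , q′ , h′ = step r (k + b r) (λ t → trans (cong₂ _+_ (h t) (h′ t))
        (solve 6 (λ t r a′ b′ k l → ((t :- r) :* a′ :+ k) :+ ((t :- r) :* b′ :+ l)
          := (t :- r) :* (a′ :+ b′) :+ (k :+ l)) refl t r (a′ t) (b′ t) k (b r))) (Poly-+ p q′)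

  Poly-scale : ∀ {a n c} e → Poly a n c → Poly (λ t → e * a t) n (e * c)
  Poly-scale e (constant h) = constant (λ t → cong (e *_) (h t))
  Poly-scale e (step {b = b} r k h p) = step r (e * k)
    (λ t → trans (cong (e *_) (h t))
      (solve 5 (λ t r b k e → e :* ((t :- r) :* b :+ k) := (t :- r) :* (e :* b) :+ e :* k) refl t r (b t) k e))
    (Poly-scale e p)

  Poly-* : ∀ {a b n m c e} → Poly a n c → Poly b m e → Poly (λ t → a t * b t) (n ℕ.+ m) (c * e)
  Poly-* {b = b} (constant {c = c} h) q = Poly-ext (λ t → cong (_* b t) (sym (h t))) (Poly-scale c q)
  Poly-* {b = b} {m = m} {e = e} (step {b = a′} {n = n} {c = c} r k h p) q =
    subst (Poly _ _) (+-identityʳ _)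
      (Poly-ext (λ t → trans (solve 5 (λ t r a b k → ((t :- r) :* (a :* b) :+ :0) :+ k :* b
                                       := ((t :- r) :* a :+ k) :* b) refl t r (a′ t) (b t) k)
                             (cong (_* b t) (sym (h t))))
        (Poly-+ (step r 0# (λ _ → refl) (Poly-* p q)) (Poly-raise-by n (Poly-scale k q))))

  -- Each zero `ι s` is split off as a linear factor. The quotient vanishes at all later
  -- `ι (k + suc s)`, where that factor is nonzero, so after n divisions only the constant `c` is
  -- left.
  Poly-vanishing : ∀ {a n c} → Poly a n c → ∀ s → (∀ k → a (ι (k ℕ.+ s)) ≡ 0#) → c ≡ 0#
  Poly-vanishing (constant h) s v = trans (sym (h _)) (v 0)
  Poly-vanishing {a} p@(step _ _ _ _) s v with Poly-divide p (ι s)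
  ... | b , q , h = Poly-vanishing q (suc s) λ k →
    *-cancelˡ-0 (gap k) (begin
      (ι (k ℕ.+ suc s) - ι s) * b (ι (k ℕ.+ suc s))               ≡⟨ +-identityʳ _ ⟨
      (ι (k ℕ.+ suc s) - ι s) * b (ι (k ℕ.+ suc s)) + 0#          ≡⟨ cong (λ z → (ι (k ℕ.+ suc s) - ι s) * b (ι (k ℕ.+ suc s)) + z) (v 0) ⟨
      (ι (k ℕ.+ suc s) - ι s) * b (ι (k ℕ.+ suc s)) + a (ι s)     ≡⟨ h _ ⟨
      a (ι (k ℕ.+ suc s))                                         ≡⟨ cong (λ j → a (ι j)) (ℕₚ.+-suc k s) ⟩
      a (ι (suc k ℕ.+ s))                                         ≡⟨ v (suc k) ⟩
      0#                                                          ∎)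
    where
    gap : ∀ k → ι (k ℕ.+ suc s) - ι s ≢ 0#
    gap k eq = ι-suc≢0 k (begin
      ι (suc k)                    ≡⟨ solve 2 (λ x y → x := (x :+ y) :- y) refl (ι (suc k)) (ι s) ⟩
      (ι (suc k) + ι s) - ι s      ≡⟨ cong (_- ι s) (ι-+ (suc k) s) ⟨
      ι (suc k ℕ.+ s) - ι s        ≡⟨ cong (λ j → ι j - ι s) (ℕₚ.+-suc k s) ⟨
      ι (k ℕ.+ suc s) - ι s        ≡⟨ eq ⟩
      0#                           ∎)

  Poly-zero : ∀ {a n c} → Poly a n c → (∀ t → a t ≡ 0#) → c ≡ 0#
  Poly-zero p v = Poly-vanishing p 0 (λ _ → v _)

  Poly-lower : ∀ {a n} → Poly a (suc n) 0# → ∃ λ c → Poly a n c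
  Poly-lower (step r k h (constant hb)) = k , constant λ t →
    trans (h t) (trans (cong (λ z → (t - r) * z + k) (hb t)) (solve 3 (λ t r k → (t :- r) :* :0 :+ k := k) refl t r k))
  Poly-lower (step r k h p@(step _ _ _ _)) with Poly-lower p
  ... | c , q = c , step r k h q

  Nonzero : (Carrier → Carrier) → ℕ → Set
  Nonzero a n = ∃ λ c → c ≢ 0# × Poly a n c

  degree : ∀ {a n c} → Poly a n c → (∀ t → a t ≡ 0#) ⊎ ∃ (Nonzero a)
  degree {n = n} {c} p with c ≟ 0#
  degree {n = n} {c} p | no c≢0 = inj₂ (n , c , c≢0 , p)
  degree (constant h) | yes refl = inj₁ h
  degree p@(step _ _ _ _) | yes refl = degree-lower p
    where
    degree-lower : ∀ {a n} → Poly a (suc n) 0# → (∀ t → a t ≡ 0#) ⊎ ∃ (Nonzero a)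
    degree-lower {a} {n} p with Poly-lower p
    ... | c , q with c ≟ 0#
    ...   | no c≢0 = inj₂ (n , c , c≢0 , q)
    degree-lower {a} {zero} p | _ , constant h | yes refl = inj₁ h
    degree-lower {a} {suc n} p | _ , q | yes refl = degree-lower q

  private
    -- For n < m the difference a - b, padded to degree m, has leading coefficient -e; it vanishes
    -- identically, so e would be zero.
    degree-≮ : ∀ {a b n m c e} → (∀ t → a t ≡ b t) → Poly a n c → Poly b m e → e ≢ 0# → ¬ n ℕ.< m
    degree-≮ {a} {b} {n} {m} {c} {e} eq p q e≢0 n<m = e≢0 (begin
      e                     ≡⟨ solve 1 (λ e → e := :0 :+ (:- :1) :* (:- :1) :* e) refl e ⟩
      0# + (- 1#) * (- 1#) * e  ≡⟨ solve 1 (λ e → :0 :+ (:- :1) :* (:- :1) :* e := (:- :1) :* (:0 :+ (:- :1) :* e)) refl e ⟩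
      (- 1#) * (0# + (- 1#) * e)  ≡⟨ cong ((- 1#) *_) (Poly-zero difference (λ t →
          trans (cong (_+ (- 1#) * b t) (eq t)) (solve 1 (λ z → z :+ (:- :1) :* z := :0) refl (b t)))) ⟩
      (- 1#) * 0#             ≡⟨ zeroʳ _ ⟩
      0#                    ∎)
      where
      difference : Poly (λ t → a t + (- 1#) * b t) m (0# + (- 1#) * e)
      difference = Poly-+ (subst (λ j → Poly a j 0#)
                     (trans (sym (ℕₚ.+-suc (m ℕ.∸ suc n) n)) (ℕₚ.m∸n+n≡m n<m))
                     (Poly-raise-by (m ℕ.∸ suc n) p)) (Poly-scale (- 1#) q)

  degree-unique : ∀ {a b n m} → (∀ t → a t ≡ b t) → Nonzero a n → Nonzero b m → n ≡ m
  degree-unique {n = n} {m} eq (c , c≢0 , p) (e , e≢0 , q) with ℕₚ.<-cmp n m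
  ... | tri< n<m _ _ = ⊥-elim (degree-≮ eq p q e≢0 n<m)
  ... | tri≈ _ n≡m _ = n≡m
  ... | tri> _ _ m<n = ⊥-elim (degree-≮ (λ t → sym (eq t)) q p c≢0 m<n)

  Nonzero-* : ∀ {a b n m} → Nonzero a n → Nonzero b m → Nonzero (λ t → a t * b t) (n ℕ.+ m)
  Nonzero-* (c , c≢0 , p) (e , e≢0 , q) = c * e , *-≢0 c≢0 e≢0 , Poly-* p q

  Nonzero-+ : ∀ {a b n m e} → Nonzero a n → Poly b m e → m ℕ.< n → Nonzero (λ t → a t + b t) n
  Nonzero-+ {a} {b} {n} {m} (c , c≢0 , p) q m<n = c + 0# , (λ eq → c≢0 (trans (sym (+-identityʳ c)) eq)) ,
    Poly-+ p (subst (λ j → Poly b j 0#)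
      (trans (sym (ℕₚ.+-suc (n ℕ.∸ suc m) m)) (ℕₚ.m∸n+n≡m m<n)) (Poly-raise-by (n ℕ.∸ suc m) q))

  IsPolynomial : (Carrier → Carrier) → Set
  IsPolynomial a = ∃₂ (Poly a)

-- Ring identities for products of point ideals

module IdealIdentities {c ℓ} (R : CommutativeRing c ℓ) where
  open CommutativeRing R renaming (refl to ≈-refl; trans to ≈-trans; sym to ≈-sym)
  open IntegerSolver R

  -- Here `L` is y - lx - m for a line, `L′` is y + lx + m and `Vᵢ` is x - xᵢ. As I_P = (V₁, L) and
  -- I_Q = (V₂, L), this puts V₃ I_P I_Q inside L (L′, V₃), and (L′, V₃) is the ideal of P + Q.
  line-forward : ∀ L L′ V₁ V₂ V₃ q₁ b₁ q₂ b₂ → L * L′ ≈ V₁ * V₂ * V₃ →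
    V₃ * ((V₁ * q₁ + L * b₁) * (V₂ * q₂ + L * b₂)) ≈
    L * (L′ * (q₁ * q₂) + V₃ * (b₁ * (V₂ * q₂ + L * b₂) + V₁ * q₁ * b₂))
  line-forward L L′ V₁ V₂ V₃ q₁ b₁ q₂ b₂ eq = ≈-trans
    (solve 8 (λ L V₁ V₂ V₃ q₁ b₁ q₂ b₂ → V₃ :* ((V₁ :* q₁ :+ L :* b₁) :* (V₂ :* q₂ :+ L :* b₂))
      := V₁ :* V₂ :* V₃ :* (q₁ :* q₂) :+ L :* (V₃ :* (b₁ :* (V₂ :* q₂ :+ L :* b₂) :+ V₁ :* q₁ :* b₂)))
      ≈-refl L V₁ V₂ V₃ q₁ b₁ q₂ b₂)
    (≈-trans (+-congʳ (*-congʳ (≈-sym eq)))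
      (solve 4 (λ L L′ q w → L :* L′ :* q :+ L :* w := L :* (L′ :* q :+ w)) ≈-refl L L′ (q₁ * q₂)
        (V₃ * (b₁ * (V₂ * q₂ + L * b₂) + V₁ * q₁ * b₂))))

  -- The converse inclusion: L (V₃, L′) is reached from V₃ times combinations of L and V₁V₂, which
  -- both lie in I_P I_Q.
  line-backward : ∀ L L′ V₁ V₂ V₃ q r → L * L′ ≈ V₁ * V₂ * V₃ →
    V₃ * (q * L + r * (V₁ * V₂)) ≈ L * (V₃ * q + L′ * r)
  line-backward L L′ V₁ V₂ V₃ q r eq = ≈-trans
    (solve 6 (λ L V₁ V₂ V₃ q r → V₃ :* (q :* L :+ r :* (V₁ :* V₂)) := L :* (V₃ :* q) :+ V₁ :* V₂ :* V₃ :* r)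
      ≈-refl L V₁ V₂ V₃ q r)
    (≈-trans (+-congˡ (*-congʳ (≈-sym eq)))
      (solve 5 (λ L L′ V₃ q r → L :* (V₃ :* q) :+ L :* L′ :* r := L :* (V₃ :* q :+ L′ :* r)) ≈-refl L L′ V₃ q r))

  -- Opposite points have the ideals (V, L) and (V, L′). The only term without a visible factor V is
  -- LL′, which the hypothesis supplies. The factor `1#` fits the shape g I = h J.
  vertical-forward : ∀ L L′ V E q₁ b₁ q₂ b₂ → L * L′ ≈ V * E →
    1# * ((V * q₁ + L * b₁) * (V * q₂ + L′ * b₂)) ≈
    V * (q₁ * (V * q₂ + L′ * b₂) + L * b₁ * q₂ + E * (b₁ * b₂))
  vertical-forward L L′ V E q₁ b₁ q₂ b₂ eq = ≈-trans
    (solve 7 (λ L L′ V q₁ b₁ q₂ b₂ → :1 :* ((V :* q₁ :+ L :* b₁) :* (V :* q₂ :+ L′ :* b₂))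
      := V :* (q₁ :* (V :* q₂ :+ L′ :* b₂) :+ L :* b₁ :* q₂) :+ L :* L′ :* (b₁ :* b₂))
      ≈-refl L L′ V q₁ b₁ q₂ b₂)
    (≈-trans (+-congˡ (*-congʳ eq))
      (solve 4 (λ V w E b → V :* w :+ V :* E :* b := V :* (w :+ E :* b)) ≈-refl V
        (q₁ * (V * q₂ + L′ * b₂) + L * b₁ * q₂) E (b₁ * b₂)))

  distribute : ∀ g u u₁ u₂ h v₁ v₂ → u ≈ u₁ + u₂ → g * u₁ ≈ h * v₁ → g * u₂ ≈ h * v₂ → g * u ≈ h * (v₁ + v₂)
  distribute g u u₁ u₂ h v₁ v₂ eq e₁ e₂ =
    ≈-trans (*-congˡ eq) (≈-trans (distribˡ g u₁ u₂) (≈-trans (+-cong e₁ e₂) (≈-sym (distribˡ h v₁ v₂))))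

  compose : ∀ g h g′ h′ u v w → g * u ≈ h * v → g′ * v ≈ h′ * w → (g * g′) * u ≈ (h * h′) * w
  compose g h g′ h′ u v w e₁ e₂ = ≈-trans
    (solve 3 (λ g g′ u → g :* g′ :* u := g′ :* (g :* u)) ≈-refl g g′ u)
    (≈-trans (*-congˡ e₁) (≈-trans
      (solve 3 (λ g′ h v → g′ :* (h :* v) := h :* (g′ :* v)) ≈-refl g′ h v)
      (≈-trans (*-congˡ e₂) (solve 3 (λ h h′ w → h :* (h′ :* w) := h :* h′ :* w) ≈-refl h h′ w))))

  multiply : ∀ g h u v k w → w ≈ u * k → g * u ≈ h * v → g * w ≈ h * (v * k)
  multiply g h u v k w eq e = ≈-trans (*-congˡ eq) (≈-trans (≈-sym (*-assoc g u k))
    (≈-trans (*-congʳ e) (*-assoc h v k)))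

  -- If the same pair g, h carries V to u and W to v, then V : W = u : v. The factor g stays in
  -- front until its nonzero norm allows it to be cancelled.
  cross : ∀ g h V u W v → g * V ≈ h * u → g * W ≈ h * v → g * (V * v + (- (u * W))) ≈ 0#
  cross g h V u W v e₁ e₂ = ≈-trans
    (solve 5 (λ g V u W v → g :* (V :* v :- u :* W) := (g :* V) :* v :- u :* (g :* W)) ≈-refl g V u W v)
    (≈-trans (+-cong (*-congʳ e₁) (-‿cong (*-congˡ e₂)))
      (solve 3 (λ h u v → (h :* u) :* v :- u :* (h :* v) := :0) ≈-refl h u v))

-- The affine curve, its coordinate ring and the norm to K[x]

data Pt (C : Set) : Set where
  O : Pt C
  pt : C → C → Pt C

module CoordinateRing (F : DiscreteField) (A B : DiscreteField.Carrier F) where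
  open DiscreteField F
  open PolynomialFunctions F
  open ≡.≡-Reasoning

  2# 3# : Carrier
  2# = 1# + 1#
  3# = (1# + 1#) + 1#

  f : Carrier → Carrier
  f x = x * (x * x) + (A * x + B)

  On : Pt Carrier → Set
  On O = ⊤
  On (pt x y) = y * y ≡ f x

  -- The slope is any solution of the cleared equation rather than a quotient, so a certificate can
  -- supply it without an inversion.
  data Slope (l x₁ y₁ x₂ y₂ : Carrier) : Set where
    chord : x₁ ≢ x₂ → l * (x₂ - x₁) ≡ y₂ - y₁ → Slope l x₁ y₁ x₂ y₂
    tangent : x₁ ≡ x₂ → y₁ ≡ y₂ → y₁ ≢ 0# → l * (2# * y₁) ≡ 3# * (x₁ * x₁) + A → Slope l x₁ y₁ x₂ y₂

  thirdX : Carrier → Carrier → Carrier → Carrier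
  thirdX l x₁ x₂ = (l * l - x₁) - x₂

  -- A relation instead of a function, so that each use names its own case and slope. Uniqueness of
  -- the result is a consequence of the ideal classes (`Sum-unique`).
  data Sum : Pt Carrier → Pt Carrier → Pt Carrier → Set where
    identityˡ : ∀ {Q} → Sum O Q Q
    identityʳ : ∀ {P} → Sum P O P
    vertical : ∀ {x y y′} → y + y′ ≡ 0# → Sum (pt x y) (pt x y′) O
    line : ∀ {x₁ y₁ x₂ y₂} l → Slope l x₁ y₁ x₂ y₂ →
           Sum (pt x₁ y₁) (pt x₂ y₂) (pt (thirdX l x₁ x₂) (l * (x₁ - thirdX l x₁ x₂) - y₁))

  IsPolynomial-+ : ∀ {a b} → IsPolynomial a → IsPolynomial b → IsPolynomial (λ t → a t + b t)
  IsPolynomial-+ {a} {b} (n , _ , p) (m , _ , q) = _ , _ ,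
    Poly-+ (Poly-raise-by m p) (subst (λ j → Poly b j 0#) (cong suc (ℕₚ.+-comm n m)) (Poly-raise-by n q))

  IsPolynomial-* : ∀ {a b} → IsPolynomial a → IsPolynomial b → IsPolynomial (λ t → a t * b t)
  IsPolynomial-* (_ , _ , p) (_ , _ , q) = _ , _ , Poly-* p q

  linear-Poly : ∀ α β → Poly (λ t → α * t + β) 1 α
  linear-Poly α β = step 0# β (λ t → solve 3 (λ α β t → α :* t :+ β := (t :- :0) :* α :+ β) refl α β t) (constant λ _ → refl)

  f-Poly : Poly f 3 1#
  f-Poly = step 0# B (λ t → solve 3 (λ A B t → t :* (t :* t) :+ (A :* t :+ B) := (t :- :0) :* (t :* t :+ A) :+ B) refl A B t)
          (step 0# A (λ t → solve 2 (λ A t → t :* t :+ A := (t :- :0) :* t :+ A) refl A t)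
          (step 0# 0# (λ t → solve 1 (λ t → t := (t :- :0) :* :1 :+ :0) refl t) (constant λ _ → refl)))

  -- The coordinate ring K[x] ⊕ K[x]y of the affine curve; polynomials are represented by the
  -- functions they define, so that an identity can be checked at each t in K[y]/(y² - f t).
  record Fn : Set where
    constructor fn
    field
      re im : Carrier → Carrier
      re-poly : IsPolynomial re
      im-poly : IsPolynomial im
  open Fn

  at : Fn → Carrier → Carrier × Carrier
  at u t = re u t , im u t

  module Fibre (t : Carrier) = Quadratic isCommutativeRing (f t)
  module Id (t : Carrier) = IdealIdentities (Fibre.commutativeRing t)
  module FibreRing (t : Carrier) = CommutativeRing (Fibre.commutativeRing t)

  infix 4 _≈_
  _≈_ : Fn → Fn → Set
  u ≈ v = ∀ t → at u t ≡ at v t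

  infixl 6 _⊞_
  infixl 7 _⊡_
  _⊞_ _⊡_ : Fn → Fn → Fn
  u ⊞ v = fn (λ t → re u t + re v t) (λ t → im u t + im v t)
             (IsPolynomial-+ (re-poly u) (re-poly v)) (IsPolynomial-+ (im-poly u) (im-poly v))
  u ⊡ v = fn (λ t → re u t * re v t + f t * (im u t * im v t)) (λ t → re u t * im v t + im u t * re v t)
             (IsPolynomial-+ (IsPolynomial-* (re-poly u) (re-poly v))
                             (IsPolynomial-* (_ , _ , f-Poly) (IsPolynomial-* (im-poly u) (im-poly v))))
             (IsPolynomial-+ (IsPolynomial-* (re-poly u) (im-poly v)) (IsPolynomial-* (im-poly u) (re-poly v)))

  neg : Fn → Fn
  neg u = fn (λ t → - re u t) (λ t → - im u t) (negPoly (re-poly u)) (negPoly (im-poly u))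
    where
    negPoly : ∀ {a} → IsPolynomial a → IsPolynomial (λ t → - a t)
    negPoly {a} (n , _ , p) = n , _ , Poly-ext (λ t → solve 1 (λ x → (:- :1) :* x := :- x) refl (a t)) (Poly-scale (- 1#) p)

  affine : Carrier → Carrier → Carrier → Fn
  affine α β e = fn (λ t → α * t + β) (λ _ → e) (_ , _ , linear-Poly α β) (_ , _ , constant λ _ → refl)

  scalar : (a : Carrier → Carrier) → IsPolynomial a → Fn
  scalar a p = fn a (λ _ → 0#) p (_ , _ , constant λ _ → refl)

  cst : Carrier → Fn
  cst k = scalar (λ _ → k) (_ , _ , constant λ _ → refl)

  vert : Carrier → Fn
  vert x = scalar (λ t → t - x) (_ , _ , step x 0# (λ t → solve 2 (λ t x → t :- x := (t :- x) :* :1 :+ :0) refl t x) (constant λ _ → refl))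

  -- y - (lx + m) and y + (lx + m)
  lineFn lineFn′ : Carrier → Carrier → Fn
  lineFn l m = affine (- l) (- m) 1#
  lineFn′ l m = affine l m 1#

  normFn : Fn → Carrier → Carrier
  normFn u t = Fibre.norm t (at u t)

  NonzeroFn : Fn → ℕ → Set
  NonzeroFn u = Nonzero (normFn u)

  NonzeroFn-⊡ : ∀ {u v n m} → NonzeroFn u n → NonzeroFn v m → NonzeroFn (u ⊡ v) (n ℕ.+ m)
  NonzeroFn-⊡ {u} {v} p q with Nonzero-* p q
  ... | c , c≢0 , r = c , c≢0 , Poly-ext (λ t → sym (Fibre.norm-* t (at u t) (at v t))) r

  normFn-cong : ∀ {u v} → u ≈ v → ∀ t → normFn u t ≡ normFn v t
  normFn-cong eq t = cong (Fibre.norm t) (eq t)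

  -- The degree n of the norm is the pole order of u = a + by at infinity, where x has order 2 and y
  -- has order 3. The constructor tells which of a and by carries the pole; its last field bounds
  -- the other one.
  data Shape (u : Fn) (n : ℕ) : Set where
    even : ∀ m → n ≡ m ℕ.+ m → Nonzero (re u) m →
           (∀ t → im u t ≡ 0#) ⊎ (∃ λ k → 3 ℕ.+ (k ℕ.+ k) ℕ.< m ℕ.+ m) → Shape u n
    odd : ∀ k → n ≡ 3 ℕ.+ (k ℕ.+ k) → Nonzero (im u) k →
          (∀ t → re u t ≡ 0#) ⊎ (∃ λ m → m ℕ.+ m ℕ.< 3 ℕ.+ (k ℕ.+ k) × Nonzero (re u) m) → Shape u n

  private
    Nonzero-ext : ∀ {a b n} → (∀ t → a t ≡ b t) → Nonzero a n → Nonzero b n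
    Nonzero-ext eq (c , c≢0 , p) = c , c≢0 , Poly-ext eq p

    f·b² : ∀ {b k} → Nonzero b k → Nonzero (λ t → - (f t * (b t * b t))) (3 ℕ.+ (k ℕ.+ k))
    f·b² {b} {k} p with Nonzero-* (1# , 1≢0 , f-Poly) (Nonzero-* p p)
    ... | c , c≢0 , q = (- 1#) * c , (λ eq → c≢0 (begin
        c                      ≡⟨ solve 1 (λ c → c := (:- :1) :* ((:- :1) :* c)) refl c ⟩
        (- 1#) * ((- 1#) * c)  ≡⟨ cong ((- 1#) *_) eq ⟩
        (- 1#) * 0#            ≡⟨ zeroʳ _ ⟩
        0#                     ∎)) ,
      Poly-ext (λ t → solve 1 (λ x → (:- :1) :* x := :- x) refl (f t * (b t * b t))) (Poly-scale (- 1#) q)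

    double≢3+double : ∀ m k → m ℕ.+ m ≢ 3 ℕ.+ (k ℕ.+ k)
    double≢3+double (suc zero) zero ()
    double≢3+double (suc (suc m)) zero eq
      with trans (sym (trans (ℕₚ.+-suc m (suc m)) (cong suc (ℕₚ.+-suc m m)))) (ℕₚ.suc-injective (ℕₚ.suc-injective eq))
    ... | ()
    double≢3+double (suc m) (suc k) eq = double≢3+double m k (ℕₚ.suc-injective (ℕₚ.suc-injective (begin
      suc (suc (m ℕ.+ m))            ≡⟨ cong suc (ℕₚ.+-suc m m) ⟨
      suc m ℕ.+ suc m                ≡⟨ eq ⟩
      3 ℕ.+ (suc k ℕ.+ suc k)        ≡⟨ cong (4 ℕ.+_) (ℕₚ.+-suc k k) ⟩
      5 ℕ.+ (k ℕ.+ k)                ∎)))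

  -- The degree of the norm a² - fb² is max(2 deg a, 3 + 2 deg b), by parity.
  classify : ∀ u → (∀ t → at u t ≡ (0# , 0#)) ⊎ ∃ λ n → NonzeroFn u n × Shape u n
  classify u with degree (proj₂ (proj₂ (re-poly u))) | degree (proj₂ (proj₂ (im-poly u)))
  ... | inj₁ a≡0 | inj₁ b≡0 = inj₁ λ t → cong₂ _,_ (a≡0 t) (b≡0 t)
  ... | inj₁ a≡0 | inj₂ (k , b) = inj₂ (_ , Nonzero-ext
          (λ t → trans (sym (+-identityˡ _)) (cong (_+ - (f t * (im u t * im u t)))
            (sym (trans (cong (λ z → z * re u t) (a≡0 t)) (zeroˡ _))))) (f·b² b)
        , odd k refl b (inj₁ a≡0))
  ... | inj₂ (m , a) | inj₁ b≡0 = inj₂ (_ , Nonzero-ext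
          (λ t → trans (solve 2 (λ a s → a :* a := a :* a :- s :* (:0 :* :0)) refl (re u t) (f t))
            (cong (λ z → re u t * re u t - f t * (z * z)) (sym (b≡0 t)))) (Nonzero-* a a)
        , even m refl a (inj₁ b≡0))
  ... | inj₂ (m , a) | inj₂ (k , b) with ℕₚ.<-cmp (m ℕ.+ m) (3 ℕ.+ (k ℕ.+ k))
  ...   | tri< lt _ _ = inj₂ (_ , Nonzero-ext (λ t → +-comm _ _)
            (Nonzero-+ (f·b² b) (proj₂ (proj₂ (Nonzero-* a a))) lt) , odd k refl b (inj₂ (m , lt , a)))
  ...   | tri≈ _ eq _ = ⊥-elim (double≢3+double m k eq)
  ...   | tri> _ _ gt = inj₂ (_ , Nonzero-+ (Nonzero-* a a) (proj₂ (proj₂ (f·b² b))) gt , even m refl a (inj₂ (k , gt)))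

-- Products of ideals and equality up to nonzero factors

module IdealClasses (F : DiscreteField) (A B : DiscreteField.Carrier F) where
  open DiscreteField F
  open PolynomialFunctions F
  open CoordinateRing F A B
  open Fn
  open ≡.≡-Reasoning

  Ideal : Set₁
  Ideal = Fn → Set

  infixl 7 _⊗_
  -- Finite sums of products. Functions with the same values may differ as elements of `Fn`, so both
  -- constructors close the product under `≈`.
  data _⊗_ (I J : Ideal) (w : Fn) : Set where
    product : ∀ {u v} → I u → J v → w ≈ u ⊡ v → (I ⊗ J) w
    sum : ∀ {u v} → (I ⊗ J) u → (I ⊗ J) v → w ≈ u ⊞ v → (I ⊗ J) w

  infix 4 _∼_
  -- gI = hJ for some nonzero g and h
  record _∼_ (I J : Ideal) : Set where
    field
      g h : Fn
      g-nonzero : ∃ (NonzeroFn g)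
      h-nonzero : ∃ (NonzeroFn h)
      forward : ∀ {u} → I u → ∃ λ v → J v × g ⊡ u ≈ h ⊡ v
      backward : ∀ {v} → J v → ∃ λ u → I u × g ⊡ u ≈ h ⊡ v

  cst-nonzero : ∀ {k} → k ≢ 0# → NonzeroFn (cst k) 0
  cst-nonzero {k} k≢0 = k * k , *-≢0 k≢0 k≢0 , constant λ t →
    solve 2 (λ k s → k :* k :- s :* (:0 :* :0) := k :* k) refl k (f t)

  vert-nonzero : ∀ x → NonzeroFn (vert x) 2
  vert-nonzero x = 1# , 1≢0 ,
    step x 0# (λ t → solve 3 (λ t x s → (t :- x) :* (t :- x) :- s :* (:0 :* :0) := (t :- x) :* (t :- x) :+ :0) refl t x (f t))
      (step x 0# (λ t → solve 2 (λ t x → t :- x := (t :- x) :* :1 :+ :0) refl t x) (constant λ _ → refl))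

  -1≢0 : - 1# ≢ 0#
  -1≢0 eq = 1≢0 (begin
    1#              ≡⟨ solve 1 (λ z → z := (:- :1) :* (:- z)) refl 1# ⟩
    (- 1#) * (- 1#) ≡⟨ cong ((- 1#) *_) eq ⟩
    (- 1#) * 0#     ≡⟨ zeroʳ _ ⟩
    0#              ∎)

  minus-f : Poly (λ t → - (f t * (1# * 1#))) 3 (- 1#)
  minus-f = subst (Poly _ 3) (*-identityʳ (- 1#))
    (Poly-ext (λ t → solve 1 (λ x → (:- :1) :* x := :- (x :* (:1 :* :1))) refl (f t)) (Poly-scale (- 1#) f-Poly))

  lineFn-nonzero : ∀ l m → NonzeroFn (lineFn l m) 3
  lineFn-nonzero l m = ext (Nonzero-+ (- 1# , -1≢0 , minus-f)
      (Poly-* (linear-Poly (- l) (- m)) (linear-Poly (- l) (- m))) ℕₚ.≤-refl)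
    where
    ext : Nonzero (λ t → - (f t * (1# * 1#)) + ((- l) * t + (- m)) * ((- l) * t + (- m))) 3 → NonzeroFn (lineFn l m) 3
    ext (c , c≢0 , p) = c , c≢0 , Poly-ext (λ t → +-comm _ _) p

  ∼-sym : ∀ {I J} → I ∼ J → J ∼ I
  ∼-sym e = record
    { g = h ; h = g ; g-nonzero = h-nonzero ; h-nonzero = g-nonzero
    ; forward = λ j → let u , i , eq = backward j in u , i , λ t → sym (eq t)
    ; backward = λ i → let v , j , eq = forward i in v , j , λ t → sym (eq t) }
    where open _∼_ e

  ∼-trans : ∀ {I J K} → I ∼ J → J ∼ K → I ∼ K
  ∼-trans e e′ = record
    { g = E.g ⊡ E′.g ; h = E.h ⊡ E′.h
    ; g-nonzero = _ , NonzeroFn-⊡ {E.g} {E′.g} (proj₂ E.g-nonzero) (proj₂ E′.g-nonzero)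
    ; h-nonzero = _ , NonzeroFn-⊡ {E.h} {E′.h} (proj₂ E.h-nonzero) (proj₂ E′.h-nonzero)
    ; forward = λ {u} i → let v , j , eq = E.forward i ; w , k , eq′ = E′.forward j in
        w , k , λ t → Id.compose t (at E.g t) (at E.h t) (at E′.g t) (at E′.h t) (at u t) (at v t) (at w t) (eq t) (eq′ t)
    ; backward = λ {w} k → let v , j , eq′ = E′.backward k ; u , i , eq = E.backward j in
        u , i , λ t → Id.compose t (at E.g t) (at E.h t) (at E′.g t) (at E′.h t) (at u t) (at v t) (at w t) (eq t) (eq′ t) }
    where
    module E = _∼_ e
    module E′ = _∼_ e′

  ⊆⊇⇒∼ : ∀ {I J : Ideal} → (∀ {u} → I u → J u) → (∀ {u} → J u → I u) → I ∼ J
  ⊆⊇⇒∼ to from = record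
    { g = cst 1# ; h = cst 1# ; g-nonzero = _ , cst-nonzero 1≢0 ; h-nonzero = _ , cst-nonzero 1≢0
    ; forward = λ i → _ , to i , λ _ → refl ; backward = λ i → _ , from i , λ _ → refl }

  ⊗-comm⊆ : ∀ {I J w} → (I ⊗ J) w → (J ⊗ I) w
  ⊗-comm⊆ (product {u} {v} i j eq) = product j i λ t → trans (eq t) (FibreRing.*-comm t (at u t) (at v t))
  ⊗-comm⊆ (sum p q eq) = sum (⊗-comm⊆ p) (⊗-comm⊆ q) eq

  ⊗-comm : ∀ {I J} → I ⊗ J ∼ J ⊗ I
  ⊗-comm = ⊆⊇⇒∼ ⊗-comm⊆ ⊗-comm⊆

  ⊗-assoc⊆ : ∀ {I J K w} → ((I ⊗ J) ⊗ K) w → (I ⊗ (J ⊗ K)) w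
  ⊗-assoc⊆ (sum p q eq) = sum (⊗-assoc⊆ p) (⊗-assoc⊆ q) eq
  ⊗-assoc⊆ {I} {J} {K} (product {v = k} ij k∈ eq) = go ij eq
    where
    go : ∀ {m w} → (I ⊗ J) m → w ≈ m ⊡ k → (I ⊗ (J ⊗ K)) w
    go {m} (product {u} {v} i j eq) eq′ = product {u = u} {v = v ⊡ k} i (product j k∈ λ _ → refl)
      λ t → trans (eq′ t) (trans (cong (λ z → Fibre._⊛_ t z (at k t)) (eq t)) (FibreRing.*-assoc t (at u t) (at v t) (at k t)))
    go {m} (sum {u} {v} p q eq) eq′ = sum {u = u ⊡ k} {v = v ⊡ k} (go p λ _ → refl) (go q λ _ → refl)
      λ t → trans (eq′ t) (trans (cong (λ z → Fibre._⊛_ t z (at k t)) (eq t)) (FibreRing.distribʳ t (at k t) (at u t) (at v t)))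

  -- The second inclusion is the first one applied twice, with the three factors rotated by
  -- commutativity.
  ⊗-assoc : ∀ {I J K} → (I ⊗ J) ⊗ K ∼ I ⊗ (J ⊗ K)
  ⊗-assoc = ⊆⊇⇒∼ ⊗-assoc⊆ λ p → ⊗-comm⊆ (⊗-assoc⊆ (⊗-comm⊆ (⊗-assoc⊆ (⊗-comm⊆ p))))

  ⊗-congʳ : ∀ {I J K} → I ∼ J → I ⊗ K ∼ J ⊗ K
  ⊗-congʳ {I} {J} {K} e = record
    { g = g ; h = h ; g-nonzero = g-nonzero ; h-nonzero = h-nonzero ; forward = fwd ; backward = bwd }
    where
    open _∼_ e
    fwd : ∀ {w} → (I ⊗ K) w → ∃ λ v → (J ⊗ K) v × g ⊡ w ≈ h ⊡ v
    fwd {w} (product {u} {k} i k∈ eq) = let v , j , e = forward i in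
      v ⊡ k , product j k∈ (λ _ → refl) , λ t → Id.multiply t (at g t) (at h t) (at u t) (at v t) (at k t) (at w t) (eq t) (e t)
    fwd {w} (sum {u₁} {u₂} p q eq) = let v₁ , p′ , e₁ = fwd p ; v₂ , q′ , e₂ = fwd q in
      v₁ ⊞ v₂ , sum p′ q′ (λ _ → refl) ,
      λ t → Id.distribute t (at g t) (at w t) (at u₁ t) (at u₂ t) (at h t) (at v₁ t) (at v₂ t) (eq t) (e₁ t) (e₂ t)
    bwd : ∀ {w} → (J ⊗ K) w → ∃ λ v → (I ⊗ K) v × g ⊡ v ≈ h ⊡ w
    bwd {w} (product {u} {k} j k∈ eq) = let v , i , e = backward j in
      v ⊡ k , product i k∈ (λ _ → refl) , λ t → sym (Id.multiply t (at h t) (at g t) (at u t) (at v t) (at k t) (at w t) (eq t) (sym (e t)))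
    bwd {w} (sum {u₁} {u₂} p q eq) = let v₁ , p′ , e₁ = bwd p ; v₂ , q′ , e₂ = bwd q in
      v₁ ⊞ v₂ , sum p′ q′ (λ _ → refl) ,
      λ t → sym (Id.distribute t (at h t) (at w t) (at u₁ t) (at u₂ t) (at g t) (at v₁ t) (at v₂ t) (eq t) (sym (e₁ t)) (sym (e₂ t)))

  ⊗-congˡ : ∀ {I J K} → I ∼ J → K ⊗ I ∼ K ⊗ J
  ⊗-congˡ e = ∼-trans ⊗-comm (∼-trans (⊗-congʳ e) ⊗-comm)

  -- The functions vanishing at a point; I O is the unit ideal.
  eval : Fn → Carrier → Carrier → Carrier
  eval u x y = re u x + im u x * y

  I : Pt Carrier → Ideal
  I O u = ⊤
  I (pt x y) u = eval u x y ≡ 0#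

  eval-⊡ : ∀ {x y} → y * y ≡ f x → ∀ u v → eval (u ⊡ v) x y ≡ eval u x y * eval v x y
  eval-⊡ {x} {y} on u v = begin
    (re u x * re v x + f x * (im u x * im v x)) + (re u x * im v x + im u x * re v x) * y
      ≡⟨ cong (λ s → (re u x * re v x + s * (im u x * im v x)) + (re u x * im v x + im u x * re v x) * y) on ⟨
    (re u x * re v x + y * y * (im u x * im v x)) + (re u x * im v x + im u x * re v x) * y
      ≡⟨ solve 5 (λ a b c e y → (a :* c :+ y :* y :* (b :* e)) :+ (a :* e :+ b :* c) :* y
          := (a :+ b :* y) :* (c :+ e :* y)) refl (re u x) (im u x) (re v x) (im v x) y ⟩
    eval u x y * eval v x y ∎

  I-⊡ˡ : ∀ P → On P → ∀ r {u} → I P u → I P (r ⊡ u)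
  I-⊡ˡ O _ r _ = tt
  I-⊡ˡ (pt x y) on r {u} i = trans (eval-⊡ on r u) (trans (cong (eval r x y *_) i) (zeroʳ _))

  I-cong : ∀ P {u v} → u ≈ v → I P u → I P v
  I-cong O eq _ = tt
  I-cong (pt x y) eq i = trans (cong (λ z → proj₁ z + proj₂ z * y) (sym (eq x))) i

  I-⊞ : ∀ P {u v} → I P u → I P v → I P (u ⊞ v)
  I-⊞ O _ _ = tt
  I-⊞ (pt x y) {u} {v} i j = begin
    (re u x + re v x) + (im u x + im v x) * y    ≡⟨ solve 5 (λ a b c e y → (a :+ c) :+ (b :+ e) :* y
                                                     := (a :+ b :* y) :+ (c :+ e :* y)) refl (re u x) (im u x) (re v x) (im v x) y ⟩
    eval u x y + eval v x y                      ≡⟨ cong₂ _+_ i j ⟩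
    0# + 0#                                      ≡⟨ +-identityˡ 0# ⟩
    0#                                           ∎

  ⊗-⊡ˡ : ∀ {P J} → On P → ∀ r {u} → (I P ⊗ J) u → (I P ⊗ J) (r ⊡ u)
  ⊗-⊡ˡ {P} on r (product {u} {v} i j eq) = product (I-⊡ˡ P on r i) j
    λ t → trans (cong (Fibre._⊛_ t (at r t)) (eq t)) (sym (FibreRing.*-assoc t (at r t) (at u t) (at v t)))
  ⊗-⊡ˡ on r (sum {u} {v} p q eq) = sum (⊗-⊡ˡ on r p) (⊗-⊡ˡ on r q)
    λ t → trans (cong (Fibre._⊛_ t (at r t)) (eq t)) (FibreRing.distribˡ t (at r t) (at u t) (at v t))

  ⊗-resp : ∀ {I J u v} → v ≈ u → (I ⊗ J) u → (I ⊗ J) v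
  ⊗-resp eq (product i j e) = product i j λ t → trans (eq t) (e t)
  ⊗-resp eq (sum p q e) = sum p q λ t → trans (eq t) (e t)

  -- Nonzero constants are units. The generators below are first found multiplied by x₂ - x₁, by 2y
  -- or by f′(x), and this removes the constant.
  ⊗-unscale : ∀ {P J κ} → On P → κ ≢ 0# → ∀ {u} → (I P ⊗ J) (cst κ ⊡ u) → (I P ⊗ J) u
  ⊗-unscale {κ = κ} on κ≢0 {u} p = ⊗-resp (λ t → cong₂ _,_
      (cancel (re u t) (im u t) (f t) (κ ⁻¹) κ (*-inverseʳ κ≢0))
      (cancel′ (re u t) (im u t) (f t) (κ ⁻¹) κ (*-inverseʳ κ≢0))) (⊗-⊡ˡ on (cst (κ ⁻¹)) p)
    where
    cancel : ∀ a b s i k → k * i ≡ 1# → a ≡ i * (k * a + s * (0# * b)) + s * (0# * (k * b + 0# * a))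
    cancel a b s i k eq = begin
      a               ≡⟨ *-identityˡ a ⟨
      1# * a          ≡⟨ cong (_* a) eq ⟨
      k * i * a       ≡⟨ solve 5 (λ a b s i k → k :* i :* a
                           := i :* (k :* a :+ s :* (:0 :* b)) :+ s :* (:0 :* (k :* b :+ :0 :* a))) refl a b s i k ⟩
      i * (k * a + s * (0# * b)) + s * (0# * (k * b + 0# * a)) ∎
    cancel′ : ∀ a b s i k → k * i ≡ 1# → b ≡ i * (k * b + 0# * a) + 0# * (k * a + s * (0# * b))
    cancel′ a b s i k eq = begin
      b               ≡⟨ *-identityˡ b ⟨
      1# * b          ≡⟨ cong (_* b) eq ⟨
      k * i * b       ≡⟨ solve 5 (λ a b s i k → k :* i :* b
                           := i :* (k :* b :+ :0 :* a) :+ :0 :* (k :* a :+ s :* (:0 :* b))) refl a b s i k ⟩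
      i * (k * b + 0# * a) + 0# * (k * a + s * (0# * b)) ∎

  divide-root : ∀ {a} → IsPolynomial a → ∀ x → a x ≡ 0# → ∃ λ b → IsPolynomial b × (∀ t → a t ≡ (t - x) * b t)
  divide-root {a} (zero , c , constant h) x ax≡0 = (λ _ → 0#) , (_ , _ , constant λ _ → refl) ,
    λ t → trans (h t) (trans (sym (h x)) (trans ax≡0 (sym (zeroʳ _))))
  divide-root {a} (suc n , c , p) x ax≡0 with Poly-divide p x
  ... | b , q , h = b , (_ , _ , q) , λ t → trans (h t) (trans (cong (λ z → (t - x) * b t + z) ax≡0) (+-identityʳ _))

  -- The ideal of a point on the line y = lx + m is generated by x - x_P and the line: replacing y
  -- by lx + m changes u by a multiple of the line and leaves a polynomial in x with the root x_P.
  decompose : ∀ l m x u → eval u x (l * x + m) ≡ 0# →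
              ∃₂ λ q b → u ≈ vert x ⊡ q ⊞ lineFn l m ⊡ b
  decompose l m x u eq with divide-root {λ t → re u t + im u t * (l * t + m)}
      (IsPolynomial-+ (re-poly u) (IsPolynomial-* (im-poly u) (_ , _ , linear-Poly l m))) x eq
  ... | q , q-poly , h = scalar q q-poly , scalar (im u) (im-poly u) , λ t → cong₂ _,_
    (begin
      re u t
        ≡⟨ solve 3 (λ a b L → a := (a :+ b :* L) :- L :* b) refl (re u t) (im u t) (l * t + m) ⟩
      (re u t + im u t * (l * t + m)) - (l * t + m) * im u t
        ≡⟨ cong (λ z → z - (l * t + m) * im u t) (h t) ⟩
      (t - x) * q t - (l * t + m) * im u t
        ≡⟨ solve 7 (λ t x q l m b s → (t :- x) :* q :- (l :* t :+ m) :* b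
             := ((t :- x) :* q :+ s :* (:0 :* :0)) :+ (((:- l) :* t :+ (:- m)) :* b :+ s :* (:1 :* :0))) refl t x (q t) l m (im u t) (f t) ⟩
      ((t - x) * q t + f t * (0# * 0#)) + (((- l) * t + (- m)) * im u t + f t * (1# * 0#)) ∎)
    (solve 6 (λ t x q l m b → b := ((t :- x) :* :0 :+ :0 :* q) :+ (((:- l) :* t :+ (:- m)) :* :0 :+ :1 :* b))
      refl t x (q t) l m (im u t))

-- The ideal class of a sum of two points

module AdditionClasses (F : DiscreteField) (A B : DiscreteField.Carrier F) where
  open DiscreteField F
  open PolynomialFunctions F
  open CoordinateRing F A B
  open IdealClasses F A B
  open Fn
  open ≡.≡-Reasoning

  -- y = lx + m meets the curve in x₁, x₂ and x₃ = l² - x₁ - x₂.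
  Meets : (l m x₁ x₂ : Carrier) → Set
  Meets l m x₁ x₂ = ∀ t → f t - (l * t + m) * (l * t + m) ≡ (t - x₁) * (t - x₂) * (t - thirdX l x₁ x₂)

  private
    Δ : (l m x₁ x₂ t : Carrier) → Carrier
    Δ l m x₁ x₂ t = (f t - (l * t + m) * (l * t + m)) - (t - x₁) * (t - x₂) * (t - thirdX l x₁ x₂)

    on-line : ∀ {x y s l m} → y * y ≡ s → y ≡ l * x + m → s - (l * x + m) * (l * x + m) ≡ 0#
    on-line {y = y} refl refl = -‿inverseʳ _

    Δ-at-x₁ : ∀ {l m x₁ x₂ y₁} → y₁ * y₁ ≡ f x₁ → y₁ ≡ l * x₁ + m → Δ l m x₁ x₂ x₁ ≡ 0#
    Δ-at-x₁ {l} {m} {x₁} {x₂} on eq = trans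
      (cong (λ z → z - (x₁ - x₁) * (x₁ - x₂) * (x₁ - thirdX l x₁ x₂)) (on-line on eq))
      (solve 3 (λ x₁ x₂ x₃ → :0 :- (x₁ :- x₁) :* (x₁ :- x₂) :* (x₁ :- x₃) := :0) refl x₁ x₂ (thirdX l x₁ x₂))

    Δ-at-x₂ : ∀ {l m x₁ x₂ y₂} → y₂ * y₂ ≡ f x₂ → y₂ ≡ l * x₂ + m → Δ l m x₁ x₂ x₂ ≡ 0#
    Δ-at-x₂ {l} {m} {x₁} {x₂} on eq = trans
      (cong (λ z → z - (x₂ - x₁) * (x₂ - x₂) * (x₂ - thirdX l x₁ x₂)) (on-line on eq))
      (solve 3 (λ x₁ x₂ x₃ → :0 :- (x₂ :- x₁) :* (x₂ :- x₂) :* (x₂ :- x₃) := :0) refl x₁ x₂ (thirdX l x₁ x₂))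

  slope-line : ∀ {l x₁ y₁ x₂ y₂} → Slope l x₁ y₁ x₂ y₂ → y₁ ≡ l * x₁ + (y₁ - l * x₁) × y₂ ≡ l * x₂ + (y₁ - l * x₁)
  slope-line {l} {x₁} {y₁} {x₂} {y₂} s = solve 3 (λ l x y → y := l :* x :+ (y :- l :* x)) refl l x₁ y₁ , second s
    where
    second : Slope l x₁ y₁ x₂ y₂ → y₂ ≡ l * x₂ + (y₁ - l * x₁)
    second (chord _ eq) = begin
      y₂                          ≡⟨ solve 2 (λ y₁ y₂ → y₂ := (y₂ :- y₁) :+ y₁) refl y₁ y₂ ⟩
      (y₂ - y₁) + y₁              ≡⟨ cong (_+ y₁) eq ⟨
      l * (x₂ - x₁) + y₁          ≡⟨ solve 4 (λ l x₁ x₂ y₁ → l :* (x₂ :- x₁) :+ y₁ := l :* x₂ :+ (y₁ :- l :* x₁)) refl l x₁ x₂ y₁ ⟩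
      l * x₂ + (y₁ - l * x₁)      ∎
    second (tangent refl refl _ _) = solve 3 (λ l x y → y := l :* x :+ (y :- l :* x)) refl l x₁ y₁

  -- Both sides of Meets are monic cubics with the same t²-coefficient, so that Δ is linear in t.
  slope-meets : ∀ {l x₁ y₁ x₂ y₂} → y₁ * y₁ ≡ f x₁ → y₂ * y₂ ≡ f x₂ →
                Slope l x₁ y₁ x₂ y₂ → Meets l (y₁ - l * x₁) x₁ x₂
  slope-meets {l} {x₁} {y₁} {x₂} {y₂} on₁ on₂ s@(chord x₁≢x₂ _) t = x-y≡0⇒x≡y (*-cancelˡ-0
    (λ eq → x₁≢x₂ (sym (x-y≡0⇒x≡y eq))) (begin
      (x₂ - x₁) * Δ l m x₁ x₂ t
        ≡⟨ solve 7 (λ l m x₁ x₂ t A B →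
             let third = (l :* l :- x₁) :- x₂
                 Δ = λ t → ((t :* (t :* t) :+ (A :* t :+ B)) :- (l :* t :+ m) :* (l :* t :+ m)) :- (t :- x₁) :* (t :- x₂) :* (t :- third)
             in (x₂ :- x₁) :* Δ t := Δ x₂ :* (t :- x₁) :+ Δ x₁ :* (x₂ :- t)) refl l m x₁ x₂ t A B ⟩
      Δ l m x₁ x₂ x₂ * (t - x₁) + Δ l m x₁ x₂ x₁ * (x₂ - t)
        ≡⟨ cong₂ (λ z w → z * (t - x₁) + w * (x₂ - t)) (Δ-at-x₂ {l} {m} {x₁} {x₂} {y₂} on₂ (proj₂ (slope-line s)))
             (Δ-at-x₁ {l} {m} {x₁} {x₂} {y₁} on₁ (proj₁ (slope-line s))) ⟩
      0# * (t - x₁) + 0# * (x₂ - t)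
        ≡⟨ solve 2 (λ u v → :0 :* u :+ :0 :* v := :0) refl (t - x₁) (x₂ - t) ⟩
      0# ∎))
    where m = y₁ - l * x₁
  slope-meets {l} {x₁} {y₁} on₁ _ s@(tangent refl refl _ eq) t = x-y≡0⇒x≡y (begin
      Δ l m x₁ x₁ t
        ≡⟨ solve 6 (λ l x₁ y₁ t A B →
             let m = y₁ :- l :* x₁
                 third = (l :* l :- x₁) :- x₁
                 Δ = λ t → ((t :* (t :* t) :+ (A :* t :+ B)) :- (l :* t :+ m) :* (l :* t :+ m)) :- (t :- x₁) :* (t :- x₁) :* (t :- third)
             in Δ t := Δ x₁ :+ (t :- x₁) :* (((:1 :+ :1 :+ :1) :* (x₁ :* x₁) :+ A) :- l :* ((:1 :+ :1) :* y₁))) refl l x₁ y₁ t A B ⟩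
      Δ l m x₁ x₁ x₁ + (t - x₁) * ((3# * (x₁ * x₁) + A) - l * (2# * y₁))
        ≡⟨ cong₂ (λ z w → z + (t - x₁) * w) (Δ-at-x₁ {l} {m} {x₁} {x₁} {y₁} on₁ (proj₁ (slope-line s))) (x≡y⇒x-y≡0 (sym eq)) ⟩
      0# + (t - x₁) * 0#
        ≡⟨ solve 1 (λ u → :0 :+ u :* :0 := :0) refl (t - x₁) ⟩
      0# ∎)
    where m = y₁ - l * x₁

  lineFn-* : ∀ {l m x₁ x₂} → Meets l m x₁ x₂ → lineFn l m ⊡ lineFn′ l m ≈ vert x₁ ⊡ vert x₂ ⊡ vert (thirdX l x₁ x₂)
  lineFn-* {l} {m} {x₁} {x₂} meets t = cong₂ _,_
    (begin
      ((- l) * t + (- m)) * (l * t + m) + f t * (1# * 1#)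
        ≡⟨ solve 4 (λ l m t s → ((:- l) :* t :+ (:- m)) :* (l :* t :+ m) :+ s :* (:1 :* :1)
             := s :- (l :* t :+ m) :* (l :* t :+ m)) refl l m t (f t) ⟩
      f t - (l * t + m) * (l * t + m)
        ≡⟨ meets t ⟩
      (t - x₁) * (t - x₂) * (t - x₃)
        ≡⟨ solve 4 (λ u v w s → u :* v :* w := (u :* v :+ s :* (:0 :* :0)) :* w :+ s :* ((u :* :0 :+ :0 :* v) :* :0))
             refl (t - x₁) (t - x₂) (t - x₃) (f t) ⟩
      ((t - x₁) * (t - x₂) + f t * (0# * 0#)) * (t - x₃) + f t * (((t - x₁) * 0# + 0# * (t - x₂)) * 0#) ∎)
    (solve 7 (λ l m t u v w s → ((:- l) :* t :+ (:- m)) :* :1 :+ :1 :* (l :* t :+ m)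
       := (u :* v :+ s :* (:0 :* :0)) :* :0 :+ (u :* :0 :+ :0 :* v) :* w) refl l m t (t - x₁) (t - x₂) (t - x₃) (f t))
    where x₃ = thirdX l x₁ x₂

  lineFn-vanishes : ∀ {l m x y} → y ≡ l * x + m → I (pt x y) (lineFn l m)
  lineFn-vanishes {l} {m} {x} refl = solve 3 (λ l m x → ((:- l) :* x :+ (:- m)) :+ :1 :* (l :* x :+ m) := :0) refl l m x

  vert-vanishes : ∀ x y → I (pt x y) (vert x)
  vert-vanishes x y = solve 2 (λ x y → (x :- x) :+ :0 :* y := :0) refl x y

  neg-vanishes : ∀ x y {u} → I (pt x y) u → I (pt x y) (neg u)
  neg-vanishes x y {u} i = begin
    - re u x + - im u x * y    ≡⟨ solve 3 (λ a b y → (:- a) :+ (:- b) :* y := (:- :1) :* (a :+ b :* y)) refl (re u x) (im u x) y ⟩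
    (- 1#) * eval u x y        ≡⟨ cong ((- 1#) *_) i ⟩
    (- 1#) * 0#                ≡⟨ zeroʳ _ ⟩
    0#                         ∎

  -- For a chord, (x₂ - x₁) L = (x - x₁) L - L (x - x₂). For a tangent, L (L + 2(lx + m)) = (x -
  -- x₁)²(x - x₃) and lx + m = y₁ + l(x - x₁), so 2y₁ L equals (x - x₁)²(x - x₃) - L² - 2l(x - x₁)
  -- L, each term of which lies in the product.
  lineFn-in-product : ∀ {l x₁ y₁ x₂ y₂} → y₁ * y₁ ≡ f x₁ → y₂ * y₂ ≡ f x₂ → Slope l x₁ y₁ x₂ y₂ →
                      (I (pt x₁ y₁) ⊗ I (pt x₂ y₂)) (lineFn l (y₁ - l * x₁))
  lineFn-in-product {l} {x₁} {y₁} {x₂} {y₂} on₁ on₂ s@(chord x₁≢x₂ _) =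
    ⊗-unscale {pt x₁ y₁} on₁ (λ eq → x₁≢x₂ (sym (x-y≡0⇒x≡y eq)))
      (sum {u = vert x₁ ⊡ L} {v = neg L ⊡ vert x₂}
           (product {u = vert x₁} {v = L} (vert-vanishes x₁ y₁) (lineFn-vanishes (proj₂ (slope-line s))) λ _ → refl)
           (product {u = neg L} {v = vert x₂} (neg-vanishes x₁ y₁ {L} (lineFn-vanishes (proj₁ (slope-line s)))) (vert-vanishes x₂ y₂) λ _ → refl)
           λ t → cong₂ _,_
             (solve 5 (λ x₁ x₂ t a s → (x₂ :- x₁) :* a :+ s :* (:0 :* :1)
               := ((t :- x₁) :* a :+ s :* (:0 :* :1)) :+ ((:- a) :* (t :- x₂) :+ s :* ((:- :1) :* :0))) refl x₁ x₂ t (re L t) (f t))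
             (solve 4 (λ x₁ x₂ t a → (x₂ :- x₁) :* :1 :+ :0 :* a
               := ((t :- x₁) :* :1 :+ :0 :* a) :+ ((:- a) :* :0 :+ (:- :1) :* (t :- x₂))) refl x₁ x₂ t (re L t)))
    where L = lineFn l (y₁ - l * x₁)
  lineFn-in-product {l} {x₁} {y₁} on₁ on₂ s@(tangent refl refl y₁≢0 _) =
    ⊗-unscale {pt x₁ y₁} on₁ (*-≢0 2≢0 y₁≢0)
      (sum {u = vert x₁ ⊡ (vert x₃ ⊡ vert x₁)} {v = (neg L ⊡ L) ⊞ ((cst (- (2# * l)) ⊡ vert x₁) ⊡ L)}
        (product {u = vert x₁} {v = vert x₃ ⊡ vert x₁} (vert-vanishes x₁ y₁) (I-⊡ˡ (pt x₁ y₁) on₁ (vert x₃) {vert x₁} (vert-vanishes x₁ y₁)) λ _ → refl)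
        (sum {u = neg L ⊡ L} {v = (cst (- (2# * l)) ⊡ vert x₁) ⊡ L}
             (product {u = neg L} {v = L} (neg-vanishes x₁ y₁ {L} L∈I) L∈I λ _ → refl)
             (product {u = cst (- (2# * l)) ⊡ vert x₁} {v = L} (I-⊡ˡ (pt x₁ y₁) on₁ (cst (- (2# * l))) {vert x₁} (vert-vanishes x₁ y₁)) L∈I λ _ → refl)
             λ _ → refl)
        λ t → cong₂ _,_
          (begin
            2# * y₁ * re L t + f t * (0# * 1#)
              ≡⟨ solve 5 (λ l x y t s → let m = y :- l :* x in
                   (:1 :+ :1) :* y :* ((:- l) :* t :+ (:- m)) :+ s :* (:0 :* :1)
                   := (s :- (l :* t :+ m) :* (l :* t :+ m))
                      :+ (((:- ((:- l) :* t :+ (:- m))) :* ((:- l) :* t :+ (:- m)) :+ s :* ((:- :1) :* :1))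
                      :+ (((:- ((:1 :+ :1) :* l)) :* (t :- x) :+ s :* (:0 :* :0)) :* ((:- l) :* t :+ (:- m))
                         :+ s :* (((:- ((:1 :+ :1) :* l)) :* :0 :+ :0 :* (t :- x)) :* :1)))) refl l x₁ y₁ t (f t) ⟩
            (f t - (l * t + (y₁ - l * x₁)) * (l * t + (y₁ - l * x₁))) + rest t
              ≡⟨ cong (_+ rest t) (slope-meets on₁ on₁ s t) ⟩
            (t - x₁) * (t - x₁) * (t - x₃) + rest t
              ≡⟨ cong (_+ rest t) (solve 3 (λ u w s → u :* u :* w
                   := u :* (w :* u :+ s :* (:0 :* :0)) :+ s :* (:0 :* (w :* :0 :+ :0 :* u))) refl (t - x₁) (t - x₃) (f t)) ⟩
            _ ∎)
          (solve 6 (λ l x y t w s → let m = y :- l :* x ; a = (:- l) :* t :+ (:- m) ; u = t :- x in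
             (:1 :+ :1) :* y :* :1 :+ :0 :* a
             := (u :* (w :* :0 :+ :0 :* u) :+ :0 :* (w :* u :+ s :* (:0 :* :0)))
                :+ (((:- a) :* :1 :+ (:- :1) :* a)
                :+ (((:- ((:1 :+ :1) :* l)) :* u :+ s :* (:0 :* :0)) :* :1 :+ ((:- ((:1 :+ :1) :* l)) :* :0 :+ :0 :* u) :* a)))
             refl l x₁ y₁ t (t - x₃) (f t)))
    where
    L = lineFn l (y₁ - l * x₁)
    x₃ = thirdX l x₁ x₁
    L∈I : I (pt x₁ y₁) L
    L∈I = lineFn-vanishes (proj₁ (slope-line s))
    rest : Carrier → Carrier
    rest t = (- re L t * re L t + f t * (- 1# * 1#))
           + ((- (2# * l) * (t - x₁) + f t * (0# * 0#)) * re L t + f t * ((- (2# * l) * 0# + 0# * (t - x₁)) * 1#))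

  On-sum : ∀ {P Q R} → On P → On Q → Sum P Q R → On R
  On-sum _ onQ identityˡ = onQ
  On-sum onP _ identityʳ = onP
  On-sum _ _ (vertical _) = tt
  On-sum on₁ on₂ (line {x₁} {y₁} {x₂} l s) = trans
    (solve 4 (λ l x₁ x₃ y₁ → (l :* (x₁ :- x₃) :- y₁) :* (l :* (x₁ :- x₃) :- y₁)
      := (l :* x₃ :+ (y₁ :- l :* x₁)) :* (l :* x₃ :+ (y₁ :- l :* x₁))) refl l x₁ x₃ y₁)
    (sym (x-y≡0⇒x≡y (trans (slope-meets on₁ on₂ s x₃)
      (solve 3 (λ x₁ x₂ x₃ → (x₃ :- x₁) :* (x₃ :- x₂) :* (x₃ :- x₃) := :0) refl x₁ x₂ x₃))))
    where x₃ = thirdX l x₁ x₂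

  -- With S = P + Q, the line L vanishes at P, Q and -S, while x - x₃ vanishes at S and -S.
  -- Comparing zeros suggests (x - x₃) I_P I_Q = L I_S, which fixes g and h.
  line-class : ∀ {l x₁ y₁ x₂ y₂} → y₁ * y₁ ≡ f x₁ → y₂ * y₂ ≡ f x₂ → Slope l x₁ y₁ x₂ y₂ →
    I (pt x₁ y₁) ⊗ I (pt x₂ y₂) ∼ I (pt (thirdX l x₁ x₂) (l * (x₁ - thirdX l x₁ x₂) - y₁))
  line-class {l} {x₁} {y₁} {x₂} {y₂} on₁ on₂ s = record
    { g = vert x₃ ; h = L ; g-nonzero = _ , vert-nonzero x₃ ; h-nonzero = _ , lineFn-nonzero l m
    ; forward = fwd ; backward = λ {v} → bwd {v} }
    where
    m = y₁ - l * x₁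
    x₃ = thirdX l x₁ x₂
    S = pt x₃ (l * (x₁ - x₃) - y₁)
    L = lineFn l m
    L′ = lineFn′ l m
    LL′ = lineFn-* {l} {m} {x₁} {x₂} (slope-meets on₁ on₂ s)
    onS : On S
    onS = On-sum {pt x₁ y₁} {pt x₂ y₂} {S} on₁ on₂ (line l s)
    L′∈I : I S L′
    L′∈I = solve 4 (λ l x₁ x₃ y₁ → (l :* x₃ :+ (y₁ :- l :* x₁)) :+ :1 :* (l :* (x₁ :- x₃) :- y₁) := :0) refl l x₁ x₃ y₁
    multiple : ∀ q {u} → I S u → I S (u ⊡ q)
    multiple q {u} i = I-cong S {q ⊡ u} {u ⊡ q} (λ t → FibreRing.*-comm t (at q t) (at u t)) (I-⊡ˡ S onS q {u} i)
    forward-product : ∀ {w} q₁ b₁ q₂ b₂ → w ≈ (vert x₁ ⊡ q₁ ⊞ L ⊡ b₁) ⊡ (vert x₂ ⊡ q₂ ⊞ L ⊡ b₂) →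
                      ∃ λ v → I S v × vert x₃ ⊡ w ≈ L ⊡ v
    forward-product {w} q₁ b₁ q₂ b₂ eq = L′ ⊡ (q₁ ⊡ q₂) ⊞ vert x₃ ⊡ rest ,
      I-⊞ S {L′ ⊡ (q₁ ⊡ q₂)} {vert x₃ ⊡ rest} (multiple (q₁ ⊡ q₂) {L′} L′∈I) (multiple rest {vert x₃} (vert-vanishes x₃ (l * (x₁ - x₃) - y₁))) ,
      λ t → trans (cong (Fibre._⊛_ t (at (vert x₃) t)) (eq t))
        (Id.line-forward t (at L t) (at L′ t) (at (vert x₁) t) (at (vert x₂) t) (at (vert x₃) t)
          (at q₁ t) (at b₁ t) (at q₂ t) (at b₂ t) (LL′ t))
      where rest = b₁ ⊡ (vert x₂ ⊡ q₂ ⊞ L ⊡ b₂) ⊞ vert x₁ ⊡ q₁ ⊡ b₂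
    fwd : ∀ {w} → (I (pt x₁ y₁) ⊗ I (pt x₂ y₂)) w → ∃ λ v → I S v × vert x₃ ⊡ w ≈ L ⊡ v
    fwd {w} (sum {u₁} {u₂} p q eq) = let v₁ , i₁ , e₁ = fwd p ; v₂ , i₂ , e₂ = fwd q in
      v₁ ⊞ v₂ , I-⊞ S {v₁} {v₂} i₁ i₂ ,
      λ t → Id.distribute t (at (vert x₃) t) (at w t) (at u₁ t) (at u₂ t) (at L t) (at v₁ t) (at v₂ t) (eq t) (e₁ t) (e₂ t)
    fwd {w} (product {u} {v} i j eq) =
      let q₁ , b₁ , e₁ = decompose l m x₁ u (trans (cong (λ y → eval u x₁ y) (sym (proj₁ (slope-line s)))) i)
          q₂ , b₂ , e₂ = decompose l m x₂ v (trans (cong (λ y → eval v x₂ y) (sym (proj₂ (slope-line s)))) j)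
      in forward-product {w} q₁ b₁ q₂ b₂ (λ t → trans (eq t) (cong₂ (Fibre._⊛_ t) (e₁ t) (e₂ t)))
    backward-element : ∀ {v} q r → v ≈ vert x₃ ⊡ q ⊞ L′ ⊡ r →
                       ∃ λ w → (I (pt x₁ y₁) ⊗ I (pt x₂ y₂)) w × vert x₃ ⊡ w ≈ L ⊡ v
    backward-element q r eq = q ⊡ L ⊞ r ⊡ (vert x₁ ⊡ vert x₂) ,
      sum {u = q ⊡ L} {v = r ⊡ (vert x₁ ⊡ vert x₂)}
        (⊗-⊡ˡ {pt x₁ y₁} on₁ q {L} (lineFn-in-product on₁ on₂ s))
        (⊗-⊡ˡ {pt x₁ y₁} on₁ r {vert x₁ ⊡ vert x₂} (product {u = vert x₁} {v = vert x₂} (vert-vanishes x₁ y₁) (vert-vanishes x₂ y₂) λ _ → refl))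
        (λ _ → refl) ,
      λ t → trans (Id.line-backward t (at L t) (at L′ t) (at (vert x₁) t) (at (vert x₂) t) (at (vert x₃) t) (at q t) (at r t) (LL′ t))
        (cong (Fibre._⊛_ t (at L t)) (sym (eq t)))
    bwd : ∀ {v} → I S v → ∃ λ w → (I (pt x₁ y₁) ⊗ I (pt x₂ y₂)) w × vert x₃ ⊡ w ≈ L ⊡ v
    bwd {v} i =
      let q , r , e = decompose (- l) (- m) x₃ v (trans (cong (λ y → eval v x₃ y)
            (solve 4 (λ l x₁ x₃ y₁ → (:- l) :* x₃ :+ (:- (y₁ :- l :* x₁)) := l :* (x₁ :- x₃) :- y₁) refl l x₁ x₃ y₁)) i)
      in backward-element {v} q r (λ t → trans (e t) (cong (λ z → Fibre._⊕_ t (Fibre._⊛_ t (at (vert x₃) t) (at q t)) (Fibre._⊛_ t z (at r t)))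
          (cong (_, 1#) (solve 3 (λ l m t → (:- (:- l)) :* t :+ (:- (:- m)) := l :* t :+ m) refl l m t))))

  module _ (nonsingular : ∀ x → f x ≡ 0# → 3# * (x * x) + A ≢ 0#) where

    -- The product is the principal ideal of V = x - x_P. With L and L′ the functions Y - y and Y +
    -- y, where Y is the coordinate function, 2yV = V L′ - L V settles y ≠ 0. For y = 0 the identity
    -- f′(x_P) V = L L′ - V (x + 2x_P) V is used, and this is where nonsingularity enters.
    vertical-class : ∀ {x y} → y * y ≡ f x → I (pt x y) ⊗ I (pt x (- y)) ∼ I O
    vertical-class {x} {y} on = record
      { g = cst 1# ; h = vert x ; g-nonzero = _ , cst-nonzero 1≢0 ; h-nonzero = _ , vert-nonzero x
      ; forward = λ p → let v , e = fwd p in v , tt , e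
      ; backward = λ {v} _ → v ⊡ vert x , ⊗-⊡ˡ {pt x y} on v {vert x} vert∈ ,
          λ t → trans (FibreRing.*-identityˡ t (at (v ⊡ vert x) t)) (FibreRing.*-comm t (at v t) (at (vert x) t)) }
      where
      L = lineFn 0# y
      L′ = lineFn 0# (- y)
      E : Fn
      E = scalar (λ t → t * t + (x * t + (x * x + A))) (IsPolynomial-+ (IsPolynomial-* id-poly id-poly)
            (_ , _ , linear-Poly x (x * x + A)))
        where
        id-poly : IsPolynomial (λ t → t)
        id-poly = _ , _ , Poly-ext (λ t → solve 1 (λ t → :1 :* t :+ :0 := t) refl t) (linear-Poly 1# 0#)
      LL′ : L ⊡ L′ ≈ vert x ⊡ E
      LL′ t = cong₂ _,_
        (begin
          ((- 0#) * t + (- y)) * ((- 0#) * t + (- - y)) + f t * (1# * 1#)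
            ≡⟨ solve 3 (λ t y s → ((:- :0) :* t :+ (:- y)) :* ((:- :0) :* t :+ (:- :- y)) :+ s :* (:1 :* :1) := s :- y :* y) refl t y (f t) ⟩
          f t - y * y
            ≡⟨ cong (λ z → f t - z) on ⟩
          f t - f x
            ≡⟨ solve 5 (λ t x A B s → ((t :* (t :* t) :+ (A :* t :+ B)) :- (x :* (x :* x) :+ (A :* x :+ B)))
                 := (t :- x) :* (t :* t :+ (x :* t :+ (x :* x :+ A))) :+ s :* (:0 :* :0)) refl t x A B (f t) ⟩
          (t - x) * (t * t + (x * t + (x * x + A))) + f t * (0# * 0#) ∎)
        (solve 4 (λ t y u w → ((:- :0) :* t :+ (:- y)) :* :1 :+ :1 :* ((:- :0) :* t :+ (:- :- y)) := u :* :0 :+ :0 :* w)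
          refl t y (t - x) (t * t + (x * t + (x * x + A))))
      fwd : ∀ {w} → (I (pt x y) ⊗ I (pt x (- y))) w → ∃ λ v → cst 1# ⊡ w ≈ vert x ⊡ v
      fwd {w} (sum {u₁} {u₂} p q eq) = let v₁ , e₁ = fwd p ; v₂ , e₂ = fwd q in
        v₁ ⊞ v₂ , λ t → Id.distribute t (at (cst 1#) t) (at w t) (at u₁ t) (at u₂ t) (at (vert x) t) (at v₁ t) (at v₂ t) (eq t) (e₁ t) (e₂ t)
      fwd {w} (product {u} {v} i j eq) =
        let q₁ , b₁ , e₁ = decompose 0# y x u (trans (cong (λ z → eval u x z) (solve 2 (λ x y → :0 :* x :+ y := y) refl x y)) i)
            q₂ , b₂ , e₂ = decompose 0# (- y) x v (trans (cong (λ z → eval v x z) (solve 2 (λ x y → :0 :* x :+ (:- y) := :- y) refl x y)) j)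
        in (q₁ ⊡ (vert x ⊡ q₂ ⊞ L′ ⊡ b₂) ⊞ L ⊡ b₁ ⊡ q₂) ⊞ E ⊡ (b₁ ⊡ b₂) ,
        λ t → trans (cong (Fibre._⊛_ t (at (cst 1#) t)) (trans (eq t) (cong₂ (Fibre._⊛_ t) (e₁ t) (e₂ t))))
          (Id.vertical-forward t (at L t) (at L′ t) (at (vert x) t) (at E t) (at q₁ t) (at b₁ t) (at q₂ t) (at b₂ t) (LL′ t))
      vanish : I (pt x y) L
      vanish = lineFn-vanishes (solve 2 (λ x y → y := :0 :* x :+ y) refl x y)
      vanish′ : I (pt x (- y)) L′
      vanish′ = lineFn-vanishes (solve 2 (λ x y → :- y := :0 :* x :+ (:- y)) refl x y)
      vert∈₁ : y ≢ 0# → (I (pt x y) ⊗ I (pt x (- y))) (vert x)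
      vert∈₁ y≢0 = ⊗-unscale {pt x y} on (*-≢0 2≢0 y≢0)
        (sum {u = vert x ⊡ L′} {v = neg L ⊡ vert x}
          (product {u = vert x} {v = L′} (vert-vanishes x y) vanish′ λ _ → refl)
          (product {u = neg L} {v = vert x} (neg-vanishes x y {L} vanish) (vert-vanishes x (- y)) λ _ → refl)
          λ t → cong₂ _,_
            (solve 4 (λ t x y s → (:1 :+ :1) :* y :* (t :- x) :+ s :* (:0 :* :0)
              := ((t :- x) :* ((:- :0) :* t :+ (:- :- y)) :+ s :* (:0 :* :1))
                 :+ ((:- ((:- :0) :* t :+ (:- y))) :* (t :- x) :+ s :* ((:- :1) :* :0))) refl t x y (f t))
            (solve 3 (λ t x y → (:1 :+ :1) :* y :* :0 :+ :0 :* (t :- x)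
              := ((t :- x) :* :1 :+ :0 :* ((:- :0) :* t :+ (:- :- y)))
                 :+ ((:- ((:- :0) :* t :+ (:- y))) :* :0 :+ (:- :1) :* (t :- x))) refl t x y))
      vert∈₂ : y ≡ 0# → (I (pt x y) ⊗ I (pt x (- y))) (vert x)
      vert∈₂ y≡0 = ⊗-unscale {pt x y} on (nonsingular x (trans (sym on) (trans (cong (_* y) y≡0) (zeroˡ y))))
        (sum {u = L ⊡ L′} {v = vert x ⊡ (W ⊡ vert x)}
          (product {u = L} {v = L′} vanish vanish′ λ _ → refl)
          (product {u = vert x} {v = W ⊡ vert x} (vert-vanishes x y)
            (I-⊡ˡ (pt x (- y)) on′ W {vert x} (vert-vanishes x (- y))) λ _ → refl)
          λ t → cong₂ _,_
            (trans (solve 4 (λ t x A s → ((:1 :+ :1 :+ :1) :* (x :* x) :+ A) :* (t :- x) :+ s :* (:0 :* :0)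
                := ((t :- x) :* (t :* t :+ (x :* t :+ (x :* x :+ A))) :+ s :* (:0 :* :0))
                   :+ ((t :- x) :* (((:- :1) :* t :+ (:- ((:1 :+ :1) :* x))) :* (t :- x) :+ s :* (:0 :* :0))
                      :+ s :* (:0 :* (((:- :1) :* t :+ (:- ((:1 :+ :1) :* x))) :* :0 :+ :0 :* (t :- x))))) refl t x A (f t))
              (cong (_+ re (vert x ⊡ (W ⊡ vert x)) t) (sym (cong proj₁ (LL′ t)))))
            (trans (solve 5 (λ t x A s w → ((:1 :+ :1 :+ :1) :* (x :* x) :+ A) :* :0 :+ :0 :* (t :- x)
                := ((t :- x) :* :0 :+ :0 :* w)
                   :+ ((t :- x) :* (((:- :1) :* t :+ (:- ((:1 :+ :1) :* x))) :* :0 :+ :0 :* (t :- x))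
                      :+ :0 :* (((:- :1) :* t :+ (:- ((:1 :+ :1) :* x))) :* (t :- x) :+ s :* (:0 :* :0)))) refl t x A (f t) (re E t))
              (cong (_+ im (vert x ⊡ (W ⊡ vert x)) t) (sym (cong proj₂ (LL′ t))))))
        where
        W = affine (- 1#) (- (2# * x)) 0#
        on′ : (- y) * (- y) ≡ f x
        on′ = trans (solve 1 (λ y → (:- y) :* (:- y) := y :* y) refl y) on
      vert∈ : (I (pt x y) ⊗ I (pt x (- y))) (vert x)
      vert∈ with y ≟ 0#
      ... | no y≢0 = vert∈₁ y≢0
      ... | yes y≡0 = vert∈₂ y≡0

    O-class : ∀ {P} → On P → I O ⊗ I P ∼ I P
    O-class {P} on = ⊆⊇⇒∼ to (λ {u} i → product {u = cst 1#} {v = u} tt i λ t → sym (FibreRing.*-identityˡ t (at u t)))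
      where
      to : ∀ {w} → (I O ⊗ I P) w → I P w
      to {w} (product {u} {v} _ j eq) = I-cong P {u ⊡ v} {w} (λ t → sym (eq t)) (I-⊡ˡ P on u {v} j)
      to {w} (sum {u} {v} p q eq) = I-cong P {u ⊞ v} {w} (λ t → sym (eq t)) (I-⊞ P {u} {v} (to p) (to q))

    sum-class : ∀ {P Q R} → On P → On Q → Sum P Q R → I P ⊗ I Q ∼ I R
    sum-class _ onQ identityˡ = O-class onQ
    sum-class onP _ identityʳ = ∼-trans ⊗-comm (O-class onP)
    sum-class on₁ on₂ (line l s) = line-class on₁ on₂ s
    sum-class {pt x y} on₁ _ (vertical {y′ = y′} eq) =
      subst (λ z → I (pt x y) ⊗ I (pt x z) ∼ I O) (sym y′≡-y) (vertical-class on₁)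
      where
      y′≡-y : y′ ≡ - y
      y′≡-y = trans (solve 2 (λ y y′ → y′ := (y :+ y′) :- y) refl y y′) (trans (cong (_- y) eq) (+-identityˡ (- y)))

-- A point is determined by the class of its ideal

module ClassInjectivity (F : DiscreteField) (A B : DiscreteField.Carrier F) where
  open DiscreteField F
  open PolynomialFunctions F
  open CoordinateRing F A B
  open IdealClasses F A B
  open AdditionClasses F A B
  open Fn
  open ≡.≡-Reasoning

  private
    suc-double : ∀ m → suc m ℕ.+ suc m ≡ suc (suc (m ℕ.+ m))
    suc-double m = cong suc (ℕₚ.+-suc m m)

    double<4⇒≤1 : ∀ m → m ℕ.+ m ℕ.< 4 → m ≡ 0 ⊎ m ≡ 1
    double<4⇒≤1 0 _ = inj₁ refl
    double<4⇒≤1 1 _ = inj₂ refl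
    double<4⇒≤1 (suc (suc m)) lt = ⊥-elim (ℕₚ.<⇒≱ lt
      (subst (4 ℕ.≤_) (sym (trans (suc-double (suc m)) (cong (2 ℕ.+_) (suc-double m)))) (s≤s (s≤s (s≤s (s≤s z≤n))))))

    <-absurd : ∀ {k n} → 3 ℕ.+ k ℕ.< n → ¬ n ℕ.< 4
    <-absurd (s≤s (s≤s (s≤s (s≤s _)))) (s≤s (s≤s (s≤s (s≤s ()))))

    Poly-linear : ∀ {a m c} → m ≡ 0 ⊎ m ≡ 1 → Poly a m c → ∃₂ λ α β → ∀ t → a t ≡ α * t + β
    Poly-linear (inj₁ refl) (constant {c = c} h) = 0# , c , λ t → trans (h t) (solve 2 (λ t c → c := :0 :* t :+ c) refl t c)
    Poly-linear (inj₂ refl) (step r k h (constant {c = c} hb)) = c , k - c * r , λ t →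
      trans (h t) (trans (cong (λ z → (t - r) * z + k) (hb t))
        (solve 4 (λ t r c k → (t :- r) :* c :+ k := c :* t :+ (k :- c :* r)) refl t r c k))

  order-1 : ∀ {u} → ¬ Shape u 1
  order-1 (even 0 () _ _)
  order-1 (even 1 () _ _)
  order-1 (even (suc (suc m)) eq _ _) with trans eq (cong suc (ℕₚ.+-suc (suc m) (suc m)))
  ... | ()
  order-1 (odd k () _ _)

  order-0 : ∀ {u} → Shape u 0 → ∃ λ c → c ≢ 0# × ∀ t → at u t ≡ (c , 0#)
  order-0 (odd k () _ _)
  order-0 (even (suc m) () _ _)
  order-0 (even 0 _ (c , c≢0 , constant h) (inj₁ b≡0)) = c , c≢0 , λ t → cong₂ _,_ (h t) (b≡0 t)
  order-0 (even 0 _ _ (inj₂ (k , lt))) = ⊥-elim (<-absurd lt (s≤s z≤n))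

  order-2 : ∀ {u} → Shape u 2 → ∀ t → im u t ≡ 0#
  order-2 (odd k () _ _)
  order-2 (even m _ _ (inj₁ b≡0)) = b≡0
  order-2 (even m eq _ (inj₂ (k , lt))) = ⊥-elim (<-absurd lt (subst (ℕ._< 4) eq (s≤s (s≤s (s≤s z≤n)))))

  -- Pole order 3 forces b to be a nonzero constant and 2 deg a < 3, so u is the equation of a line
  -- that is not vertical.
  order-3 : ∀ {u} → Shape u 3 → ∃ λ e → e ≢ 0# × ∃₂ λ α β → ∀ t → at u t ≡ (α * t + β , e)
  order-3 (even 0 () _ _)
  order-3 (even 1 () _ _)
  order-3 (even (suc (suc m)) eq _ _) with trans eq (trans (cong suc (ℕₚ.+-suc (suc m) (suc m))) (cong (λ j → suc (suc (suc j))) (ℕₚ.+-suc m m)))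
  ... | ()
  order-3 (odd (suc k) eq _ _) with trans eq (cong (4 ℕ.+_) (ℕₚ.+-suc k k))
  ... | ()
  order-3 {u} (odd 0 _ (e , e≢0 , constant h) (inj₁ a≡0)) = e , e≢0 , 0# , 0# ,
    λ t → cong₂ _,_ (trans (a≡0 t) (solve 1 (λ t → :0 := :0 :* t :+ :0) refl t)) (h t)
  order-3 {u} (odd 0 _ (e , e≢0 , constant h) (inj₂ (m , lt , _ , _ , p))) =
    let α , β , a = Poly-linear (double<4⇒≤1 m (ℕₚ.<-trans lt (s≤s (s≤s (s≤s (s≤s z≤n)))))) p
    in e , e≢0 , α , β , λ t → cong₂ _,_ (a t) (h t)

  zero⇒¬nonzero : ∀ {u n} → (∀ t → at u t ≡ (0# , 0#)) → ¬ NonzeroFn u n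
  zero⇒¬nonzero u≡0 (c , c≢0 , p) = c≢0 (Poly-zero p λ t →
    trans (cong (Fibre.norm t) (u≡0 t)) (solve 1 (λ s → :0 :* :0 :- s :* (:0 :* :0) := :0) refl (f t)))

  ⊡-zeroʳ : ∀ {h u} → (∀ t → at u t ≡ (0# , 0#)) → ∀ t → at (h ⊡ u) t ≡ (0# , 0#)
  ⊡-zeroʳ {h} u≡0 t = trans (cong (Fibre._⊛_ t (at h t)) (u≡0 t)) (FibreRing.zeroʳ t (at h t))

  ⊡-cancelˡ-zero : ∀ {g u n} → NonzeroFn g n → (∀ t → at (g ⊡ u) t ≡ (0# , 0#)) → ∀ t → at u t ≡ (0# , 0#)
  ⊡-cancelˡ-zero {g} {u} g≢0 gu≡0 with classify u
  ... | inj₁ u≡0 = u≡0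
  ... | inj₂ (_ , u≢0 , _) = ⊥-elim (zero⇒¬nonzero {g ⊡ u} gu≡0 (NonzeroFn-⊡ {g} {u} g≢0 u≢0))

  -- The orders of the four functions in an identity ga = hb.
  order-equation : ∀ {g a h b i j k} → NonzeroFn g i → NonzeroFn a j → NonzeroFn h k → g ⊡ a ≈ h ⊡ b →
                   ∃ λ l → Shape b l × i ℕ.+ j ≡ k ℕ.+ l
  order-equation {g} {a} {h} {b} g≢0 a≢0 h≢0 eq with classify b
  ... | inj₁ b≡0 = ⊥-elim (zero⇒¬nonzero {g ⊡ a} (λ t → trans (eq t) (⊡-zeroʳ {h} {b} b≡0 t)) (NonzeroFn-⊡ {g} {a} g≢0 a≢0))
  ... | inj₂ (l , b≢0 , shape) = l , shape ,
    degree-unique (normFn-cong {g ⊡ a} {h ⊡ b} eq) (NonzeroFn-⊡ {g} {a} g≢0 a≢0) (NonzeroFn-⊡ {h} {b} h≢0 b≢0)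

  private
    -- The numbers i and k are the norm degrees of g and h. The equations give nv = nu + 1, nv′ =
    -- nu′ + 1 and nu + nu′ = 4; since the degree 1 never occurs, nu cannot be 0, 1, 3 or 4.
    orders : ∀ i k {nu nv nu′ nv′} → nu ≢ 1 → nv ≢ 1 → nu′ ≢ 1 → nv′ ≢ 1 →
             i ℕ.+ 2 ≡ k ℕ.+ nu → i ℕ.+ 3 ≡ k ℕ.+ nv → k ℕ.+ 2 ≡ i ℕ.+ nu′ → k ℕ.+ 3 ≡ i ℕ.+ nv′ → nu ≡ 2 × nv ≡ 3
    orders i k {nu} {nv} {nu′} {nv′} nu≢1 nv≢1 nu′≢1 nv′≢1 e₁ e₂ e₃ e₄ = go nu nu′ nu≢1 nu′≢1 nv≡ nv′≡ total
      where
      next : ∀ i k {m n} → i ℕ.+ 2 ≡ k ℕ.+ m → i ℕ.+ 3 ≡ k ℕ.+ n → n ≡ suc m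
      next i k {m} {n} e e′ = ℕₚ.+-cancelˡ-≡ k n (suc m) (begin
        k ℕ.+ n          ≡⟨ e′ ⟨
        i ℕ.+ 3          ≡⟨ ℕₚ.+-suc i 2 ⟩
        suc (i ℕ.+ 2)    ≡⟨ cong suc e ⟩
        suc (k ℕ.+ m)    ≡⟨ ℕₚ.+-suc k m ⟨
        k ℕ.+ suc m      ∎)
      nv≡ : nv ≡ suc nu
      nv≡ = next i k e₁ e₂
      nv′≡ : nv′ ≡ suc nu′
      nv′≡ = next k i e₃ e₄
      total : nu ℕ.+ nu′ ≡ 4
      total = ℕₚ.+-cancelˡ-≡ (k ℕ.+ i) (nu ℕ.+ nu′) 4 (begin
        (k ℕ.+ i) ℕ.+ (nu ℕ.+ nu′)   ≡⟨ +-*-Solver.solve 4 (λ k i a b → (k +-*-Solver.:+ i) +-*-Solver.:+ (a +-*-Solver.:+ b)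
                                          +-*-Solver.:= (k +-*-Solver.:+ a) +-*-Solver.:+ (i +-*-Solver.:+ b)) refl k i nu nu′ ⟩
        (k ℕ.+ nu) ℕ.+ (i ℕ.+ nu′)   ≡⟨ cong₂ ℕ._+_ e₁ e₃ ⟨
        (i ℕ.+ 2) ℕ.+ (k ℕ.+ 2)      ≡⟨ +-*-Solver.solve 2 (λ k i → (i +-*-Solver.:+ +-*-Solver.con 2) +-*-Solver.:+ (k +-*-Solver.:+ +-*-Solver.con 2)
                                          +-*-Solver.:= (k +-*-Solver.:+ i) +-*-Solver.:+ +-*-Solver.con 4) refl k i ⟩
        (k ℕ.+ i) ℕ.+ 4              ∎)
      go : ∀ nu nu′ → nu ≢ 1 → nu′ ≢ 1 → nv ≡ suc nu → nv′ ≡ suc nu′ → nu ℕ.+ nu′ ≡ 4 → nu ≡ 2 × nv ≡ 3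
      go 0 _ _ _ e _ _ = ⊥-elim (nv≢1 e)
      go 1 _ ne _ _ _ _ = ⊥-elim (ne refl)
      go 2 _ _ _ e _ _ = refl , e
      go 3 1 _ ne _ _ _ = ⊥-elim (ne refl)
      go 4 0 _ _ _ e _ = ⊥-elim (nv′≢1 e)

  -- The partners u and v of x - x_P and y - y_P again have degrees 2 and 3, so u is a polynomial in
  -- x and v = αx + β + cy is a line. Comparing coefficients in (x - x_P) v = u (y - y_P) gives u =
  -- c(x - x_P) and v = c(y - y_P); both vanish at the second point.
  affine-injective : ∀ {x y x′ y′} → I (pt x y) ∼ I (pt x′ y′) → x ≡ x′ × y ≡ y′
  affine-injective {x} {y} {x′} {y′} e = go g-nonzero h-nonzero
      (forward {vert x} (vert-vanishes x y)) (forward {lineFn 0# y} (on-horizontal x y))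
      (backward {vert x′} (vert-vanishes x′ y′)) (backward {lineFn 0# y′} (on-horizontal x′ y′))
    where
    open _∼_ e
    on-horizontal : ∀ x y → I (pt x y) (lineFn 0# y)
    on-horizontal x y = lineFn-vanishes (solve 2 (λ x y → y := :0 :* x :+ y) refl x y)
    not-1 : ∀ {u n} → Shape u n → n ≢ 1
    not-1 {u} s refl = order-1 {u} s
    conclude : ∀ u v c α β → c ≢ 0# → (∀ t → im u t ≡ 0#) → (∀ t → at v t ≡ (α * t + β , c)) →
               eval u x′ y′ ≡ 0# → eval v x′ y′ ≡ 0# →
               (∀ t → at (vert x ⊡ v ⊞ neg (u ⊡ lineFn 0# y)) t ≡ (0# , 0#)) → x ≡ x′ × y ≡ y′
    conclude u v c α β c≢0 im-u v≡ u∈ v∈ vanish = sym x′≡x , x-y≡0⇒x≡y (*-cancelˡ-0 c≢0 (begin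
        c * (y - y′)
          ≡⟨ solve 6 (λ c y y′ α β x → c :* (y :- y′) := (α :* x :+ β :+ c :* y) :- ((α :* x :+ β) :+ c :* y′)) refl c y y′ α β x ⟩
        (α * x + β + c * y) - ((α * x + β) + c * y′)
          ≡⟨ cong₂ _-_ at-x at-x′ ⟩
        0# - 0#
          ≡⟨ -‿inverseʳ 0# ⟩
        0# ∎))
      where
      im-part : ∀ t → (t - x) * c ≡ re u t
      im-part t = x-y≡0⇒x≡y (begin
        (t - x) * c - re u t
          ≡⟨ solve 6 (λ t x c U A y → (t :- x) :* c :- U
               := ((t :- x) :* c :+ :0 :* A) :+ (:- (U :* :1 :+ :0 :* ((:- :0) :* t :+ (:- y))))) refl t x c (re u t) (α * t + β) y ⟩
        ((t - x) * c + 0# * (α * t + β)) + (- (re u t * 1# + 0# * ((- 0#) * t + (- y))))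
          ≡⟨ cong₂ (λ z w → ((t - x) * proj₂ z + 0# * proj₁ z) + (- (re u t * 1# + w * ((- 0#) * t + (- y))))) (v≡ t) (im-u t) ⟨
        proj₂ (at (vert x ⊡ v ⊞ neg (u ⊡ lineFn 0# y)) t)
          ≡⟨ cong proj₂ (vanish t) ⟩
        0# ∎)
      re-part : ∀ t → (t - x) * (α * t + β + c * y) ≡ 0#
      re-part t = begin
        (t - x) * (α * t + β + c * y)
          ≡⟨ solve 6 (λ t x L c y s → (t :- x) :* (L :+ c :* y)
               := ((t :- x) :* L :+ s :* (:0 :* c)) :+ (:- (((t :- x) :* c) :* ((:- :0) :* t :+ (:- y)) :+ s :* (:0 :* :1)))) refl t x (α * t + β) c y (f t) ⟩
        ((t - x) * (α * t + β) + f t * (0# * c)) + (- (((t - x) * c) * ((- 0#) * t + (- y)) + f t * (0# * 1#)))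
          ≡⟨ cong (λ z → ((t - x) * (α * t + β) + f t * (0# * c)) + (- (z * ((- 0#) * t + (- y)) + f t * (0# * 1#)))) (im-part t) ⟩
        ((t - x) * (α * t + β) + f t * (0# * c)) + (- (re u t * ((- 0#) * t + (- y)) + f t * (0# * 1#)))
          ≡⟨ cong₂ (λ z w → ((t - x) * proj₁ z + f t * (0# * proj₂ z)) + (- (re u t * ((- 0#) * t + (- y)) + f t * (w * 1#)))) (v≡ t) (im-u t) ⟨
        proj₁ (at (vert x ⊡ v ⊞ neg (u ⊡ lineFn 0# y)) t)
          ≡⟨ cong proj₁ (vanish t) ⟩
        0# ∎
      x′≡x : x′ ≡ x
      x′≡x = x-y≡0⇒x≡y (*-cancelˡ-0 c≢0 (begin
        c * (x′ - x)             ≡⟨ *-comm _ _ ⟩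
        (x′ - x) * c             ≡⟨ im-part x′ ⟩
        re u x′                  ≡⟨ solve 2 (λ a y → a := a :+ :0 :* y) refl (re u x′) y′ ⟩
        re u x′ + 0# * y′        ≡⟨ cong (λ z → re u x′ + z * y′) (im-u x′) ⟨
        eval u x′ y′             ≡⟨ u∈ ⟩
        0#                       ∎))
      -- The value at x of a linear function that vanishes at x + 1 and x + 2.
      at-x : α * x + β + c * y ≡ 0#
      at-x = begin
        α * x + β + c * y
          ≡⟨ solve 5 (λ x α β c y → α :* x :+ β :+ c :* y
               := (:1 :+ :1) :* ((x :+ :1 :- x) :* (α :* (x :+ :1) :+ β :+ c :* y)) :- (α :* (x :+ (:1 :+ :1)) :+ β :+ c :* y)) refl x α β c y ⟩
        2# * ((x + 1# - x) * (α * (x + 1#) + β + c * y)) - (α * (x + 2#) + β + c * y)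
          ≡⟨ cong₂ (λ z w → 2# * z - w) (re-part (x + 1#)) (*-cancelˡ-0 2≢0
               (trans (cong (_* (α * (x + 2#) + β + c * y)) (solve 1 (λ x → :1 :+ :1 := x :+ (:1 :+ :1) :- x) refl x)) (re-part (x + 2#)))) ⟩
        2# * 0# - 0#
          ≡⟨ solve 0 ((:1 :+ :1) :* :0 :- :0 := :0) refl ⟩
        0# ∎
      at-x′ : (α * x + β) + c * y′ ≡ 0#
      at-x′ = trans (cong (λ z → (α * z + β) + c * y′) (sym x′≡x))
        (trans (cong (λ z → proj₁ z + proj₂ z * y′) (sym (v≡ x′))) v∈)

    go : ∃ (NonzeroFn g) → ∃ (NonzeroFn h) →
         (∃ λ u → I (pt x′ y′) u × g ⊡ vert x ≈ h ⊡ u) → (∃ λ v → I (pt x′ y′) v × g ⊡ lineFn 0# y ≈ h ⊡ v) →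
         (∃ λ u → I (pt x y) u × g ⊡ u ≈ h ⊡ vert x′) → (∃ λ v → I (pt x y) v × g ⊡ v ≈ h ⊡ lineFn 0# y′) →
         x ≡ x′ × y ≡ y′
    go (i , g≢0) (k , h≢0) (u , u∈ , eu) (v , v∈ , ev) (u′ , _ , eu′) (v′ , _ , ev′) = go′
        (order-equation {g} {vert x} {h} {u} g≢0 (vert-nonzero x) h≢0 eu)
        (order-equation {g} {lineFn 0# y} {h} {v} g≢0 (lineFn-nonzero 0# y) h≢0 ev)
        (order-equation {h} {vert x′} {g} {u′} h≢0 (vert-nonzero x′) g≢0 (λ t → sym (eu′ t)))
        (order-equation {h} {lineFn 0# y′} {g} {v′} h≢0 (lineFn-nonzero 0# y′) g≢0 (λ t → sym (ev′ t)))
      where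
      finish : ∃ (λ c → c ≢ 0# × ∃₂ λ α β → ∀ t → at v t ≡ (α * t + β , c)) → (∀ t → im u t ≡ 0#) → x ≡ x′ × y ≡ y′
      finish (c , c≢0 , α , β , v≡) im-u = conclude u v c α β c≢0 im-u v≡ u∈ v∈
         (⊡-cancelˡ-zero {g} {vert x ⊡ v ⊞ neg (u ⊡ lineFn 0# y)} g≢0
           (λ t → Id.cross t (at g t) (at h t) (at (vert x) t) (at u t) (at (lineFn 0# y) t) (at v t) (eu t) (ev t)))
      go′ : (∃ λ n → Shape u n × i ℕ.+ 2 ≡ k ℕ.+ n) → (∃ λ n → Shape v n × i ℕ.+ 3 ≡ k ℕ.+ n) →
            (∃ λ n → Shape u′ n × k ℕ.+ 2 ≡ i ℕ.+ n) → (∃ λ n → Shape v′ n × k ℕ.+ 3 ≡ i ℕ.+ n) → x ≡ x′ × y ≡ y′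
      go′ (_ , su , nu) (_ , sv , nv) (_ , su′ , nu′) (_ , sv′ , nv′) =
        finish (order-3 {v} (subst (Shape v) (proj₂ sizes) sv)) (order-2 {u} (subst (Shape u) (proj₁ sizes) su))
        where sizes = orders i k (not-1 {u} su) (not-1 {v} sv) (not-1 {u′} su′) (not-1 {v′} sv′) nu nv nu′ nv′

  -- With w the partner of 1, the degrees satisfy deg w + deg u = 2 and deg w + deg v = 3. As 1 is
  -- never a degree, deg w = 0; then w is a nonzero constant and cannot vanish at the point.
  affine≁O : ∀ {x y} → ¬ I (pt x y) ∼ I O
  affine≁O {x} {y} e = go g-nonzero h-nonzero (forward {vert x} (vert-vanishes x y))
      (forward {lineFn 0# y} (lineFn-vanishes (solve 2 (λ x y → y := :0 :* x :+ y) refl x y))) (backward {cst 1#} tt)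
    where
    open _∼_ e
    absurd : ∀ w {u v nu nv nw} → Shape u nu → Shape v nv → Shape w nw → eval w x y ≡ 0# → ∀ i k →
             i ℕ.+ 2 ≡ k ℕ.+ nu → i ℕ.+ 3 ≡ k ℕ.+ nv → k ℕ.+ 0 ≡ i ℕ.+ nw → ⊥
    absurd w {u} {v} {nu} {nv} {nw} su sv sw w∈ i k e₁ e₂ e₃ = go nw refl
      where
      sum-to : ∀ {n m} → i ℕ.+ n ≡ k ℕ.+ m → nw ℕ.+ m ≡ n
      sum-to {n} {m} e = ℕₚ.+-cancelˡ-≡ i (nw ℕ.+ m) n (begin
        i ℕ.+ (nw ℕ.+ m)   ≡⟨ ℕₚ.+-assoc i nw m ⟨
        (i ℕ.+ nw) ℕ.+ m   ≡⟨ cong (ℕ._+ m) e₃ ⟨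
        (k ℕ.+ 0) ℕ.+ m    ≡⟨ cong (ℕ._+ m) (ℕₚ.+-identityʳ k) ⟩
        k ℕ.+ m            ≡⟨ e ⟨
        i ℕ.+ n            ∎)
      too-big : ∀ n m → suc (suc (suc n)) ℕ.+ m ≢ 2
      too-big n m ()
      go : ∀ n → nw ≡ n → ⊥
      go 0 refl = let c , c≢0 , w≡ = order-0 {w} sw in c≢0 (begin
        c                 ≡⟨ solve 2 (λ c y → c := c :+ :0 :* y) refl c y ⟩
        c + 0# * y        ≡⟨ cong (λ z → proj₁ z + proj₂ z * y) (w≡ x) ⟨
        eval w x y        ≡⟨ w∈ ⟩
        0#                ∎)
      go 1 refl = order-1 {w} sw
      go 2 refl = order-1 {v} (subst (Shape v) (ℕₚ.suc-injective (ℕₚ.suc-injective (sum-to e₂))) sv)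
      go (suc (suc (suc n))) refl = too-big n nu (sum-to e₁)

    go : ∃ (NonzeroFn g) → ∃ (NonzeroFn h) → (∃ λ u → ⊤ × g ⊡ vert x ≈ h ⊡ u) →
         (∃ λ v → ⊤ × g ⊡ lineFn 0# y ≈ h ⊡ v) → (∃ λ w → I (pt x y) w × g ⊡ w ≈ h ⊡ cst 1#) → ⊥
    go (i , g≢0) (k , h≢0) (u , _ , eu) (v , _ , ev) (w , w∈ , ew) = go′
        (order-equation {g} {vert x} {h} {u} g≢0 (vert-nonzero x) h≢0 eu)
        (order-equation {g} {lineFn 0# y} {h} {v} g≢0 (lineFn-nonzero 0# y) h≢0 ev)
        (order-equation {h} {cst 1#} {g} {w} h≢0 (cst-nonzero 1≢0) g≢0 (λ t → sym (ew t)))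
      where
      go′ : (∃ λ n → Shape u n × i ℕ.+ 2 ≡ k ℕ.+ n) → (∃ λ n → Shape v n × i ℕ.+ 3 ≡ k ℕ.+ n) →
            (∃ λ n → Shape w n × k ℕ.+ 0 ≡ i ℕ.+ n) → ⊥
      go′ (_ , su , nu) (_ , sv , nv) (_ , sw , nw) = absurd w {u} {v} su sv sw w∈ i k nu nv nw

  class-injective : ∀ {P Q} → I P ∼ I Q → P ≡ Q
  class-injective {O} {O} _ = refl
  class-injective {O} {pt x y} e = ⊥-elim (affine≁O (∼-sym e))
  class-injective {pt x y} {O} e = ⊥-elim (affine≁O e)
  class-injective {pt x y} {pt x′ y′} e = cong₂ pt (proj₁ (affine-injective e)) (proj₂ (affine-injective e))

  module _ (nonsingular : ∀ x → f x ≡ 0# → 3# * (x * x) + A ≢ 0#) where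

    Sum-unique : ∀ {P Q R R′} → On P → On Q → Sum P Q R → Sum P Q R′ → R ≡ R′
    Sum-unique onP onQ s s′ = class-injective (∼-trans (∼-sym (sum-class nonsingular onP onQ s)) (sum-class nonsingular onP onQ s′))

    Sum-comm : ∀ {P Q R R′} → On P → On Q → Sum P Q R → Sum Q P R′ → R ≡ R′
    Sum-comm onP onQ s s′ = class-injective (∼-trans (∼-sym (sum-class nonsingular onP onQ s))
      (∼-trans ⊗-comm (sum-class nonsingular onQ onP s′)))

    Sum-assoc : ∀ {P Q R PQ QR S S′} → On P → On Q → On R →
                Sum P Q PQ → Sum PQ R S → Sum Q R QR → Sum P QR S′ → S ≡ S′
    Sum-assoc {P} {Q} {R} onP onQ onR pq pq+r qr p+qr = class-injective
      (∼-trans (∼-sym (sum-class nonsingular (On-sum onP onQ pq) onR pq+r))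
      (∼-trans (∼-sym (⊗-congʳ (sum-class nonsingular onP onQ pq)))
      (∼-trans ⊗-assoc
      (∼-trans (⊗-congˡ (sum-class nonsingular onQ onR qr))
               (sum-class nonsingular onP (On-sum onQ onR qr) p+qr)))))

-- Power classes and the Kummer map at a 2-torsion point

module PowerClasses (F : DiscreteField) where
  open DiscreteField F
  open ≡.≡-Reasoning

  infixr 8 _^_
  _^_ : Carrier → ℕ → Carrier
  x ^ zero = 1#
  x ^ suc n = x * x ^ n

  ^-distrib-* : ∀ x y n → (x * y) ^ n ≡ x ^ n * y ^ n
  ^-distrib-* x y zero = sym (*-identityˡ 1#)
  ^-distrib-* x y (suc n) = trans (cong (x * y *_) (^-distrib-* x y n))
    (solve 4 (λ x y a b → x :* y :* (a :* b) := x :* a :* (y :* b)) refl x y (x ^ n) (y ^ n))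

  1^ : ∀ n → 1# ^ n ≡ 1#
  1^ zero = refl
  1^ (suc n) = trans (*-identityˡ _) (1^ n)

  infix 4 _≈[_]_
  -- Equality in K* / K*ⁿ
  record _≈[_]_ (a : Carrier) (n : ℕ) (b : Carrier) : Set where
    constructor powers
    field
      u v : Carrier
      u≢0 : u ≢ 0#
      v≢0 : v ≢ 0#
      equation : a * u ^ n ≡ b * v ^ n

  module _ {n : ℕ} where

    ≈-reflexive : ∀ {a b} → a ≡ b → a ≈[ n ] b
    ≈-reflexive refl = powers 1# 1# 1≢0 1≢0 refl

    ≈-sym : ∀ {a b} → a ≈[ n ] b → b ≈[ n ] a
    ≈-sym (powers u v u≢0 v≢0 eq) = powers v u v≢0 u≢0 (sym eq)

    ≈-trans : ∀ {a b c} → a ≈[ n ] b → b ≈[ n ] c → a ≈[ n ] c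
    ≈-trans {a} {b} {c} (powers u v u≢0 v≢0 eq) (powers u′ v′ u′≢0 v′≢0 eq′) =
      powers (u * u′) (v * v′) (*-≢0 u≢0 u′≢0) (*-≢0 v≢0 v′≢0) (begin
        a * (u * u′) ^ n           ≡⟨ cong (a *_) (^-distrib-* u u′ n) ⟩
        a * (u ^ n * u′ ^ n)       ≡⟨ *-assoc _ _ _ ⟨
        a * u ^ n * u′ ^ n         ≡⟨ cong (_* u′ ^ n) eq ⟩
        b * v ^ n * u′ ^ n         ≡⟨ solve 3 (λ b v u → b :* v :* u := v :* (b :* u)) refl b (v ^ n) (u′ ^ n) ⟩
        v ^ n * (b * u′ ^ n)       ≡⟨ cong (v ^ n *_) eq′ ⟩
        v ^ n * (c * v′ ^ n)       ≡⟨ solve 3 (λ v c w → v :* (c :* w) := c :* (v :* w)) refl (v ^ n) c (v′ ^ n) ⟩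
        c * (v ^ n * v′ ^ n)       ≡⟨ cong (c *_) (^-distrib-* v v′ n) ⟨
        c * (v * v′) ^ n           ∎)

    ≈-* : ∀ {a b c e} → a ≈[ n ] b → c ≈[ n ] e → a * c ≈[ n ] (b * e)
    ≈-* {a} {b} {c} {e} (powers u v u≢0 v≢0 eq) (powers u′ v′ u′≢0 v′≢0 eq′) =
      powers (u * u′) (v * v′) (*-≢0 u≢0 u′≢0) (*-≢0 v≢0 v′≢0) (begin
        a * c * (u * u′) ^ n          ≡⟨ cong (a * c *_) (^-distrib-* u u′ n) ⟩
        a * c * (u ^ n * u′ ^ n)      ≡⟨ solve 4 (λ a c u w → a :* c :* (u :* w) := (a :* u) :* (c :* w)) refl a c (u ^ n) (u′ ^ n) ⟩
        (a * u ^ n) * (c * u′ ^ n)    ≡⟨ cong₂ _*_ eq eq′ ⟩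
        (b * v ^ n) * (e * v′ ^ n)    ≡⟨ solve 4 (λ a c u w → (a :* u) :* (c :* w) := a :* c :* (u :* w)) refl b e (v ^ n) (v′ ^ n) ⟩
        b * e * (v ^ n * v′ ^ n)      ≡⟨ cong (b * e *_) (^-distrib-* v v′ n) ⟨
        b * e * (v * v′) ^ n          ∎)

    power≈1 : ∀ {x} → x ≢ 0# → (x ^ n) ≈[ n ] 1#
    power≈1 {x} x≢0 = powers 1# x 1≢0 x≢0
      (trans (cong (x ^ n *_) (1^ n)) (trans (*-identityʳ _) (sym (*-identityˡ _))))

    ≈1⇒power : ∀ {a} → a ≈[ n ] 1# → ∃ λ w → w ^ n ≡ a
    ≈1⇒power {a} (powers u v u≢0 v≢0 eq) = v * u ⁻¹ , (begin
      (v * u ⁻¹) ^ n               ≡⟨ ^-distrib-* v (u ⁻¹) n ⟩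
      v ^ n * (u ⁻¹) ^ n           ≡⟨ cong (_* (u ⁻¹) ^ n) (trans eq (*-identityˡ _)) ⟨
      a * u ^ n * (u ⁻¹) ^ n       ≡⟨ *-assoc _ _ _ ⟩
      a * (u ^ n * (u ⁻¹) ^ n)     ≡⟨ cong (a *_) (^-distrib-* u (u ⁻¹) n) ⟨
      a * (u * u ⁻¹) ^ n           ≡⟨ cong (λ z → a * z ^ n) (*-inverseʳ u≢0) ⟩
      a * 1# ^ n                   ≡⟨ cong (a *_) (1^ n) ⟩
      a * 1#                       ≡⟨ *-identityʳ a ⟩
      a                            ∎)

module KummerMaps (F : DiscreteField) (A B : DiscreteField.Carrier F) where
  open DiscreteField F
  open CoordinateRing F A B using (f; On; Slope; chord; tangent; Sum; thirdX; 2#; 3#; identityˡ; identityʳ; vertical; line)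
  open AdditionClasses F A B using (Meets; slope-line; slope-meets; On-sum)
  open PowerClasses F
  open ≡.≡-Reasoning

  -- A homomorphism from the points to K* / K*ⁿ.
  record Kummer (n : ℕ) : Set where
    field
      χ : Pt Carrier → Carrier
      χ-O : χ O ≡ 1#
      χ-≢0 : ∀ P → On P → χ P ≢ 0#
      χ-sum : ∀ {P Q R} → On P → On Q → Sum P Q R → (χ P * χ Q) ≈[ n ] χ R

  df : Carrier → Carrier
  df x = 3# * (x * x) + A

  -- The derivative of the hypothesis at t = a. The cubic terms cancel, so the difference of the two
  -- sides is quadratic in t and its central difference over a - 1 and a + 1 is exactly twice its
  -- derivative.
  derivative : ∀ {l m a b c} → (∀ t → f t - (l * t + m) * (l * t + m) ≡ (t - a) * (t - b) * (t - c)) →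
               df a - 2# * (l * (l * a + m)) ≡ (a - b) * (a - c)
  derivative {l} {m} {a} {b} {c} meets = x-y≡0⇒x≡y (*-cancelˡ-0 2≢0 (begin
    2# * ((df a - 2# * (l * (l * a + m))) - (a - b) * (a - c))
      ≡⟨ solve 7 (λ l m a b c A B →
           let D = λ t → ((t :* (t :* t) :+ (A :* t :+ B)) :- (l :* t :+ m) :* (l :* t :+ m)) :- (t :- a) :* (t :- b) :* (t :- c)
           in (:1 :+ :1) :* ((((:1 :+ :1 :+ :1) :* (a :* a) :+ A) :- (:1 :+ :1) :* (l :* (l :* a :+ m))) :- (a :- b) :* (a :- c))
              := D (a :+ :1) :- D (a :- :1)) refl l m a b c A B ⟩
    difference (a + 1#) - difference (a - 1#)
      ≡⟨ cong₂ _-_ (x≡y⇒x-y≡0 (meets (a + 1#))) (x≡y⇒x-y≡0 (meets (a - 1#))) ⟩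
    0# - 0#
      ≡⟨ -‿inverseʳ 0# ⟩
    0# ∎))
    where
    difference : Carrier → Carrier
    difference t = (f t - (l * t + m) * (l * t + m)) - (t - a) * (t - b) * (t - c)

  private
    square-0 : ∀ {y} → y * y ≡ 0# → y ≡ 0#
    square-0 {y} eq with y ≟ 0#
    ... | yes y≡0 = y≡0
    ... | no y≢0 = *-cancelˡ-0 y≢0 eq

    sub-≢0 : ∀ {x y} → x ≢ y → x - y ≢ 0#
    sub-≢0 x≢y eq = x≢y (x-y≡0⇒x≡y eq)

  two-torsion : ∀ {S} → On S → Sum S S O → S ≡ O ⊎ ∃ λ x → S ≡ pt x 0# × f x ≡ 0#
  two-torsion {O} _ _ = inj₁ refl
  two-torsion {pt x y} on (vertical 2y≡0) = inj₂ (x , cong (pt x) y≡0 , trans (sym on) (trans (cong (_* y) y≡0) (zeroˡ y)))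
    where
    y≡0 : y ≡ 0#
    y≡0 = *-cancelˡ-0 2≢0 (trans (solve 1 (λ y → (:1 :+ :1) :* y := y :+ y) refl y) 2y≡0)

  module Square (e : Carrier) (fe≡0 : f e ≡ 0#) (dfe≢0 : df e ≢ 0#) where

    -- At (e , 0) the function x - e vanishes. Where y is nonzero it agrees modulo squares with f /
    -- (x - e), whose value at e is f′(e). The decision is an argument so that proofs can match on
    -- it.
    χ′ : ∀ {x} → Dec (x ≡ e) → Carrier
    χ′ (yes _) = df e
    χ′ {x} (no _) = x - e

    χ : Pt Carrier → Carrier
    χ O = 1#
    χ (pt x y) = χ′ (x ≟ e)

    χ-≢0 : ∀ P → χ P ≢ 0#
    χ-≢0 O = 1≢0
    χ-≢0 (pt x y) with x ≟ e
    ... | yes _ = dfe≢0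
    ... | no x≢e = sub-≢0 x≢e

    -- Setting t = e in the factorisation shows that the product of the three values x₁ - e, x₂ - e,
    -- x₃ - e is (le + m)².
    line-case : ∀ l m x₁ x₂ x₃ →
      (∀ t → f t - (l * t + m) * (l * t + m) ≡ (t - x₁) * (t - x₂) * (t - x₃)) →
      ((d₁ : Dec (x₁ ≡ e)) (d₂ : Dec (x₂ ≡ e)) (d₃ : Dec (x₃ ≡ e)) → (χ′ d₁ * χ′ d₂) ≈[ 2 ] χ′ d₃)
    line-case l m x₁ x₂ x₃ meets = cases
      where
      at-e : (x₁ - e) * (x₂ - e) * (x₃ - e) ≡ (l * e + m) * (l * e + m)
      at-e = begin
        (x₁ - e) * (x₂ - e) * (x₃ - e)
          ≡⟨ solve 4 (λ a b c e → (a :- e) :* (b :- e) :* (c :- e) := :- ((e :- a) :* (e :- b) :* (e :- c))) refl x₁ x₂ x₃ e ⟩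
        - ((e - x₁) * (e - x₂) * (e - x₃))
          ≡⟨ cong -_ (meets e) ⟨
        - (f e - (l * e + m) * (l * e + m))
          ≡⟨ cong (λ z → - (z - (l * e + m) * (l * e + m))) fe≡0 ⟩
        - (0# - (l * e + m) * (l * e + m))
          ≡⟨ solve 1 (λ z → :- (:0 :- z) := z) refl ((l * e + m) * (l * e + m)) ⟩
        (l * e + m) * (l * e + m) ∎
      -- If one of the three points is (e , 0), the other two satisfy (a - e)(b - e) = f′(e).
      through-e : (x₁ - e) * (x₂ - e) * (x₃ - e) ≡ 0# → ∀ b c →
                  (∀ t → f t - (l * t + m) * (l * t + m) ≡ (t - e) * (t - b) * (t - c)) → df e ≡ (b - e) * (c - e)
      through-e z b c meets′ = begin
        df e
          ≡⟨ solve 2 (λ d l → d := d :- (:1 :+ :1) :* (l :* :0)) refl (df e) l ⟩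
        df e - 2# * (l * 0#)
          ≡⟨ cong (λ w → df e - 2# * (l * w)) (square-0 (trans (sym at-e) z)) ⟨
        df e - 2# * (l * (l * e + m))
          ≡⟨ derivative meets′ ⟩
        (e - b) * (e - c)
          ≡⟨ solve 3 (λ e b c → (e :- b) :* (e :- c) := (b :- e) :* (c :- e)) refl e b c ⟩
        (b - e) * (c - e) ∎
      cases : (d₁ : Dec (x₁ ≡ e)) (d₂ : Dec (x₂ ≡ e)) (d₃ : Dec (x₃ ≡ e)) → (χ′ d₁ * χ′ d₂) ≈[ 2 ] χ′ d₃
      cases (yes refl) d₂ d₃ = case₁ d₂ d₃
        where
        eq : df e ≡ (x₂ - e) * (x₃ - e)
        eq = through-e (solve 3 (λ e b c → (e :- e) :* (b :- e) :* (c :- e) := :0) refl e x₂ x₃) x₂ x₃ meets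
        ne : (x₂ - e) * (x₃ - e) ≢ 0#
        ne z = dfe≢0 (trans eq z)
        case₁ : (d₂ : Dec (x₂ ≡ e)) (d₃ : Dec (x₃ ≡ e)) → (df e * χ′ d₂) ≈[ 2 ] χ′ d₃
        case₁ (yes refl) _ = ⊥-elim (ne (solve 2 (λ e c → (e :- e) :* (c :- e) := :0) refl e x₃))
        case₁ (no _) (yes refl) = ⊥-elim (ne (solve 2 (λ e b → (b :- e) :* (e :- e) := :0) refl e x₂))
        case₁ (no x₂≢e) (no _) = powers 1# (x₂ - e) 1≢0 (sub-≢0 x₂≢e) (trans (cong (λ z → z * (x₂ - e) * (1# ^ 2)) eq)
          (solve 2 (λ b c → b :* c :* b :* (:1 :* (:1 :* :1)) := c :* (b :* (b :* :1))) refl (x₂ - e) (x₃ - e)))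
      cases (no x₁≢e) (yes refl) d₃ = case₂ d₃
        where
        eq : df e ≡ (x₁ - e) * (x₃ - e)
        eq = through-e (solve 3 (λ e a c → (a :- e) :* (e :- e) :* (c :- e) := :0) refl e x₁ x₃) x₁ x₃
          (λ t → trans (meets t) (solve 4 (λ t a e c → (t :- a) :* (t :- e) :* (t :- c) := (t :- e) :* (t :- a) :* (t :- c)) refl t x₁ e x₃))
        case₂ : (d₃ : Dec (x₃ ≡ e)) → ((x₁ - e) * df e) ≈[ 2 ] χ′ d₃
        case₂ (yes refl) = ⊥-elim (dfe≢0 (trans eq (solve 2 (λ e b → (b :- e) :* (e :- e) := :0) refl e x₁)))
        case₂ (no _) = powers 1# (x₁ - e) 1≢0 (sub-≢0 x₁≢e) (trans (cong (λ z → (x₁ - e) * z * (1# ^ 2)) eq)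
          (solve 2 (λ b c → b :* (b :* c) :* (:1 :* (:1 :* :1)) := c :* (b :* (b :* :1))) refl (x₁ - e) (x₃ - e)))
      cases (no _) (no _) (yes refl) = ≈-reflexive (sym (through-e
        (solve 3 (λ e a b → (a :- e) :* (b :- e) :* (e :- e) := :0) refl e x₁ x₂) x₁ x₂
        (λ t → trans (meets t) (solve 4 (λ t a b e → (t :- a) :* (t :- b) :* (t :- e) := (t :- e) :* (t :- a) :* (t :- b)) refl t x₁ x₂ e))))
      cases (no x₁≢e) (no x₂≢e) (no x₃≢e) = powers (x₃ - e) (l * e + m) (sub-≢0 x₃≢e)
        (λ z → *-≢0 (*-≢0 (sub-≢0 x₁≢e) (sub-≢0 x₂≢e)) (sub-≢0 x₃≢e)
          (trans at-e (trans (cong (_* (l * e + m)) z) (zeroˡ _))))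
        (begin
          (x₁ - e) * (x₂ - e) * ((x₃ - e) ^ 2)
            ≡⟨ solve 3 (λ a b c → a :* b :* (c :* (c :* :1)) := c :* (a :* b :* c)) refl (x₁ - e) (x₂ - e) (x₃ - e) ⟩
          (x₃ - e) * ((x₁ - e) * (x₂ - e) * (x₃ - e))
            ≡⟨ cong ((x₃ - e) *_) at-e ⟩
          (x₃ - e) * ((l * e + m) * (l * e + m))
            ≡⟨ solve 2 (λ c w → c :* (w :* w) := c :* (w :* (w :* :1))) refl (x₃ - e) (l * e + m) ⟩
          (x₃ - e) * ((l * e + m) ^ 2) ∎)

    χ-sum : ∀ {P Q R} → On P → On Q → Sum P Q R → (χ P * χ Q) ≈[ 2 ] χ R
    χ-sum _ _ identityˡ = ≈-reflexive (*-identityˡ _)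
    χ-sum _ _ identityʳ = ≈-reflexive (*-identityʳ _)
    χ-sum {pt x y} _ _ (vertical {y′ = y′} _) = powers 1# (χ (pt x y)) 1≢0 (χ-≢0 (pt x y))
      (solve 1 (λ c → c :* c :* (:1 :* (:1 :* :1)) := :1 :* (c :* (c :* :1))) refl (χ (pt x y)))
    χ-sum on₁ on₂ (line {x₁} {y₁} {x₂} l s) =
      line-case l (y₁ - l * x₁) x₁ x₂ (thirdX l x₁ x₂) (slope-meets on₁ on₂ s) (x₁ ≟ e) (x₂ ≟ e) (thirdX l x₁ x₂ ≟ e)

    kummer : Kummer 2
    kummer = record { χ = χ ; χ-O = refl ; χ-≢0 = λ P _ → χ-≢0 P ; χ-sum = χ-sum }

-- The Kummer map of a flex and the 3-torsion

module CubeKummer (F : DiscreteField) (A B : DiscreteField.Carrier F)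
  (x₀ y₀ α : DiscreteField.Carrier F) where
  open DiscreteField F
  open CoordinateRing F A B using (f; On; Slope; chord; tangent; Sum; thirdX; 2#; 3#; identityˡ; identityʳ; vertical; line)
  open AdditionClasses F A B using (Meets; slope-line; slope-meets; On-sum)
  open PowerClasses F
  open KummerMaps F A B
  open ≡.≡-Reasoning

  -- The flex tangent at (x₀ , y₀)
  L : Carrier → Carrier
  L t = α * t + (y₀ - α * x₀)

  module _ (y₀≢0 : y₀ ≢ 0#) (flex : ∀ t → f t - L t * L t ≡ (t - x₀) * (t - x₀) * (t - x₀)) where

    private
      cube-0 : ∀ {z} → z * z * z ≡ 0# → z ≡ 0#
      cube-0 {z} eq with z ≟ 0#
      ... | yes z≡0 = z≡0
      ... | no z≢0 = *-cancelˡ-0 (*-≢0 z≢0 z≢0) eq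

      L-x₀ : L x₀ ≡ y₀
      L-x₀ = solve 3 (λ α x y → α :* x :+ (y :- α :* x) := y) refl α x₀ y₀

      -2y₀≢0 : - (2# * y₀) ≢ 0#
      -2y₀≢0 eq = *-≢0 2≢0 y₀≢0 (trans (solve 1 (λ z → z := :- (:- z)) refl (2# * y₀)) (trans (cong -_ eq)
        (solve 0 (:- :0 := :0) refl)))

      4y₀² : Carrier
      4y₀² = (2# * y₀) * (2# * y₀)

      4y₀²≢0 : 4y₀² ≢ 0#
      4y₀²≢0 = *-≢0 (*-≢0 2≢0 y₀≢0) (*-≢0 2≢0 y₀≢0)

    -- At the flex y - L vanishes, and the value is dictated by the opposite point: there y - L is
    -- -2y₀, and 4y₀² times -2y₀ is a cube.
    χ′ : ∀ {v} → Dec (v ≡ 0#) → Carrier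
    χ′ (yes _) = 4y₀²
    χ′ {v} (no _) = v

    χ : Pt Carrier → Carrier
    χ O = 1#
    χ (pt x y) = χ′ ((y - L x) ≟ 0#)

    χ-≢0 : ∀ P → χ P ≢ 0#
    χ-≢0 O = 1≢0
    χ-≢0 (pt x y) with (y - L x) ≟ 0#
    ... | yes _ = 4y₀²≢0
    ... | no v≢0 = v≢0

    -- The values at opposite points multiply to a cube because the tangent meets the curve three
    -- times at the flex.
    conjugate : ∀ {x y} → y * y ≡ f x → (y - L x) * (- y - L x) ≡ (x₀ - x) * (x₀ - x) * (x₀ - x)
    conjugate {x} {y} on = begin
      (y - L x) * (- y - L x)              ≡⟨ solve 2 (λ y L → (y :- L) :* ((:- y) :- L) := :- (y :* y :- L :* L)) refl y (L x) ⟩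
      - (y * y - L x * L x)                ≡⟨ cong (λ z → - (z - L x * L x)) on ⟩
      - (f x - L x * L x)                  ≡⟨ cong -_ (flex x) ⟩
      - ((x - x₀) * (x - x₀) * (x - x₀))   ≡⟨ solve 2 (λ x x₀ → :- ((x :- x₀) :* (x :- x₀) :* (x :- x₀))
                                                := (x₀ :- x) :* (x₀ :- x) :* (x₀ :- x)) refl x x₀ ⟩
      (x₀ - x) * (x₀ - x) * (x₀ - x)       ∎

    on-flex-line : ∀ {x y} → y * y ≡ f x → y - L x ≡ 0# → x ≡ x₀ × y ≡ y₀
    on-flex-line {x} {y} on v≡0 = x≡x₀ , trans (x-y≡0⇒x≡y v≡0) (trans (cong L x≡x₀) L-x₀)
      where
      x≡x₀ : x ≡ x₀
      x≡x₀ = sym (x-y≡0⇒x≡y (cube-0 (trans (sym (conjugate on)) (trans (cong (_* (- y - L x)) v≡0) (zeroˡ _)))))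

    module Line (l m x₁ x₂ x₃ : Carrier)
      (meets : ∀ t → f t - (l * t + m) * (l * t + m) ≡ (t - x₁) * (t - x₂) * (t - x₃)) where

      p q : Carrier
      p = l - α
      q = m - (y₀ - α * x₀)

      value : Carrier → Carrier
      value t = p * t + q

      value-≡ : ∀ t → (l * t + m) - L t ≡ value t
      value-≡ t = solve 6 (λ l α m t y x → (l :* t :+ m) :- (α :* t :+ (y :- α :* x)) := (l :- α) :* t :+ (m :- (y :- α :* x))) refl l α m t y₀ x₀

      -- The values at three collinear points multiply to a cube: if p ≠ 0, evaluate at the
      -- intersection of the line with the flex tangent.
      product-cube : value x₁ * value x₂ * value x₃ ≡ value x₀ * value x₀ * value x₀
      product-cube with p ≟ 0#
      ... | yes p≡0 = trans (cong (λ z → (z * x₁ + q) * (z * x₂ + q) * (z * x₃ + q)) p≡0)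
        (trans (solve 5 (λ a b c d q → (:0 :* a :+ q) :* (:0 :* b :+ q) :* (:0 :* c :+ q) := (:0 :* d :+ q) :* (:0 :* d :+ q) :* (:0 :* d :+ q)) refl x₁ x₂ x₃ x₀ q)
          (cong (λ z → (z * x₀ + q) * (z * x₀ + q) * (z * x₀ + q)) (sym p≡0)))
      ... | no p≢0 = begin
        value x₁ * value x₂ * value x₃
          ≡⟨ cong₂ _*_ (cong₂ _*_ (shift x₁) (shift x₂)) (shift x₃) ⟩
        p * (x₁ - s) * (p * (x₂ - s)) * (p * (x₃ - s))
          ≡⟨ solve 5 (λ p a b c s → p :* (a :- s) :* (p :* (b :- s)) :* (p :* (c :- s))
               := :- (p :* p :* p :* ((s :- a) :* (s :- b) :* (s :- c)))) refl p x₁ x₂ x₃ s ⟩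
        - (p * p * p * ((s - x₁) * (s - x₂) * (s - x₃)))
          ≡⟨ cong (λ z → - (p * p * p * z)) (meets s) ⟨
        - (p * p * p * (f s - (l * s + m) * (l * s + m)))
          ≡⟨ cong (λ z → - (p * p * p * (f s - z * z))) (x-y≡0⇒x≡y (trans (value-≡ s) value-s)) ⟩
        - (p * p * p * (f s - L s * L s))
          ≡⟨ cong (λ z → - (p * p * p * z)) (flex s) ⟩
        - (p * p * p * ((s - x₀) * (s - x₀) * (s - x₀)))
          ≡⟨ solve 3 (λ p s x → :- (p :* p :* p :* ((s :- x) :* (s :- x) :* (s :- x)))
               := (p :* (x :- s)) :* (p :* (x :- s)) :* (p :* (x :- s))) refl p s x₀ ⟩
        (p * (x₀ - s)) * (p * (x₀ - s)) * (p * (x₀ - s))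
          ≡⟨ cong (λ z → z * z * z) (shift x₀) ⟨
        value x₀ * value x₀ * value x₀ ∎
        where
        s = - (q * p ⁻¹)
        value-s : value s ≡ 0#
        value-s = begin
          p * (- (q * p ⁻¹)) + q      ≡⟨ solve 3 (λ p q i → p :* (:- (q :* i)) :+ q := q :* (:1 :- p :* i)) refl p q (p ⁻¹) ⟩
          q * (1# - p * p ⁻¹)         ≡⟨ cong (λ z → q * (1# - z)) (*-inverseʳ p≢0) ⟩
          q * (1# - 1#)               ≡⟨ solve 1 (λ q → q :* (:1 :- :1) := :0) refl q ⟩
          0#                          ∎
        shift : ∀ t → value t ≡ p * (t - s)
        shift t = begin
          p * t + q                   ≡⟨ solve 4 (λ p t q s → p :* t :+ q := p :* (t :- s) :+ (p :* s :+ q)) refl p t q s ⟩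
          p * (t - s) + value s       ≡⟨ cong (λ z → p * (t - s) + z) value-s ⟩
          p * (t - s) + 0#            ≡⟨ +-identityʳ _ ⟩
          p * (t - s)                 ∎

      -- The values at a and b if the third point of the line is the flex.
      through-flex : value x₀ ≡ 0# → ∀ {a b} →
        (∀ t → f t - (l * t + m) * (l * t + m) ≡ (t - x₀) * (t - a) * (t - b)) →
        (a - x₀) * (b - x₀) ≡ - (2# * y₀) * p
      through-flex vx₀≡0 {a} {b} meets′ = begin
        (a - x₀) * (b - x₀)
          ≡⟨ solve 3 (λ a b x → (a :- x) :* (b :- x) := (x :- a) :* (x :- b)) refl a b x₀ ⟩
        (x₀ - a) * (x₀ - b)
          ≡⟨ derivative {l} {m} {x₀} {a} {b} meets′ ⟨
        df x₀ - 2# * (l * (l * x₀ + m))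
          ≡⟨ cong (λ z → df x₀ - 2# * (l * z)) lx₀+m≡y₀ ⟩
        df x₀ - 2# * (l * y₀)
          ≡⟨ solve 4 (λ d l α y → d :- (:1 :+ :1) :* (l :* y) := (d :- (:1 :+ :1) :* (α :* y)) :+ (:- ((:1 :+ :1) :* y)) :* (l :- α)) refl (df x₀) l α y₀ ⟩
        (df x₀ - 2# * (α * y₀)) + - (2# * y₀) * p
          ≡⟨ cong (λ z → (df x₀ - 2# * (α * z)) + - (2# * y₀) * p) L-x₀ ⟨
        (df x₀ - 2# * (α * L x₀)) + - (2# * y₀) * p
          ≡⟨ cong (λ z → z + - (2# * y₀) * p) (derivative {α} {y₀ - α * x₀} {x₀} {x₀} {x₀} flex) ⟩
        (x₀ - x₀) * (x₀ - x₀) + - (2# * y₀) * p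
          ≡⟨ solve 2 (λ x z → (x :- x) :* (x :- x) :+ z := z) refl x₀ (- (2# * y₀) * p) ⟩
        - (2# * y₀) * p ∎
        where
        lx₀+m≡y₀ : l * x₀ + m ≡ y₀
        lx₀+m≡y₀ = trans (x-y≡0⇒x≡y (trans (value-≡ x₀) vx₀≡0)) L-x₀

      value-shift : value x₀ ≡ 0# → ∀ t → value t ≡ p * (t - x₀)
      value-shift vx₀≡0 t = begin
        value t                      ≡⟨ solve 4 (λ p t q s → p :* t :+ q := p :* (t :- s) :+ (p :* s :+ q)) refl p t q x₀ ⟩
        p * (t - x₀) + value x₀      ≡⟨ cong (λ z → p * (t - x₀) + z) vx₀≡0 ⟩
        p * (t - x₀) + 0#            ≡⟨ +-identityʳ _ ⟩
        p * (t - x₀)                 ∎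

      on₃ : (l * x₃ + m) * (l * x₃ + m) ≡ f x₃
      on₃ = sym (x-y≡0⇒x≡y (trans (meets x₃) (solve 3 (λ a b c → (c :- a) :* (c :- b) :* (c :- c) := :0) refl x₁ x₂ x₃)))

      v₃ : Carrier
      v₃ = - (l * x₃ + m) - L x₃

      v₃-value : value x₃ * v₃ ≡ (x₀ - x₃) * (x₀ - x₃) * (x₀ - x₃)
      v₃-value = trans (cong (_* v₃) (sym (value-≡ x₃))) (conjugate on₃)

      -- The third intersection is -R for the sum R; `conjugate` trades its value for that of R, so
      -- the cube in `product-cube` becomes χ(P)χ(Q) = χ(R). If x₃ = x₀, the value at -R is 0, so -R
      -- is the flex itself, and `through-flex` computes the product instead.
      generic : value x₁ ≢ 0# → value x₂ ≢ 0# → v₃ ≢ 0# → (value x₁ * value x₂) ≈[ 3 ] v₃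
      generic v₁≢0 v₂≢0 v₃≢0 with x₃ ≟ x₀
      ... | no x₃≢x₀ = powers (x₀ - x₃) (value x₀) (λ z → x₃≢x₀ (sym (x-y≡0⇒x≡y z)))
          (λ z → *-≢0 (*-≢0 v₁≢0 v₂≢0) (λ z₃ → *-≢0 (*-≢0 δ≢0 δ≢0) δ≢0 (trans (sym v₃-value) (trans (cong (_* v₃) z₃) (zeroˡ _))))
            (trans product-cube (trans (cong (λ w → w * w * w) z) (solve 0 (:0 :* :0 :* :0 := :0) refl))))
          (begin
            value x₁ * value x₂ * (x₀ - x₃) ^ 3
              ≡⟨ solve 2 (λ a d → a :* (d :* (d :* (d :* :1))) := a :* (d :* d :* d)) refl (value x₁ * value x₂) (x₀ - x₃) ⟩
            value x₁ * value x₂ * ((x₀ - x₃) * (x₀ - x₃) * (x₀ - x₃))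
              ≡⟨ cong (value x₁ * value x₂ *_) v₃-value ⟨
            value x₁ * value x₂ * (value x₃ * v₃)
              ≡⟨ solve 3 (λ a b c → a :* (b :* c) := c :* (a :* b)) refl (value x₁ * value x₂) (value x₃) v₃ ⟩
            v₃ * (value x₁ * value x₂ * value x₃)
              ≡⟨ cong (v₃ *_) product-cube ⟩
            v₃ * (value x₀ * value x₀ * value x₀)
              ≡⟨ solve 2 (λ v c → v :* (c :* c :* c) := v :* (c :* (c :* (c :* :1)))) refl v₃ (value x₀) ⟩
            v₃ * value x₀ ^ 3 ∎)
        where
        δ≢0 : x₀ - x₃ ≢ 0#
        δ≢0 z = x₃≢x₀ (sym (x-y≡0⇒x≡y z))
      ... | yes refl = powers 1# p 1≢0 (λ p≡0 → v₁≢0 (trans (value-shift v≡0 x₁) (trans (cong (_* (x₁ - x₀)) p≡0) (zeroˡ _)))) (begin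
            value x₁ * value x₂ * 1# ^ 3
              ≡⟨ cong₂ (λ z w → z * w * 1# ^ 3) (value-shift v≡0 x₁) (value-shift v≡0 x₂) ⟩
            p * (x₁ - x₀) * (p * (x₂ - x₀)) * 1# ^ 3
              ≡⟨ solve 4 (λ p a b x → p :* (a :- x) :* (p :* (b :- x)) :* (:1 :* (:1 :* (:1 :* :1))) := p :* p :* ((a :- x) :* (b :- x))) refl p x₁ x₂ x₀ ⟩
            p * p * ((x₁ - x₀) * (x₂ - x₀))
              ≡⟨ cong (p * p *_) (through-flex v≡0 (λ t → trans (meets t) (solve 4 (λ t a b c → (t :- a) :* (t :- b) :* (t :- c) := (t :- c) :* (t :- a) :* (t :- b)) refl t x₁ x₂ x₀))) ⟩
            p * p * (- (2# * y₀) * p)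
              ≡⟨ solve 2 (λ p z → p :* p :* (z :* p) := z :* (p :* (p :* (p :* :1)))) refl p (- (2# * y₀)) ⟩
            - (2# * y₀) * p ^ 3
              ≡⟨ cong (_* p ^ 3) (begin
                   - (2# * y₀)                      ≡⟨ solve 1 (λ y → :- ((:1 :+ :1) :* y) := (:- y) :- y) refl y₀ ⟩
                   - y₀ - y₀                        ≡⟨ cong₂ (λ z w → - z - w) lx₀+m≡y₀ L-x₀ ⟨
                   - (l * x₀ + m) - L x₀            ∎) ⟩
            v₃ * p ^ 3 ∎)
        where
        v≡0 : value x₀ ≡ 0#
        v≡0 = *-cancelˡ-0 v₃≢0 (trans (*-comm _ _) (trans v₃-value (solve 1 (λ x → (x :- x) :* (x :- x) :* (x :- x) := :0) refl x₀)))
        lx₀+m≡y₀ : l * x₀ + m ≡ y₀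
        lx₀+m≡y₀ = trans (x-y≡0⇒x≡y (trans (value-≡ x₀) v≡0)) L-x₀

      -- Here the sum is the flex and the third intersection is its opposite, with value -2y₀. Since
      -- x₃ = x₀, `product-cube` reads v₁ v₂ (-2y₀) = (-2y₀)³.
      third-flex : v₃ ≡ 0# → value x₁ * value x₂ ≡ 4y₀²
      third-flex v₃≡0 = x-y≡0⇒x≡y (*-cancelˡ-0 -2y₀≢0 (begin
        - (2# * y₀) * (value x₁ * value x₂ - 4y₀²)
          ≡⟨ solve 3 (λ a b y → (:- ((:1 :+ :1) :* y)) :* (a :* b :- (:1 :+ :1) :* y :* ((:1 :+ :1) :* y))
               := a :* b :* (:- ((:1 :+ :1) :* y)) :- (:- ((:1 :+ :1) :* y)) :* (:- ((:1 :+ :1) :* y)) :* (:- ((:1 :+ :1) :* y))) refl (value x₁) (value x₂) y₀ ⟩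
        value x₁ * value x₂ * - (2# * y₀) - - (2# * y₀) * - (2# * y₀) * - (2# * y₀)
          ≡⟨ cong (λ z → value x₁ * value x₂ * - (2# * y₀) - z * z * z) value-x₀ ⟨
        value x₁ * value x₂ * - (2# * y₀) - value x₀ * value x₀ * value x₀
          ≡⟨ cong (λ z → value x₁ * value x₂ * z - value x₀ * value x₀ * value x₀) value-x₃ ⟨
        value x₁ * value x₂ * value x₃ - value x₀ * value x₀ * value x₀
          ≡⟨ x≡y⇒x-y≡0 product-cube ⟩
        0# ∎))
        where
        T₃ = on-flex-line {x₃} { - (l * x₃ + m)} (trans (solve 1 (λ z → (:- z) :* (:- z) := z :* z) refl (l * x₃ + m)) on₃) v₃≡0
        value-x₃ : value x₃ ≡ - (2# * y₀)
        value-x₃ = begin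
          value x₃                             ≡⟨ value-≡ x₃ ⟨
          (l * x₃ + m) - L x₃                  ≡⟨ solve 2 (λ z w → z :- w := (:- (:- z)) :- w) refl (l * x₃ + m) (L x₃) ⟩
          - (- (l * x₃ + m)) - L x₃            ≡⟨ cong₂ (λ z w → - z - w) (proj₂ T₃) (trans (cong L (proj₁ T₃)) L-x₀) ⟩
          - y₀ - y₀                            ≡⟨ solve 1 (λ y → (:- y) :- y := :- ((:1 :+ :1) :* y)) refl y₀ ⟩
          - (2# * y₀)                          ∎
        value-x₀ : value x₀ ≡ - (2# * y₀)
        value-x₀ = trans (cong value (sym (proj₁ T₃))) value-x₃

      -- The value along a line through the flex is p(t - x₀). Eliminating x₃ between (x₂ - x₀)(x₃ -
      -- x₀) = -2y₀p and pv₃ = -(x₃ - x₀)² gives the cube (x₀ - x₂)³.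
      first-flex : value x₁ ≡ 0# → x₁ ≡ x₀ → value x₂ ≢ 0# → v₃ ≢ 0# × (4y₀² * value x₂) ≈[ 3 ] v₃
      first-flex v₁≡0 refl v₂≢0 = v₃≢0 , powers 1# (x₀ - x₂) 1≢0 (λ z → x₂-x₀≢0 (trans (solve 2 (λ a b → a :- b := :- (b :- a)) refl x₂ x₀) (trans (cong -_ z) (solve 0 (:- :0 := :0) refl))))
        (x-y≡0⇒x≡y (*-cancelˡ-0 p≢0 (begin
          p * (4y₀² * value x₂ * 1# ^ 3 - v₃ * (x₀ - x₂) ^ 3)
            ≡⟨ cong (λ z → p * (4y₀² * z * 1# ^ 3 - v₃ * (x₀ - x₂) ^ 3)) (value-shift v₁≡0 x₂) ⟩
          p * (4y₀² * (p * (x₂ - x₀)) * 1# ^ 3 - v₃ * (x₀ - x₂) ^ 3)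
            ≡⟨ solve 5 (λ p y v x a → p :* ((:1 :+ :1) :* y :* ((:1 :+ :1) :* y) :* (p :* (a :- x)) :* (:1 :* (:1 :* (:1 :* :1))) :- v :* ((x :- a) :* ((x :- a) :* ((x :- a) :* :1))))
                 := (:- ((:1 :+ :1) :* y) :* p) :* (:- ((:1 :+ :1) :* y) :* p) :* (a :- x) :+ (p :* v) :* ((a :- x) :* (a :- x) :* (a :- x))) refl p y₀ v₃ x₀ x₂ ⟩
          (- (2# * y₀) * p) * (- (2# * y₀) * p) * (x₂ - x₀) + (p * v₃) * ((x₂ - x₀) * (x₂ - x₀) * (x₂ - x₀))
            ≡⟨ cong₂ (λ z w → z * z * (x₂ - x₀) + w * ((x₂ - x₀) * (x₂ - x₀) * (x₂ - x₀))) (sym relation) pv₃ ⟩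
          ((x₂ - x₀) * (x₃ - x₀)) * ((x₂ - x₀) * (x₃ - x₀)) * (x₂ - x₀) + - ((x₃ - x₀) * (x₃ - x₀)) * ((x₂ - x₀) * (x₂ - x₀) * (x₂ - x₀))
            ≡⟨ solve 2 (λ b c → (b :* c) :* (b :* c) :* b :+ (:- (c :* c)) :* (b :* b :* b) := :0) refl (x₂ - x₀) (x₃ - x₀) ⟩
          0# ∎)))
        where
        p≢0 : p ≢ 0#
        p≢0 z = v₂≢0 (trans (value-shift v₁≡0 x₂) (trans (cong (_* (x₂ - x₀)) z) (zeroˡ _)))
        relation : (x₂ - x₀) * (x₃ - x₀) ≡ - (2# * y₀) * p
        relation = through-flex v₁≡0 meets
        x₂-x₀≢0 : x₂ - x₀ ≢ 0#
        x₂-x₀≢0 z = v₂≢0 (trans (value-shift v₁≡0 x₂) (trans (cong (p *_) z) (zeroʳ _)))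
        x₃-x₀≢0 : x₃ - x₀ ≢ 0#
        x₃-x₀≢0 z = *-≢0 -2y₀≢0 p≢0 (trans (sym relation) (trans (cong ((x₂ - x₀) *_) z) (zeroʳ _)))
        pv₃ : p * v₃ ≡ - ((x₃ - x₀) * (x₃ - x₀))
        pv₃ = x-y≡0⇒x≡y (*-cancelˡ-0 x₃-x₀≢0 (begin
          (x₃ - x₀) * (p * v₃ - - ((x₃ - x₀) * (x₃ - x₀)))
            ≡⟨ solve 4 (λ p v c x → (c :- x) :* (p :* v :- (:- ((c :- x) :* (c :- x)))) := p :* (c :- x) :* v :- (x :- c) :* (x :- c) :* (x :- c)) refl p v₃ x₃ x₀ ⟩
          p * (x₃ - x₀) * v₃ - (x₀ - x₃) * (x₀ - x₃) * (x₀ - x₃)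
            ≡⟨ cong (λ z → z * v₃ - (x₀ - x₃) * (x₀ - x₃) * (x₀ - x₃)) (value-shift v₁≡0 x₃) ⟨
          value x₃ * v₃ - (x₀ - x₃) * (x₀ - x₃) * (x₀ - x₃)
            ≡⟨ x≡y⇒x-y≡0 v₃-value ⟩
          0# ∎))
        v₃≢0 : v₃ ≢ 0#
        v₃≢0 z = *-≢0 x₃-x₀≢0 x₃-x₀≢0 (begin
          (x₃ - x₀) * (x₃ - x₀)             ≡⟨ solve 1 (λ w → w := :- (:- w)) refl ((x₃ - x₀) * (x₃ - x₀)) ⟩
          - (- ((x₃ - x₀) * (x₃ - x₀)))     ≡⟨ cong -_ pv₃ ⟨
          - (p * v₃)                        ≡⟨ cong (λ w → - (p * w)) z ⟩
          - (p * 0#)                        ≡⟨ solve 1 (λ p → :- (p :* :0) := :0) refl p ⟩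
          0#                                ∎)

      -- A line that meets the flex twice is its tangent, so p = 0 and the third intersection is the
      -- flex again: twice the flex is its opposite.
      both-flex : x₁ ≡ x₀ → x₂ ≡ x₀ → value x₀ ≡ 0# → v₃ ≡ - (2# * y₀)
      both-flex refl refl v≡0 = begin
        - (l * x₃ + m) - L x₃      ≡⟨ cong (λ x → - (l * x + m) - L x) x₃≡x₀ ⟩
        - (l * x₀ + m) - L x₀      ≡⟨ cong₂ (λ z w → - z - w) (trans (x-y≡0⇒x≡y (trans (value-≡ x₀) v≡0)) L-x₀) L-x₀ ⟩
        - y₀ - y₀                  ≡⟨ solve 1 (λ y → (:- y) :- y := :- ((:1 :+ :1) :* y)) refl y₀ ⟩
        - (2# * y₀)                ∎
        where
        p≡0 : p ≡ 0#
        p≡0 = *-cancelˡ-0 -2y₀≢0 (trans (sym (through-flex v≡0 meets)) (solve 2 (λ x c → (x :- x) :* (c :- x) := :0) refl x₀ x₃))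
        x₃≡x₀ : x₃ ≡ x₀
        x₃≡x₀ = sym (x-y≡0⇒x≡y (cube-0 (trans (sym v₃-value) (trans (cong (_* v₃) (trans (value-shift v≡0 x₃) (trans (cong (_* (x₃ - x₀)) p≡0) (zeroˡ _)))) (zeroˡ _)))))

    module _ (l m x₁ x₂ x₃ : Carrier)
      (meets : ∀ t → f t - (l * t + m) * (l * t + m) ≡ (t - x₁) * (t - x₂) * (t - x₃)) where
      open Line l m x₁ x₂ x₃ meets

      private
        swapped : ∀ t → f t - (l * t + m) * (l * t + m) ≡ (t - x₂) * (t - x₁) * (t - x₃)
        swapped t = trans (meets t) (cong (_* (t - x₃)) (*-comm _ _))

      -- The values are variables tied by equations, so the decisions made inside `χ`, whose
      -- subjects are only propositionally equal to the expressions in `Line`, can be passed in and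
      -- matched.
      line-case : ∀ {v₁ v₂ w₃} → v₁ ≡ value x₁ → v₂ ≡ value x₂ → w₃ ≡ v₃ →
        (v₁ ≡ 0# → x₁ ≡ x₀) → (v₂ ≡ 0# → x₂ ≡ x₀) →
        (d₁ : Dec (v₁ ≡ 0#)) (d₂ : Dec (v₂ ≡ 0#)) (d₃ : Dec (w₃ ≡ 0#)) → (χ′ d₁ * χ′ d₂) ≈[ 3 ] χ′ d₃
      line-case refl refl refl _ _ (no v₁≢0) (no v₂≢0) (no v₃≢0) = generic v₁≢0 v₂≢0 v₃≢0
      line-case refl refl refl _ _ (no _) (no _) (yes v₃≡0) = ≈-reflexive (third-flex v₃≡0)
      line-case refl refl refl x₁≡ _ (yes v₁≡0) (no v₂≢0) (no _) = proj₂ (first-flex v₁≡0 (x₁≡ v₁≡0) v₂≢0)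
      line-case refl refl refl x₁≡ _ (yes v₁≡0) (no v₂≢0) (yes v₃≡0) = ⊥-elim (proj₁ (first-flex v₁≡0 (x₁≡ v₁≡0) v₂≢0) v₃≡0)
      line-case refl refl refl _ x₂≡ (no v₁≢0) (yes v₂≡0) (no _) = ≈-trans (≈-reflexive (*-comm _ _))
        (proj₂ (Line.first-flex l m x₂ x₁ x₃ swapped v₂≡0 (x₂≡ v₂≡0) v₁≢0))
      line-case refl refl refl _ x₂≡ (no v₁≢0) (yes v₂≡0) (yes v₃≡0) =
        ⊥-elim (proj₁ (Line.first-flex l m x₂ x₁ x₃ swapped v₂≡0 (x₂≡ v₂≡0) v₁≢0) v₃≡0)
      line-case refl refl refl x₁≡ x₂≡ (yes v₁≡0) (yes v₂≡0) (yes v₃≡0) = ⊥-elim (-2y₀≢0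
        (trans (sym (both-flex (x₁≡ v₁≡0) (x₂≡ v₂≡0) (trans (cong value (sym (x₁≡ v₁≡0))) v₁≡0))) v₃≡0))
      line-case refl refl refl x₁≡ x₂≡ (yes v₁≡0) (yes v₂≡0) (no _) = powers 1# (- (2# * y₀)) 1≢0 -2y₀≢0
        (trans (solve 1 (λ y → (:1 :+ :1) :* y :* ((:1 :+ :1) :* y) :* ((:1 :+ :1) :* y :* ((:1 :+ :1) :* y)) :* (:1 :* (:1 :* (:1 :* :1)))
            := (:- ((:1 :+ :1) :* y)) :* ((:- ((:1 :+ :1) :* y)) :* ((:- ((:1 :+ :1) :* y)) :* ((:- ((:1 :+ :1) :* y)) :* :1)))) refl y₀)
          (cong (_* (- (2# * y₀)) ^ 3) (sym (both-flex (x₁≡ v₁≡0) (x₂≡ v₂≡0) (trans (cong value (sym (x₁≡ v₁≡0))) v₁≡0)))))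

    vertical-case : ∀ {x y v v′} → y * y ≡ f x → v ≡ y - L x → v′ ≡ - y - L x →
                    (d : Dec (v ≡ 0#)) (d′ : Dec (v′ ≡ 0#)) → (χ′ d * χ′ d′) ≈[ 3 ] 1#
    vertical-case {x} {y} on refl refl (no v≢0) (no v′≢0) = powers 1# (x₀ - x) 1≢0
      (λ z → *-≢0 v≢0 v′≢0 (trans (conjugate on) (trans (cong (λ w → w * w * w) z) (solve 0 (:0 :* :0 :* :0 := :0) refl))))
      (trans (cong (_* 1# ^ 3) (conjugate on))
        (solve 1 (λ d → d :* d :* d :* (:1 :* (:1 :* (:1 :* :1))) := :1 :* (d :* (d :* (d :* :1)))) refl (x₀ - x)))
    vertical-case {x} {y} on refl refl (yes v≡0) d′ = go d′
      where
      T = on-flex-line on v≡0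
      v′≡ : - y - L x ≡ - (2# * y₀)
      v′≡ = trans (cong₂ (λ z w → - z - w) (proj₂ T) (trans (cong L (proj₁ T)) L-x₀)) (solve 1 (λ y → (:- y) :- y := :- ((:1 :+ :1) :* y)) refl y₀)
      go : (d′ : Dec (- y - L x ≡ 0#)) → (4y₀² * χ′ d′) ≈[ 3 ] 1#
      go (yes v′≡0) = ⊥-elim (-2y₀≢0 (trans (sym v′≡) v′≡0))
      go (no _) = powers 1# (- (2# * y₀)) 1≢0 -2y₀≢0 (trans (cong (λ z → 4y₀² * z * 1# ^ 3) v′≡)
        (solve 1 (λ y → (:1 :+ :1) :* y :* ((:1 :+ :1) :* y) :* (:- ((:1 :+ :1) :* y)) :* (:1 :* (:1 :* (:1 :* :1)))
          := :1 :* ((:- ((:1 :+ :1) :* y)) :* ((:- ((:1 :+ :1) :* y)) :* ((:- ((:1 :+ :1) :* y)) :* :1)))) refl y₀))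
    vertical-case {x} {y} on refl refl (no v≢0) (yes v′≡0) = powers 1# (- (2# * y₀)) 1≢0 -2y₀≢0
      (trans (cong (λ z → z * 4y₀² * 1# ^ 3) v≡)
        (solve 1 (λ y → (:- ((:1 :+ :1) :* y)) :* ((:1 :+ :1) :* y :* ((:1 :+ :1) :* y)) :* (:1 :* (:1 :* (:1 :* :1)))
          := :1 :* ((:- ((:1 :+ :1) :* y)) :* ((:- ((:1 :+ :1) :* y)) :* ((:- ((:1 :+ :1) :* y)) :* :1)))) refl y₀))
      where
      T = on-flex-line {x} { - y} (trans (solve 1 (λ z → (:- z) :* (:- z) := z :* z) refl y) on) v′≡0
      v≡ : y - L x ≡ - (2# * y₀)
      v≡ = begin
        y - L x             ≡⟨ solve 2 (λ y L → y :- L := (:- (:- y)) :- L) refl y (L x) ⟩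
        - (- y) - L x       ≡⟨ cong₂ (λ z w → - z - w) (proj₂ T) (trans (cong L (proj₁ T)) L-x₀) ⟩
        - y₀ - y₀           ≡⟨ solve 1 (λ y → (:- y) :- y := :- ((:1 :+ :1) :* y)) refl y₀ ⟩
        - (2# * y₀)         ∎

    χ-sum : ∀ {P Q R} → On P → On Q → Sum P Q R → (χ P * χ Q) ≈[ 3 ] χ R
    χ-sum _ _ identityˡ = ≈-reflexive (*-identityˡ _)
    χ-sum _ _ identityʳ = ≈-reflexive (*-identityʳ _)
    χ-sum {pt x y} on _ (vertical {y′ = y′} eq) = vertical-case {x} {y} on refl
      (cong (_- L x) (trans (solve 2 (λ y y′ → y′ := (y :+ y′) :- y) refl y y′) (trans (cong (_- y) eq) (+-identityˡ (- y)))))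
      ((y - L x) ≟ 0#) ((y′ - L x) ≟ 0#)
    χ-sum on₁ on₂ (line {x₁} {y₁} {x₂} {y₂} l s) =
      line-case l m x₁ x₂ x₃ (slope-meets on₁ on₂ s)
        (trans (cong (_- L x₁) (proj₁ (slope-line s))) (value-≡ x₁))
        (trans (cong (_- L x₂) (proj₂ (slope-line s))) (value-≡ x₂))
        (cong (_- L x₃) (solve 4 (λ l a c y → l :* (a :- c) :- y := :- (l :* c :+ (y :- l :* a))) refl l x₁ x₃ y₁))
        (λ z → proj₁ (on-flex-line on₁ z)) (λ z → proj₁ (on-flex-line on₂ z))
        ((y₁ - L x₁) ≟ 0#) ((y₂ - L x₂) ≟ 0#) ((l * (x₁ - x₃) - y₁ - L x₃) ≟ 0#)
      where
      m = y₁ - l * x₁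
      x₃ = thirdX l x₁ x₂
      open Line l m x₁ x₂ x₃ (slope-meets on₁ on₂ s) using (value-≡)

    kummer : Kummer 3
    kummer = record { χ = χ ; χ-O = refl ; χ-≢0 = λ P _ → χ-≢0 P ; χ-sum = χ-sum }

  module _ (on₀ : y₀ * y₀ ≡ f x₀) (y₀≢0 : y₀ ≢ 0#) (slope : α * (2# * y₀) ≡ 3# * (x₀ * x₀) + A) (α²≡3x₀ : α * α ≡ 3# * x₀) where

    -- The third intersection of the tangent has the coordinate α² - 2x₀, which is x₀ by `α²≡3x₀`.
    flex-tangent : ∀ t → f t - L t * L t ≡ (t - x₀) * (t - x₀) * (t - x₀)
    flex-tangent t = trans (slope-meets on₀ on₀ (tangent refl refl y₀≢0 slope) t)
      (cong (λ z → (t - x₀) * (t - x₀) * (t - z))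
        (trans (cong (λ z → (z - x₀) - x₀) α²≡3x₀) (solve 1 (λ x → (:1 :+ :1 :+ :1) :* x :- x :- x := x) refl x₀)))

    κ : Carrier
    κ = 2# * 2# * 2# * (α * α * α) - 2# * (3# * 3# * 3#) * y₀

    -- The x-coordinates of the other 3-torsion points are the roots of the remaining cubic factor of
    -- the 3-division polynomial; it is pure in the variable 6y₀/(x - x₀) + 2α.
    three-torsion : (∀ w → w ^ 3 ≢ κ) → ∀ {S R} → On S → Sum S S R → Sum S R O →
                    S ≡ O ⊎ S ≡ pt x₀ y₀ ⊎ S ≡ pt x₀ (- y₀)
    three-torsion _ {O} _ _ _ = inj₁ refl
    three-torsion _ {pt x y} _ (line l (chord x≢x _)) _ = ⊥-elim (x≢x refl)
    three-torsion noncube {pt x y} on (line l (tangent _ _ _ eq)) s = go s refl refl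
      where
      G X : Carrier
      X = x - x₀
      G = 3# * (X * X * X) + 2# * 2# * (α * α) * (X * X) + 2# * 2# * 3# * (α * y₀ * X) + 2# * 2# * 3# * (y₀ * y₀)
      six : Carrier
      six = 2# * 3# * y₀ + 2# * (α * X)
      fx : f x ≡ (α * X + y₀) * (α * X + y₀) + X * X * X
      fx = begin
        f x                                   ≡⟨ solve 2 (λ f L → f := L :* L :+ (f :- L :* L)) refl (f x) (L x) ⟩
        L x * L x + (f x - L x * L x)         ≡⟨ cong (λ z → L x * L x + z) (flex-tangent x) ⟩
        L x * L x + X * X * X                 ≡⟨ cong (λ z → z * z + X * X * X) (solve 4 (λ α x y a → α :* x :+ (y :- α :* a) := α :* (x :- a) :+ y) refl α x y₀ x₀) ⟩
        (α * X + y₀) * (α * X + y₀) + X * X * X ∎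
      dfx : 3# * (x * x) + A ≡ 3# * (X * X) + 2# * (α * (α * X + y₀))
      dfx = begin
        3# * (x * x) + A
          ≡⟨ solve 3 (λ x a A → (:1 :+ :1 :+ :1) :* (x :* x) :+ A
               := (:1 :+ :1 :+ :1) :* ((x :- a) :* (x :- a)) :+ (:1 :+ :1) :* ((:1 :+ :1 :+ :1) :* a :* (x :- a)) :+ ((:1 :+ :1 :+ :1) :* (a :* a) :+ A)) refl x x₀ A ⟩
        3# * (X * X) + 2# * (3# * x₀ * X) + (3# * (x₀ * x₀) + A)
          ≡⟨ cong₂ (λ z w → 3# * (X * X) + 2# * (z * X) + w) α²≡3x₀ slope ⟨
        3# * (X * X) + 2# * (α * α * X) + α * (2# * y₀)
          ≡⟨ solve 3 (λ X α y → (:1 :+ :1 :+ :1) :* (X :* X) :+ (:1 :+ :1) :* (α :* α :* X) :+ α :* ((:1 :+ :1) :* y)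
               := (:1 :+ :1 :+ :1) :* (X :* X) :+ (:1 :+ :1) :* (α :* (α :* X :+ y))) refl X α y₀ ⟩
        3# * (X * X) + 2# * (α * (α * X + y₀)) ∎
      -- A point has order 3 when its tangent meets the curve again over the same x, that is l² =
      -- 3x. With 2yl = f′(x) this becomes 12x f(x) = f′(x)²; expanded in X = x - x₀, the flex
      -- contributes the factor X.
      XG≡0 : l * l ≡ 3# * x → X * G ≡ 0#
      XG≡0 l²≡3x = begin
        X * G
          ≡⟨ solve 3 (λ X α y → let t = :1 :+ :1 :+ :1 ; d = :1 :+ :1 in
               X :* (t :* (X :* X :* X) :+ d :* d :* (α :* α) :* (X :* X) :+ d :* d :* t :* (α :* y :* X) :+ d :* d :* t :* (y :* y))
               := d :* d :* (t :* X :+ α :* α) :* ((α :* X :+ y) :* (α :* X :+ y) :+ X :* X :* X)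
                  :- (t :* (X :* X) :+ d :* (α :* (α :* X :+ y))) :* (t :* (X :* X) :+ d :* (α :* (α :* X :+ y)))) refl X α y₀ ⟩
        2# * 2# * (3# * X + α * α) * ((α * X + y₀) * (α * X + y₀) + X * X * X)
          - (3# * (X * X) + 2# * (α * (α * X + y₀))) * (3# * (X * X) + 2# * (α * (α * X + y₀)))
          ≡⟨ cong₂ (λ z w → 2# * 2# * (3# * X + α * α) * z - w * w) (trans (sym fx) (sym on)) (trans (sym dfx) (sym eq)) ⟩
        2# * 2# * (3# * X + α * α) * (y * y) - (l * (2# * y)) * (l * (2# * y))
          ≡⟨ cong (λ z → 2# * 2# * (3# * X + z) * (y * y) - (l * (2# * y)) * (l * (2# * y))) α²≡3x₀ ⟩
        2# * 2# * (3# * X + 3# * x₀) * (y * y) - (l * (2# * y)) * (l * (2# * y))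
          ≡⟨ solve 4 (λ x a y l → let t = :1 :+ :1 :+ :1 ; d = :1 :+ :1 in
               d :* d :* (t :* (x :- a) :+ t :* a) :* (y :* y) :- (l :* (d :* y)) :* (l :* (d :* y))
               := d :* d :* (y :* y) :* (t :* x :- l :* l)) refl x x₀ y l ⟩
        2# * 2# * (y * y) * (3# * x - l * l)
          ≡⟨ cong (2# * 2# * (y * y) *_) (x≡y⇒x-y≡0 (sym l²≡3x)) ⟩
        2# * 2# * (y * y) * 0#
          ≡⟨ zeroʳ _ ⟩
        0# ∎
      cube : X ≢ 0# → G ≡ 0# → (six * X ⁻¹) ^ 3 ≡ κ
      cube X≢0 G≡0 = x-y≡0⇒x≡y (*-cancelˡ-0 (*-≢0 X≢0 (*-≢0 X≢0 X≢0)) (begin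
        X * (X * X) * ((six * X ⁻¹) ^ 3 - κ)
          ≡⟨ solve 4 (λ X s i k → X :* (X :* X) :* ((s :* i) :* ((s :* i) :* ((s :* i) :* :1)) :- k)
               := (s :* (X :* i)) :* ((s :* (X :* i)) :* (s :* (X :* i))) :- k :* (X :* (X :* X))) refl X six (X ⁻¹) κ ⟩
        (six * (X * X ⁻¹)) * ((six * (X * X ⁻¹)) * (six * (X * X ⁻¹))) - κ * (X * (X * X))
          ≡⟨ cong (λ z → (six * z) * ((six * z) * (six * z)) - κ * (X * (X * X))) (*-inverseʳ X≢0) ⟩
        (six * 1#) * ((six * 1#) * (six * 1#)) - κ * (X * (X * X))
          ≡⟨ solve 3 (λ X α y → let t = :1 :+ :1 :+ :1 ; d = :1 :+ :1 ; s = d :* t :* y :+ d :* (α :* X)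
                                    k = d :* d :* d :* (α :* α :* α) :- d :* (t :* t :* t) :* y in
               (s :* :1) :* ((s :* :1) :* (s :* :1)) :- k :* (X :* (X :* X))
               := d :* (t :* t) :* y :* (t :* (X :* X :* X) :+ d :* d :* (α :* α) :* (X :* X) :+ d :* d :* t :* (α :* y :* X) :+ d :* d :* t :* (y :* y))) refl X α y₀ ⟩
        2# * (3# * 3#) * y₀ * G
          ≡⟨ cong (2# * (3# * 3#) * y₀ *_) G≡0 ⟩
        2# * (3# * 3#) * y₀ * 0#
          ≡⟨ zeroʳ _ ⟩
        0# ∎))
      same-x : x ≡ x₀ → pt x y ≡ O ⊎ pt x y ≡ pt x₀ y₀ ⊎ pt x y ≡ pt x₀ (- y₀)
      same-x refl with (y - y₀) ≟ 0#
      ... | yes z = inj₂ (inj₁ (cong (pt x₀) (x-y≡0⇒x≡y z)))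
      ... | no nz = inj₂ (inj₂ (cong (pt x₀) (x-y≡0⇒x≡y (*-cancelˡ-0 nz (begin
        (y - y₀) * (y - - y₀)        ≡⟨ solve 2 (λ y z → (y :- z) :* (y :- (:- z)) := y :* y :- z :* z) refl y y₀ ⟩
        y * y - y₀ * y₀              ≡⟨ x≡y⇒x-y≡0 (trans on (sym on₀)) ⟩
        0#                           ∎)))))
      go : ∀ {x₃ y₃ Z} → Sum (pt x y) (pt x₃ y₃) Z → x₃ ≡ thirdX l x x → Z ≡ O → pt x y ≡ O ⊎ pt x y ≡ pt x₀ y₀ ⊎ pt x y ≡ pt x₀ (- y₀)
      go (vertical _) x≡third _ with x ≟ x₀
      ... | yes x≡x₀ = same-x x≡x₀
      ... | no x≢x₀ = ⊥-elim (noncube (six * X ⁻¹) (cube X≢0 (*-cancelˡ-0 X≢0 (XG≡0 (begin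
          l * l                    ≡⟨ solve 2 (λ l x → l :* l := ((l :* l :- x) :- x) :+ (x :+ x)) refl l x ⟩
          thirdX l x x + (x + x)   ≡⟨ cong (_+ (x + x)) x≡third ⟨
          x + (x + x)              ≡⟨ solve 1 (λ x → x :+ (x :+ x) := (:1 :+ :1 :+ :1) :* x) refl x ⟩
          3# * x                   ∎)))))
        where
        X≢0 : X ≢ 0#
        X≢0 z = x≢x₀ (x-y≡0⇒x≡y z)
      go (line _ _) _ ()

open import Defs
open import Algebra.Bundles using (AbelianGroup)
open import Data.Bool as Bool using (Bool; true; false; _∧_; _∨_; not; if_then_else_)
open import Data.Bool.ListAction using (any)
open import Data.Integer using (∣_∣)
open import Data.Integer.DivMod as ℤD using (_/ℕ_; _%ℕ_)
open import Data.Integer.Solver using () renaming (module +-*-Solver to ℤ-Solver)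
open import Data.List as List using (List; []; _∷_; length)
import Data.Nat.Coprimality as Coprime
import Data.Nat.DivMod as ℕD
open import Data.Nat.Divisibility as ℕ∣ using (divides; _∣_)
open import Data.Nat.Primality using (Prime; prime⇒nonTrivial)
open import Data.Product using (Σ)
open import Data.Product.Properties using (≡-dec)
open import Data.Rational as ℚ using (ℚ; mkℚ; 0ℚ; 1ℚ)
import Data.Rational.Properties as ℚₚ
open import Data.Rational.Unnormalised as ℚᵘ using (ℚᵘ; mkℚᵘ; *≡*) renaming (_≃_ to _≃ᵘ_)
import Data.Rational.Unnormalised.Properties as ℚᵘₚ
open import Data.Vec as Vec using (Vec; []; _∷_; map; zipWith; _++_)
open import Relation.Nullary using (does)
open import Relation.Nullary.Decidable using (map′; T?; _×-dec_)

-- Integer combinations in abelian groups and the descent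

exact : ∀ n .{{_ : ℕ.NonZero n}} b → b %ℕ n ≡ 0 → b ≡ (b /ℕ n) ℤ.* + n
exact n b eq = trans (ℤD.a≡a%ℕn+[a/ℕn]*n b n) (trans (cong (λ z → + z ℤ.+ (b /ℕ n) ℤ.* + n) eq) (ℤₚ.+-identityˡ ((b /ℕ n) ℤ.* + n)))

%ℕ≡0⇒∣ : ∀ n .{{_ : ℕ.NonZero n}} b → b %ℕ n ≡ 0 → n ∣ ∣ b ∣
%ℕ≡0⇒∣ n b eq = divides ∣ b /ℕ n ∣ (trans (cong ∣_∣ (exact n b eq)) (ℤₚ.abs-* (b /ℕ n) (+ n)))

module IntegerMultiples (G : AbelianGroup 0ℓ 0ℓ) where
  open AbelianGroup G
    renaming (_∙_ to _+_; ε to 0#; _⁻¹ to -_; refl to ≈-refl; sym to ≈-sym; trans to ≈-trans;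
              assoc to +-assoc; comm to +-comm; identityˡ to +-identityˡ; identityʳ to +-identityʳ;
              ∙-cong to +-cong; ∙-congˡ to +-congˡ; ∙-congʳ to +-congʳ; inverseˡ to -‿inverseˡ; inverseʳ to -‿inverseʳ;
              ⁻¹-cong to -‿cong)
  open import Algebra.Properties.AbelianGroup G using (⁻¹-∙-comm; ε⁻¹≈ε; ⁻¹-involutive; xyx⁻¹≈y; inverseˡ-unique)
  open import Algebra.Properties.CommutativeMonoid.Mult commutativeMonoid
    using (×-homo-+; ×-congʳ; ×-assocˡ; ×-distrib-+) renaming (_×_ to _·_)
  open import Algebra.Properties.CommutativeSemigroup commutativeSemigroup using (interchange)
  open import Relation.Binary.Reasoning.Setoid setoid

  _·ℤ_ : ℤ → Carrier → Carrier
  (+ n) ·ℤ P = n · P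
  -[1+ n ] ·ℤ P = - (suc n · P)

  lincomb : ∀ {k} → Vec ℤ k → Vec Carrier k → Carrier
  lincomb [] [] = 0#
  lincomb (a ∷ as) (P ∷ Ps) = a ·ℤ P + lincomb as Ps

  ⊖-·ℤ : ∀ m n P → (m ℤ.⊖ n) ·ℤ P ≈ m · P + - (n · P)
  ⊖-·ℤ m zero P = ≈-sym (≈-trans (+-congˡ ε⁻¹≈ε) (+-identityʳ _))
  ⊖-·ℤ zero (suc n) P = ≈-sym (+-identityˡ _)
  ⊖-·ℤ (suc m) (suc n) P = begin
    (suc m ℤ.⊖ suc n) ·ℤ P                 ≈⟨ reflexive (cong (_·ℤ P) (ℤₚ.[1+m]⊖[1+n]≡m⊖n m n)) ⟩
    (m ℤ.⊖ n) ·ℤ P                         ≈⟨ ⊖-·ℤ m n P ⟩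
    m · P + - (n · P)                      ≈⟨ +-identityˡ _ ⟨
    0# + (m · P + - (n · P))               ≈⟨ +-congʳ (-‿inverseʳ P) ⟨
    (P + - P) + (m · P + - (n · P))        ≈⟨ interchange _ _ _ _ ⟩
    (P + m · P) + (- P + - (n · P))        ≈⟨ +-congˡ (⁻¹-∙-comm _ _) ⟩
    suc m · P + - (suc n · P)              ∎

  ·ℤ-+ : ∀ i j P → (i ℤ.+ j) ·ℤ P ≈ i ·ℤ P + j ·ℤ P
  ·ℤ-+ (+ m) (+ n) P = ×-homo-+ P m n
  ·ℤ-+ (+ m) -[1+ n ] P = ⊖-·ℤ m (suc n) P
  ·ℤ-+ -[1+ m ] (+ n) P = ≈-trans (⊖-·ℤ n (suc m) P) (+-comm _ _)
  ·ℤ-+ -[1+ m ] -[1+ n ] P = begin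
    - (suc (suc (m ℕ.+ n)) · P)       ≈⟨ -‿cong (reflexive (cong (λ k → suc k · P) (sym (ℕₚ.+-suc m n)))) ⟩
    - ((suc m ℕ.+ suc n) · P)         ≈⟨ -‿cong (×-homo-+ P (suc m) (suc n)) ⟩
    - (suc m · P + suc n · P)         ≈⟨ ⁻¹-∙-comm _ _ ⟨
    - (suc m · P) + - (suc n · P)     ∎

  ·ℤ-neg : ∀ i P → (ℤ.- i) ·ℤ P ≈ - (i ·ℤ P)
  ·ℤ-neg (+ zero) P = ≈-sym ε⁻¹≈ε
  ·ℤ-neg (+ suc n) P = ≈-refl
  ·ℤ-neg -[1+ n ] P = ≈-sym (⁻¹-involutive _)

  -·comm : ∀ n P → - (n · P) ≈ n · (- P)
  -·comm zero P = ε⁻¹≈ε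
  -·comm (suc n) P = ≈-trans (≈-sym (⁻¹-∙-comm _ _)) (+-congˡ (-·comm n P))

  ·ℤ-* : ∀ n i P → (i ℤ.* + n) ·ℤ P ≈ n · (i ·ℤ P)
  ·ℤ-* n (+ m) P = ≈-trans (reflexive (cong (_·ℤ P) (trans (sym (ℤₚ.pos-* m n)) (cong +_ (ℕₚ.*-comm m n))))) (≈-sym (×-assocˡ P n m))
  ·ℤ-* n -[1+ m ] P = begin
    (-[1+ m ] ℤ.* + n) ·ℤ P          ≈⟨ reflexive (cong (_·ℤ P) (trans (sym (ℤₚ.neg-distribˡ-* (+ suc m) (+ n))) (cong ℤ.-_ (trans (sym (ℤₚ.pos-* (suc m) n)) (cong +_ (ℕₚ.*-comm (suc m) n)))))) ⟩
    (ℤ.- (+ (n ℕ.* suc m))) ·ℤ P     ≈⟨ ·ℤ-neg (+ (n ℕ.* suc m)) P ⟩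
    - ((n ℕ.* suc m) · P)            ≈⟨ -‿cong (×-assocˡ P n (suc m)) ⟨
    - (n · (suc m · P))              ≈⟨ -·comm n (suc m · P) ⟩
    n · (- (suc m · P))              ∎

  lincomb-+ : ∀ {k} (as bs : Vec ℤ k) Ps → lincomb (zipWith ℤ._+_ as bs) Ps ≈ lincomb as Ps + lincomb bs Ps
  lincomb-+ [] [] [] = ≈-sym (+-identityˡ 0#)
  lincomb-+ (a ∷ as) (b ∷ bs) (P ∷ Ps) = ≈-trans (+-cong (·ℤ-+ a b P) (lincomb-+ as bs Ps)) (interchange _ _ _ _)

  ·-0# : ∀ n → n · 0# ≈ 0#
  ·-0# zero = ≈-refl
  ·-0# (suc n) = ≈-trans (+-identityˡ _) (·-0# n)

  lincomb-* : ∀ {k} n (as : Vec ℤ k) Ps → lincomb (map (ℤ._* + n) as) Ps ≈ n · lincomb as Ps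
  lincomb-* n [] [] = ≈-sym (·-0# n)
  lincomb-* n (a ∷ as) (P ∷ Ps) = ≈-trans (+-cong (·ℤ-* n a P) (lincomb-* n as Ps)) (≈-sym (×-distrib-+ _ _ n))

  lincomb-neg : ∀ {k} (as : Vec ℤ k) Ps → lincomb (map ℤ.-_ as) Ps ≈ - lincomb as Ps
  lincomb-neg [] [] = ≈-sym ε⁻¹≈ε
  lincomb-neg (a ∷ as) (P ∷ Ps) = ≈-trans (+-cong (·ℤ-neg a P) (lincomb-neg as Ps)) (⁻¹-∙-comm _ _)

  lincomb-++ : ∀ {j k} (as : Vec ℤ j) (bs : Vec ℤ k) Ps Qs →
               lincomb (as ++ bs) (Ps ++ Qs) ≈ lincomb as Ps + lincomb bs Qs
  lincomb-++ [] bs [] Qs = ≈-sym (+-identityˡ _)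
  lincomb-++ (a ∷ as) bs (P ∷ Ps) Qs = ≈-trans (+-congˡ (lincomb-++ as bs Ps Qs)) (≈-sym (+-assoc _ _ _))

  lincombℕ : ∀ {k} → Vec ℕ k → Vec Carrier k → Carrier
  lincombℕ rs = lincomb (map +_ rs)

  module _ (ℓ : ℕ) .{{_ : ℕ.NonZero ℓ}} where

    residues : ∀ {k} → Vec ℤ k → Vec ℕ k
    residues = map (_%ℕ ℓ)

    quotients : ∀ {k} → Vec ℤ k → Vec ℤ k
    quotients = map (_/ℕ ℓ)

    split : ∀ {k} (as : Vec ℤ k) → as ≡ zipWith ℤ._+_ (map +_ (residues as)) (map (ℤ._* + ℓ) (quotients as))
    split [] = refl
    split (a ∷ as) = cong₂ _∷_ (ℤD.a≡a%ℕn+[a/ℕn]*n a ℓ) (split as)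

    lincomb-split : ∀ {k} (as : Vec ℤ k) Ps →
      lincomb as Ps ≈ lincombℕ (residues as) Ps + ℓ · lincomb (quotients as) Ps
    lincomb-split as Ps = ≈-trans (reflexive (cong (λ z → lincomb z Ps) (split as)))
      (≈-trans (lincomb-+ (map +_ (residues as)) (map (ℤ._* + ℓ) (quotients as)) Ps) (+-congˡ (lincomb-* ℓ (quotients as) Ps)))

    data AllZeroℕ : ∀ {k} → Vec ℕ k → Set where
      [] : AllZeroℕ []
      _∷_ : ∀ {k r} {rs : Vec ℕ k} → r ≡ 0 → AllZeroℕ rs → AllZeroℕ (r ∷ rs)

    lincombℕ-0 : ∀ {k} {rs : Vec ℕ k} Ps → AllZeroℕ rs → lincombℕ rs Ps ≈ 0#
    lincombℕ-0 [] [] = ≈-refl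
    lincombℕ-0 (P ∷ Ps) (refl ∷ z) = ≈-trans (+-identityˡ _) (lincombℕ-0 Ps z)

    AllZeroℕ-++ : ∀ {j k} (as : Vec ℤ j) {bs : Vec ℤ k} → AllZeroℕ (residues (as ++ bs)) → AllZeroℕ (residues as) × AllZeroℕ (residues bs)
    AllZeroℕ-++ [] z = [] , z
    AllZeroℕ-++ (a ∷ as) (r ∷ z) = let p , q = AllZeroℕ-++ as z in r ∷ p , q

  data IsZero : ∀ {k} → Vec ℤ k → Set where
    [] : IsZero []
    _∷_ : ∀ {k b} {bs : Vec ℤ k} → b ≡ + 0 → IsZero bs → IsZero (b ∷ bs)

  Bounded : ∀ {k} → ℕ → Vec ℤ k → Set
  Bounded n [] = Data.Unit.⊤ where import Data.Unit
  Bounded n (b ∷ bs) = ∣ b ∣ ℕ.≤ n × Bounded n bs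

  bounded : ∀ {k} (bs : Vec ℤ k) → ∃ λ n → Bounded n bs
  bounded [] = 0 , _
  bounded (b ∷ bs) = let n , h = bounded bs in
    ∣ b ∣ ℕ.⊔ n , ℕₚ.m≤m⊔n ∣ b ∣ n , weaken (ℕₚ.m≤n⊔m ∣ b ∣ n) bs h
    where
    weaken : ∀ {k m n} → m ℕ.≤ n → (bs : Vec ℤ k) → Bounded m bs → Bounded n bs
    weaken le [] _ = _
    weaken le (b ∷ bs) (h , hs) = ℕₚ.≤-trans h le , weaken le bs hs

  -- `Ts` may include torsion prime to ℓ, as a point of order 15 does for ℓ = 3. What counts is that
  -- it spans the ℓ-torsion and that it is independent modulo ℓ together with `Ps`.
  module Descent (ℓ : ℕ) (1<ℓ : 1 ℕ.< ℓ) .{{_ : ℕ.NonZero ℓ}} {j r} (Ts : Vec Carrier j) (Ps : Vec Carrier r)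
    (independent : ∀ (cs : Vec ℤ (j ℕ.+ r)) → lincomb cs (Ts ++ Ps) ≈ 0# → AllZeroℕ ℓ (residues ℓ cs))
    (torsion : ∀ S → ℓ · S ≈ 0# → ∃ λ as → S ≈ lincomb as Ts)
    where

    private
      divide : ∀ {k} (cs : Vec ℤ k) Qs → AllZeroℕ ℓ (residues ℓ cs) → lincomb cs Qs ≈ ℓ · lincomb (quotients ℓ cs) Qs
      divide cs Qs z = ≈-trans (lincomb-split ℓ cs Qs) (≈-trans (+-congʳ (lincombℕ-0 ℓ Qs z)) (+-identityˡ _))

      -- A relation is divisible by ℓ up to an ℓ-torsion point, which is absorbed into the Ts.
      halve : ∀ (as : Vec ℤ j) (bs : Vec ℤ r) → lincomb as Ts + lincomb bs Ps ≈ 0# →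
              AllZeroℕ ℓ (residues ℓ bs) × ∃ λ as′ → lincomb as′ Ts + lincomb (quotients ℓ bs) Ps ≈ 0#
      halve as bs eq = bs≡0 , zipWith ℤ._+_ as₁ (map ℤ.-_ as₂) , (begin
          lincomb (zipWith ℤ._+_ as₁ (map ℤ.-_ as₂)) Ts + lincomb bs₁ Ps  ≈⟨ +-congʳ (lincomb-+ as₁ (map ℤ.-_ as₂) Ts) ⟩
          (lincomb as₁ Ts + lincomb (map ℤ.-_ as₂) Ts) + lincomb bs₁ Ps   ≈⟨ +-congʳ (+-congˡ (lincomb-neg as₂ Ts)) ⟩
          (lincomb as₁ Ts + - lincomb as₂ Ts) + lincomb bs₁ Ps            ≈⟨ +-assoc _ _ _ ⟩
          lincomb as₁ Ts + (- lincomb as₂ Ts + lincomb bs₁ Ps)            ≈⟨ +-congˡ (+-comm _ _) ⟩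
          lincomb as₁ Ts + (lincomb bs₁ Ps + - lincomb as₂ Ts)            ≈⟨ +-assoc _ _ _ ⟨
          S + - lincomb as₂ Ts                                            ≈⟨ +-congʳ (proj₂ S-torsion) ⟩
          lincomb as₂ Ts + - lincomb as₂ Ts                               ≈⟨ -‿inverseʳ _ ⟩
          0#                                                              ∎)
        where
        all≡0 : AllZeroℕ ℓ (residues ℓ (as ++ bs))
        all≡0 = independent (as ++ bs) (≈-trans (lincomb-++ as bs Ts Ps) eq)
        as≡0 : AllZeroℕ ℓ (residues ℓ as)
        as≡0 = proj₁ (AllZeroℕ-++ ℓ as all≡0)
        bs≡0 : AllZeroℕ ℓ (residues ℓ bs)
        bs≡0 = proj₂ (AllZeroℕ-++ ℓ as all≡0)
        as₁ = quotients ℓ as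
        bs₁ = quotients ℓ bs
        S = lincomb as₁ Ts + lincomb bs₁ Ps
        S-torsion : ∃ λ as′ → S ≈ lincomb as′ Ts
        S-torsion = torsion S (≈-trans (×-distrib-+ _ _ ℓ)
          (≈-trans (≈-sym (+-cong (divide as Ts as≡0) (divide bs Ps bs≡0))) eq))
        as₂ = proj₁ S-torsion

      -- Termination: for a nonzero quotient q, ℓ ≥ 2 makes |q| smaller than |q|ℓ, so the common
      -- bound drops by at least one in each round.
      shrink : ∀ {k} n (bs : Vec ℤ k) → AllZeroℕ ℓ (residues ℓ bs) → Bounded (suc n) bs → Bounded n (quotients ℓ bs)
      shrink n [] _ _ = _
      shrink n (b ∷ bs) (r≡0 ∷ z) (h , hs) = smaller ∣ b /ℕ ℓ ∣ (subst (ℕ._≤ suc n) (trans (cong ∣_∣ (exact ℓ b r≡0)) (ℤₚ.abs-* (b /ℕ ℓ) (+ ℓ))) h) , shrink n bs z hs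
        where
        smaller : ∀ m → m ℕ.* ℓ ℕ.≤ suc n → m ℕ.≤ n
        smaller zero _ = z≤n
        smaller (suc m) le = ℕₚ.≤-pred (ℕₚ.<-≤-trans (ℕₚ.m<m*n (suc m) ℓ 1<ℓ) le)

      unzero : ∀ {k} (bs : Vec ℤ k) → AllZeroℕ ℓ (residues ℓ bs) → IsZero (quotients ℓ bs) → IsZero bs
      unzero [] _ _ = []
      unzero (b ∷ bs) (r≡0 ∷ z) (q≡0 ∷ qs) = trans (exact ℓ b r≡0) (cong (ℤ._* + ℓ) q≡0) ∷ unzero bs z qs

      bounded-0 : ∀ {k} (bs : Vec ℤ k) → Bounded 0 bs → IsZero bs
      bounded-0 [] _ = []
      bounded-0 (b ∷ bs) (h , hs) = ℤₚ.∣i∣≡0⇒i≡0 (ℕₚ.n≤0⇒n≡0 h) ∷ bounded-0 bs hs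

      descend : ∀ n (as : Vec ℤ j) (bs : Vec ℤ r) → Bounded n bs → lincomb as Ts + lincomb bs Ps ≈ 0# → IsZero bs
      descend zero as bs h _ = bounded-0 bs h
      descend (suc n) as bs h eq = let z , as′ , eq′ = halve as bs eq in
        unzero bs z (descend n as′ (quotients ℓ bs) (shrink n bs z h) eq′)

    free-part-zero : ∀ (as : Vec ℤ j) (bs : Vec ℤ r) → lincomb as Ts + lincomb bs Ps ≈ 0# → IsZero bs
    free-part-zero as bs = descend (proj₁ (bounded bs)) as bs (proj₂ (bounded bs))

  ·ℤ-killed : ∀ n T → n · T ≈ 0# → ∀ i → (i ℤ.* + n) ·ℤ T ≈ 0#
  ·ℤ-killed n T nT≈0 i = ≈-trans (·ℤ-* n i T) (swap i)
    where
    swap : ∀ i → n · (i ·ℤ T) ≈ 0#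
    swap (+ m) = ≈-trans (×-assocˡ T n m) (≈-trans (reflexive (cong (_· T) (ℕₚ.*-comm n m)))
      (≈-trans (≈-sym (×-assocˡ T m n)) (≈-trans (×-congʳ m nT≈0) (·-0# m))))
    swap -[1+ m ] = ≈-trans (≈-sym (-·comm n (suc m · T))) (≈-trans (-‿cong (swap (+ suc m))) ε⁻¹≈ε)

  order-divides : ∀ n .{{_ : ℕ.NonZero n}} T → n · T ≈ 0# → (∀ k → k ℕ.< n → k · T ≈ 0# → k ≡ 0) →
                  ∀ a → a ·ℤ T ≈ 0# → n ∣ ∣ a ∣
  order-divides n T nT≈0 minimal a aT≈0 = %ℕ≡0⇒∣ n a (minimal (a %ℕ n) (ℤD.n%ℕd<d a n) (begin
      (a %ℕ n) · T                                      ≈⟨ +-identityʳ _ ⟨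
      (a %ℕ n) · T + 0#                                 ≈⟨ +-congˡ (·ℤ-killed n T nT≈0 (a /ℕ n)) ⟨
      (a %ℕ n) · T + ((a /ℕ n) ℤ.* + n) ·ℤ T            ≈⟨ ·ℤ-+ (+ (a %ℕ n)) ((a /ℕ n) ℤ.* + n) T ⟨
      (+ (a %ℕ n) ℤ.+ (a /ℕ n) ℤ.* + n) ·ℤ T            ≈⟨ reflexive (cong (_·ℤ T) (sym (ℤD.a≡a%ℕn+[a/ℕn]*n a n))) ⟩
      a ·ℤ T                                            ≈⟨ aT≈0 ⟩
      0#                                                ∎))

-- Integers inside the rationals and integrality of roots

ratio : ℤ → ℚ
ratio i = i ℚ./ 1

module ℚ-Solver = IntegerSolver ℚₚ.+-*-commutativeRing

toℚᵘ-ratio : ∀ i → ℚ.toℚᵘ (ratio i) ≃ᵘ mkℚᵘ i 0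
toℚᵘ-ratio i = ℚₚ.toℚᵘ-fromℚᵘ (mkℚᵘ i 0)

-- The gcd in a normalised sum is stuck on variables, so the identity is verified for unnormalised
-- fractions and carried back.
ratio-+ : ∀ i j → ratio i ℚ.+ ratio j ≡ ratio (i ℤ.+ j)
ratio-+ i j = ℚₚ.toℚᵘ-injective (begin
  ℚ.toℚᵘ (ratio i ℚ.+ ratio j)                   ≈⟨ ℚₚ.toℚᵘ-homo-+ (ratio i) (ratio j) ⟩
  ℚ.toℚᵘ (ratio i) ℚᵘ.+ ℚ.toℚᵘ (ratio j)         ≈⟨ ℚᵘₚ.+-cong (toℚᵘ-ratio i) (toℚᵘ-ratio j) ⟩
  mkℚᵘ i 0 ℚᵘ.+ mkℚᵘ j 0                         ≈⟨ *≡* (cong (ℤ._* + 1) (cong₂ ℤ._+_ (ℤₚ.*-identityʳ i) (ℤₚ.*-identityʳ j))) ⟩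
  mkℚᵘ (i ℤ.+ j) 0                               ≈⟨ toℚᵘ-ratio (i ℤ.+ j) ⟨
  ℚ.toℚᵘ (ratio (i ℤ.+ j))                       ∎)
  where open import Relation.Binary.Reasoning.Setoid ℚᵘₚ.≃-setoid

ratio-* : ∀ i j → ratio i ℚ.* ratio j ≡ ratio (i ℤ.* j)
ratio-* i j = ℚₚ.toℚᵘ-injective (begin
  ℚ.toℚᵘ (ratio i ℚ.* ratio j)                   ≈⟨ ℚₚ.toℚᵘ-homo-* (ratio i) (ratio j) ⟩
  ℚ.toℚᵘ (ratio i) ℚᵘ.* ℚ.toℚᵘ (ratio j)         ≈⟨ ℚᵘₚ.*-cong (toℚᵘ-ratio i) (toℚᵘ-ratio j) ⟩
  mkℚᵘ (i ℤ.* j) 0                               ≈⟨ toℚᵘ-ratio (i ℤ.* j) ⟨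
  ℚ.toℚᵘ (ratio (i ℤ.* j))                       ∎)
  where open import Relation.Binary.Reasoning.Setoid ℚᵘₚ.≃-setoid

ratio-neg : ∀ i → ℚ.- ratio i ≡ ratio (ℤ.- i)
ratio-neg i = ℚₚ.toℚᵘ-injective (begin
  ℚ.toℚᵘ (ℚ.- ratio i)             ≈⟨ ℚₚ.toℚᵘ-homo‿- (ratio i) ⟩
  ℚᵘ.- ℚ.toℚᵘ (ratio i)            ≈⟨ ℚᵘₚ.-‿cong (toℚᵘ-ratio i) ⟩
  mkℚᵘ (ℤ.- i) 0                   ≈⟨ toℚᵘ-ratio (ℤ.- i) ⟨
  ℚ.toℚᵘ (ratio (ℤ.- i))           ∎)
  where open import Relation.Binary.Reasoning.Setoid ℚᵘₚ.≃-setoid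

ratio-injective : ∀ {i j} → ratio i ≡ ratio j → i ≡ j
ratio-injective {i} {j} eq with ℚᵘₚ.≃-trans (ℚᵘₚ.≃-sym (toℚᵘ-ratio i)) (ℚᵘₚ.≃-trans (ℚₚ.toℚᵘ-cong eq) (toℚᵘ-ratio j))
... | *≡* h = trans (sym (ℤₚ.*-identityʳ i)) (trans h (ℤₚ.*-identityʳ j))

clear-denominator : ∀ q → q ℚ.* ratio (ℚ.↧ q) ≡ ratio (ℚ.↥ q)
clear-denominator q@(mkℚ p s-1 _) = ℚₚ.toℚᵘ-injective (begin
  ℚ.toℚᵘ (q ℚ.* ratio (+ suc s-1))                ≈⟨ ℚₚ.toℚᵘ-homo-* q (ratio (+ suc s-1)) ⟩
  mkℚᵘ p s-1 ℚᵘ.* ℚ.toℚᵘ (ratio (+ suc s-1))      ≈⟨ ℚᵘₚ.*-congˡ {mkℚᵘ p s-1} (toℚᵘ-ratio (+ suc s-1)) ⟩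
  mkℚᵘ p s-1 ℚᵘ.* mkℚᵘ (+ suc s-1) 0              ≈⟨ *≡* (trans (ℤₚ.*-assoc p (+ suc s-1) (+ 1)) (cong (p ℤ.*_) (trans (ℤₚ.*-identityʳ (+ suc s-1)) (cong +_ (sym (ℕₚ.*-identityʳ (suc s-1))))))) ⟩
  mkℚᵘ p 0                                        ≈⟨ toℚᵘ-ratio p ⟨
  ℚ.toℚᵘ (ratio p)                                ∎)
  where open import Relation.Binary.Reasoning.Setoid ℚᵘₚ.≃-setoid

-- The rational root theorem for t³ - it - j.
integral : ∀ q i j → q ℚ.* (q ℚ.* q) ≡ ratio i ℚ.* q ℚ.+ ratio j → ∃ λ n → q ≡ ratio n
integral q@(mkℚ p s-1 c) i j eq = p , (begin
    q                            ≡⟨ ℚₚ.*-identityʳ q ⟨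
    q ℚ.* 1ℚ                     ≡⟨ cong (λ z → q ℚ.* ratio (+ z)) s≡1 ⟨
    q ℚ.* ratio (+ s)            ≡⟨ clear-denominator q ⟩
    ratio p                      ∎)
  where
  open ≡.≡-Reasoning
  s = suc s-1
  S = ratio (+ s)
  cleared : p ℤ.* (p ℤ.* p) ≡ (i ℤ.* (p ℤ.* + s) ℤ.+ j ℤ.* (+ s ℤ.* + s)) ℤ.* + s
  cleared = ratio-injective (begin
    ratio (p ℤ.* (p ℤ.* p))
      ≡⟨ trans (sym (ratio-* p (p ℤ.* p))) (cong (ratio p ℚ.*_) (sym (ratio-* p p))) ⟩
    ratio p ℚ.* (ratio p ℚ.* ratio p)
      ≡⟨ cong (λ z → z ℚ.* (z ℚ.* z)) (clear-denominator q) ⟨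
    (q ℚ.* S) ℚ.* ((q ℚ.* S) ℚ.* (q ℚ.* S))
      ≡⟨ ℚ-Solver.solve 2 (λ q s → (q :* s) :* ((q :* s) :* (q :* s)) := (q :* (q :* q)) :* (s :* (s :* s))) refl q S ⟩
    (q ℚ.* (q ℚ.* q)) ℚ.* (S ℚ.* (S ℚ.* S))
      ≡⟨ cong (ℚ._* (S ℚ.* (S ℚ.* S))) eq ⟩
    (ratio i ℚ.* q ℚ.+ ratio j) ℚ.* (S ℚ.* (S ℚ.* S))
      ≡⟨ ℚ-Solver.solve 4 (λ i q j s → (i :* q :+ j) :* (s :* (s :* s)) := (i :* ((q :* s) :* s) :+ j :* (s :* s)) :* s) refl (ratio i) q (ratio j) S ⟩
    (ratio i ℚ.* ((q ℚ.* S) ℚ.* S) ℚ.+ ratio j ℚ.* (S ℚ.* S)) ℚ.* S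
      ≡⟨ cong (λ z → (ratio i ℚ.* (z ℚ.* S) ℚ.+ ratio j ℚ.* (S ℚ.* S)) ℚ.* S) (clear-denominator q) ⟩
    (ratio i ℚ.* (ratio p ℚ.* S) ℚ.+ ratio j ℚ.* (S ℚ.* S)) ℚ.* S
      ≡⟨ cong (ℚ._* S) (cong₂ ℚ._+_ (trans (cong (ratio i ℚ.*_) (ratio-* p (+ s))) (ratio-* i (p ℤ.* + s))) (trans (cong (ratio j ℚ.*_) (ratio-* (+ s) (+ s))) (ratio-* j (+ s ℤ.* + s)))) ⟩
    (ratio (i ℤ.* (p ℤ.* + s)) ℚ.+ ratio (j ℤ.* (+ s ℤ.* + s))) ℚ.* S
      ≡⟨ trans (cong (ℚ._* S) (ratio-+ (i ℤ.* (p ℤ.* + s)) (j ℤ.* (+ s ℤ.* + s)))) (ratio-* (i ℤ.* (p ℤ.* + s) ℤ.+ j ℤ.* (+ s ℤ.* + s)) (+ s)) ⟩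
    ratio ((i ℤ.* (p ℤ.* + s) ℤ.+ j ℤ.* (+ s ℤ.* + s)) ℤ.* + s) ∎)
    where open ℚ-Solver using (_:*_; _:+_; _:=_)
  s∣p³ : s ℕ∣.∣ ∣ p ∣ ℕ.* (∣ p ∣ ℕ.* ∣ p ∣)
  s∣p³ = ℕ∣.divides ∣ i ℤ.* (p ℤ.* + s) ℤ.+ j ℤ.* (+ s ℤ.* + s) ∣ (trans (cong (∣ p ∣ ℕ.*_) (sym (ℤₚ.abs-* p p))) (trans (sym (ℤₚ.abs-* p (p ℤ.* p))) (trans (cong ∣_∣ cleared) (ℤₚ.abs-* (i ℤ.* (p ℤ.* + s) ℤ.+ j ℤ.* (+ s ℤ.* + s)) (+ s)))))
  coprime : Coprime.Coprime s ∣ p ∣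
  coprime = Coprime.sym (Coprime.recompute c)
  s≡1 : s ≡ 1
  s≡1 = coprime (ℕ∣.∣-refl , Coprime.coprime-divisor coprime (Coprime.coprime-divisor coprime s∣p³))

-- Congruences and the residue test for powers

module Congruence (m : ℕ) where

  infix 4 _≡ₘ_
  record _≡ₘ_ (i j : ℤ) : Set where
    constructor _,_
    field
      factor : ℤ
      equation : i ≡ j ℤ.+ factor ℤ.* + m

  open ℤ-Solver using (solve; _:=_; _:+_; _:*_; _:-_)

  ≡ₘ-* : ∀ {i i′ j j′} → i ≡ₘ i′ → j ≡ₘ j′ → i ℤ.* j ≡ₘ i′ ℤ.* j′
  ≡ₘ-* {i′ = i′} {j′ = j′} (k , refl) (l , refl) = i′ ℤ.* l ℤ.+ k ℤ.* j′ ℤ.+ k ℤ.* l ℤ.* + m ,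
    solve 5 (λ i k j l m → (i :+ k :* m) :* (j :+ l :* m) := i :* j :+ (i :* l :+ k :* j :+ k :* l :* m) :* m) refl i′ k j′ l (+ m)

  ≡ₘ-+ : ∀ {i i′ j j′} → i ≡ₘ i′ → j ≡ₘ j′ → i ℤ.+ j ≡ₘ i′ ℤ.+ j′
  ≡ₘ-+ {i′ = i′} {j′ = j′} (k , refl) (l , refl) = k ℤ.+ l ,
    solve 5 (λ i k j l m → (i :+ k :* m) :+ (j :+ l :* m) := i :+ j :+ (k :+ l) :* m) refl i′ k j′ l (+ m)

  ≡ₘ-refl : ∀ {i} → i ≡ₘ i
  ≡ₘ-refl {i} = + 0 , sym (ℤₚ.+-identityʳ i)

  ≡ₘ-trans-sym : ∀ {i j i′ j′} → i ≡ₘ i′ → j ≡ₘ j′ → i ≡ j → i′ ≡ₘ j′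
  ≡ₘ-trans-sym {i′ = i′} {j′} (k , refl) (l , refl) eq = l ℤ.- k , (begin
    i′                                             ≡⟨ solve 3 (λ i k m → i := (i :+ k :* m) :- k :* m) refl i′ k (+ m) ⟩
    (i′ ℤ.+ k ℤ.* + m) ℤ.- k ℤ.* + m               ≡⟨ cong (ℤ._- k ℤ.* + m) eq ⟩
    (j′ ℤ.+ l ℤ.* + m) ℤ.- k ℤ.* + m               ≡⟨ solve 4 (λ j l k m → (j :+ l :* m) :- k :* m := j :+ (l :- k) :* m) refl j′ l k (+ m) ⟩
    j′ ℤ.+ (l ℤ.- k) ℤ.* + m                       ∎)
    where open ≡.≡-Reasoning

  residue : .{{_ : ℕ.NonZero m}} → ∀ i → i ≡ₘ + (i ℤD.%ℕ m)
  residue i = i ℤD./ℕ m , ℤD.a≡a%ℕn+[a/ℕn]*n i m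

  distance : .{{_ : ℕ.NonZero m}} → ∀ x y → + x ≡ₘ + y → ∣ x ℤ.⊖ y ∣ ℕ.% m ≡ 0
  distance x y (k , eq) = ℕ∣.n∣m⇒m%n≡0 ∣ x ℤ.⊖ y ∣ m (ℕ∣.divides ∣ k ∣ (begin
    ∣ x ℤ.⊖ y ∣                              ≡⟨ cong ∣_∣ (ℤₚ.m-n≡m⊖n x y) ⟨
    ∣ + x ℤ.- + y ∣                          ≡⟨ cong (λ z → ∣ z ℤ.- + y ∣) eq ⟩
    ∣ (+ y ℤ.+ k ℤ.* + m) ℤ.- + y ∣          ≡⟨ cong ∣_∣ (solve 2 (λ y z → (y :+ z) :- y := z) refl (+ y) (k ℤ.* + m)) ⟩
    ∣ k ℤ.* + m ∣                            ≡⟨ ℤₚ.abs-* k (+ m) ⟩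
    ∣ k ∣ ℕ.* m                              ∎))
    where open ≡.≡-Reasoning

allBelow : ℕ → (ℕ → Bool) → Bool
allBelow zero p = true
allBelow (suc n) p = p n ∧ allBelow n p

allBelow-sound : ∀ n p → allBelow n p ≡ true → ∀ k → k ℕ.< n → p k ≡ true
allBelow-sound (suc n) p eq k k<1+n with p n in pn | k ℕₚ.≟ n
... | true | yes refl = pn
... | true | no k≢n = allBelow-sound n p eq k (ℕₚ.≤∧≢⇒< (ℕₚ.≤-pred k<1+n) k≢n)

congruentᵇ : (m : ℕ) .{{_ : ℕ.NonZero m}} → ℕ → ℕ → Bool
congruentᵇ m x y = (∣ x ℤ.⊖ y ∣ ℕ.% m) ℕ.≡ᵇ 0

-- The conditions on the norm n and the trace U of a square root, resp. a cube root, of an element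
-- with norm N and rational part a.
RootEquations : ℕ → ℤ → ℤ → ℤ → ℤ → Set
RootEquations 2 N a n U = n ℤ.* n ≡ N × U ℤ.* U ≡ + 2 ℤ.* (a ℤ.+ n)
RootEquations 3 N a n U = n ℤ.* (n ℤ.* n) ≡ N × U ℤ.* (U ℤ.* U) ≡ + 3 ℤ.* (n ℤ.* U) ℤ.+ + 2 ℤ.* a
RootEquations _ N a n U = Data.Unit.⊤ where import Data.Unit

-- An integer solution reduces to residues, so the search over n and U below m is exhaustive. For ℓ
-- = 2 and a rational number a the pair n = -a, U = 0 always solves the equations, so only elements
-- with an irrational part can be detected.
unsolvableMod : ℕ → (m : ℕ) .{{_ : ℕ.NonZero m}} → ℤ → ℤ → Bool
unsolvableMod ℓ m N a = go ℓ (N ℤD.%ℕ m) (a ℤD.%ℕ m)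
  where
  go : ℕ → ℕ → ℕ → Bool
  go 2 N a = allBelow m λ n → if congruentᵇ m (n ℕ.* n) N
    then allBelow m (λ U → not (congruentᵇ m (U ℕ.* U) (2 ℕ.* (a ℕ.+ n)))) else true
  go 3 N a = allBelow m λ n → if congruentᵇ m (n ℕ.* (n ℕ.* n)) N
    then allBelow m (λ U → not (congruentᵇ m (U ℕ.* (U ℕ.* U)) (3 ℕ.* (n ℕ.* U) ℕ.+ 2 ℕ.* a))) else true
  -- Other exponents are never certified, in accordance with the trivial `RootEquations` for them.
  go _ N a = false

unsolvableMod-sound : ∀ ℓ m .{{_ : ℕ.NonZero m}} N a → unsolvableMod ℓ m N a ≡ true → ∀ n U → ¬ RootEquations ℓ N a n U
unsolvableMod-sound 2 m N a check n U (eq , eq′) = go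
  where
  open Congruence m
  N′ = N ℤD.%ℕ m
  a′ = a ℤD.%ℕ m
  n′ = n ℤD.%ℕ m
  U′ = U ℤD.%ℕ m
  first : congruentᵇ m (n′ ℕ.* n′) N′ ≡ true
  first = cong (ℕ._≡ᵇ 0) (distance (n′ ℕ.* n′) N′ (subst (_≡ₘ + N′) (sym (ℤₚ.pos-* n′ n′))
    (≡ₘ-trans-sym (≡ₘ-* (residue n) (residue n)) (residue N) eq)))
  second : congruentᵇ m (U′ ℕ.* U′) (2 ℕ.* (a′ ℕ.+ n′)) ≡ true
  second = cong (ℕ._≡ᵇ 0) (distance (U′ ℕ.* U′) (2 ℕ.* (a′ ℕ.+ n′)) (≡.subst₂ _≡ₘ_ (sym (ℤₚ.pos-* U′ U′)) (sym (ℤₚ.pos-* 2 (a′ ℕ.+ n′)))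
    (≡ₘ-trans-sym (≡ₘ-* (residue U) (residue U)) (≡ₘ-* (≡ₘ-refl {+ 2}) (≡ₘ-+ (residue a) (residue n))) eq′)))
  go : ⊥
  go with allBelow-sound m _ check n′ (ℤD.n%ℕd<d n m)
  ... | h rewrite first with allBelow-sound m _ h U′ (ℤD.n%ℕd<d U m)
  ...   | h′ rewrite second with h′
  ...     | ()
unsolvableMod-sound 3 m N a check n U (eq , eq′) = go
  where
  open Congruence m
  N′ = N ℤD.%ℕ m
  a′ = a ℤD.%ℕ m
  n′ = n ℤD.%ℕ m
  U′ = U ℤD.%ℕ m
  cube : ∀ x → + x ℤ.* (+ x ℤ.* + x) ≡ + (x ℕ.* (x ℕ.* x))
  cube x = trans (cong (+ x ℤ.*_) (sym (ℤₚ.pos-* x x))) (sym (ℤₚ.pos-* x (x ℕ.* x)))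
  right : + 3 ℤ.* (+ n′ ℤ.* + U′) ℤ.+ + 2 ℤ.* + a′ ≡ + (3 ℕ.* (n′ ℕ.* U′) ℕ.+ 2 ℕ.* a′)
  right = cong₂ ℤ._+_ (trans (cong (+ 3 ℤ.*_) (sym (ℤₚ.pos-* n′ U′))) (sym (ℤₚ.pos-* 3 (n′ ℕ.* U′)))) (sym (ℤₚ.pos-* 2 a′))
  first : congruentᵇ m (n′ ℕ.* (n′ ℕ.* n′)) N′ ≡ true
  first = cong (ℕ._≡ᵇ 0) (distance (n′ ℕ.* (n′ ℕ.* n′)) N′ (subst (_≡ₘ + N′) (cube n′)
    (≡ₘ-trans-sym (≡ₘ-* (residue n) (≡ₘ-* (residue n) (residue n))) (residue N) eq)))
  second : congruentᵇ m (U′ ℕ.* (U′ ℕ.* U′)) (3 ℕ.* (n′ ℕ.* U′) ℕ.+ 2 ℕ.* a′) ≡ true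
  second = cong (ℕ._≡ᵇ 0) (distance (U′ ℕ.* (U′ ℕ.* U′)) (3 ℕ.* (n′ ℕ.* U′) ℕ.+ 2 ℕ.* a′) (≡.subst₂ _≡ₘ_ (cube U′) right
    (≡ₘ-trans-sym (≡ₘ-* (residue U) (≡ₘ-* (residue U) (residue U)))
      (≡ₘ-+ (≡ₘ-* (≡ₘ-refl {+ 3}) (≡ₘ-* (residue n) (residue U))) (≡ₘ-* (≡ₘ-refl {+ 2}) (residue a))) eq′)))
  go : ⊥
  go with allBelow-sound m _ check n′ (ℤD.n%ℕd<d n m)
  ... | h rewrite first with allBelow-sound m _ h U′ (ℤD.n%ℕd<d U m)
  ...   | h′ rewrite second with h′
  ...     | ()
unsolvableMod-sound 0 m N a () n U
unsolvableMod-sound 1 m N a () n U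
unsolvableMod-sound (suc (suc (suc (suc _)))) m N a () n U

-- The field K, the ring ℤ[√d] and roots of its elements

module QuadraticField (d : ℤ) (nonsquare : ∀ q → q ℚ.* q ≢ ratio d) where
  open Field d
  open ℚ-Solver using (_:*_; _:+_; _:=_; _:-_; :-_; :0; :1) renaming (solve to solveℚ)
  private
    module K = Quadratic ℚₚ.+-*-isCommutativeRing (ratio d)

  invℚ-inverse : ∀ q → q ≢ 0ℚ → q ℚ.* invℚ q ≡ 1ℚ
  invℚ-inverse q q≢0 with q ℚₚ.≟ 0ℚ
  ... | yes q≡0 = ⊥-elim (q≢0 q≡0)
  ... | no q≢0′ = ℚₚ.*-inverseʳ q {{ℚ.≢-nonZero q≢0′}}

  normK : QF d → ℚ
  normK = K.norm

  -- If a² = db² with b nonzero, then d = (a/b)² contradicts `nonsquare`; with b = 0 the norm is a².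
  normK≢0 : ∀ x → x ≢ 0K → normK x ≢ 0ℚ
  normK≢0 (a , b) x≢0 eq with b ℚₚ.≟ 0ℚ
  ... | yes refl = x≢0 (cong (_, 0ℚ) a≡0)
    where
    a²≡0 : a ℚ.* a ≡ 0ℚ
    a²≡0 = trans (solveℚ 2 (λ a s → a :* a := a :* a :- s :* (:0 :* :0)) refl a (ratio d)) eq
    a≡0 : a ≡ 0ℚ
    a≡0 with a ℚₚ.≟ 0ℚ
    ... | yes a≡0 = a≡0
    ... | no a≢0 = begin
      a                              ≡⟨ ℚₚ.*-identityʳ a ⟨
      a ℚ.* 1ℚ                       ≡⟨ cong (a ℚ.*_) (invℚ-inverse a a≢0) ⟨
      a ℚ.* (a ℚ.* invℚ a)           ≡⟨ ℚₚ.*-assoc a a (invℚ a) ⟨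
      a ℚ.* a ℚ.* invℚ a             ≡⟨ cong (ℚ._* invℚ a) a²≡0 ⟩
      0ℚ ℚ.* invℚ a                  ≡⟨ ℚₚ.*-zeroˡ (invℚ a) ⟩
      0ℚ                             ∎
      where open ≡.≡-Reasoning
  ... | no b≢0 = nonsquare (a ℚ.* i) (begin
      (a ℚ.* i) ℚ.* (a ℚ.* i)
        ≡⟨ solveℚ 4 (λ a b s i → (a :* i) :* (a :* i) := (a :* a :- s :* (b :* b)) :* (i :* i) :+ s :* ((b :* i) :* (b :* i))) refl a b s i ⟩
      (a ℚ.* a ℚ.- s ℚ.* (b ℚ.* b)) ℚ.* (i ℚ.* i) ℚ.+ s ℚ.* ((b ℚ.* i) ℚ.* (b ℚ.* i))
        ≡⟨ cong₂ (λ z w → z ℚ.* (i ℚ.* i) ℚ.+ s ℚ.* (w ℚ.* w)) eq (invℚ-inverse b b≢0) ⟩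
      0ℚ ℚ.* (i ℚ.* i) ℚ.+ s ℚ.* (1ℚ ℚ.* 1ℚ)
        ≡⟨ solveℚ 2 (λ s i → :0 :* i :+ s :* (:1 :* :1) := s) refl s (i ℚ.* i) ⟩
      s ∎)
    where
    open ≡.≡-Reasoning
    i = invℚ b
    s = ratio d

  field-K : DiscreteField
  field-K = record
    { Carrier = QF d ; _+_ = _+K_ ; _*_ = _*K_ ; -_ = -K_ ; 0# = 0K ; 1# = 1K
    ; isCommutativeRing = K.⊕-⊛-isCommutativeRing
    ; _≟_ = ≡-dec ℚₚ._≟_ ℚₚ._≟_
    ; _⁻¹ = invK
    ; *-inverseʳ = λ {x} x≢0 → inverse x x≢0
    ; ι = λ n → ratio (+ n) , 0ℚ
    ; ι-zero = refl
    ; ι-suc = λ n → cong₂ _,_ (sym (ratio-+ (+ 1) (+ n))) refl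
    ; ι-suc≢0 = λ n eq → suc≢0 {n} (ratio-injective {+ suc n} {+ 0} (cong proj₁ eq)) }
    where
    suc≢0 : ∀ {n} → + suc n ≢ + 0
    suc≢0 ()
    inverse : ∀ x → x ≢ 0K → x *K invK x ≡ 1K
    inverse x@(a , b) x≢0 = cong₂ _,_
      (trans (solveℚ 4 (λ a b s n → a :* (a :* n) :+ s :* (b :* (:- (b :* n))) := (a :* a :- s :* (b :* b)) :* n) refl a b (ratio d) n)
             (invℚ-inverse (normK x) (normK≢0 x x≢0)))
      (solveℚ 3 (λ a b n → a :* (:- (b :* n)) :+ b :* (a :* n) := :0) refl a b n)
      where n = invℚ (normK x)

  module Z = Quadratic ℤₚ.+-*-isCommutativeRing d

  embed : ℤ × ℤ → QF d
  embed (a , b) = ratio a , ratio b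

  embed-+ : ∀ x y → embed x +K embed y ≡ embed (x Z.⊕ y)
  embed-+ (a , b) (c , e) = cong₂ _,_ (ratio-+ a c) (ratio-+ b e)

  embed-neg : ∀ x → -K embed x ≡ embed (Z.⊝ x)
  embed-neg (a , b) = cong₂ _,_ (ratio-neg a) (ratio-neg b)

  embed-- : ∀ x y → embed x -K embed y ≡ embed (x Z.⊕ (Z.⊝ y))
  embed-- x y = trans (cong (embed x +K_) (embed-neg y)) (embed-+ x (Z.⊝ y))

  embed-* : ∀ x y → embed x *K embed y ≡ embed (x Z.⊛ y)
  embed-* (a , b) (c , e) = cong₂ _,_
    (trans (cong₂ ℚ._+_ (ratio-* a c) (trans (cong (ratio d ℚ.*_) (ratio-* b e)) (ratio-* d (b ℤ.* e)))) (ratio-+ (a ℤ.* c) (d ℤ.* (b ℤ.* e))))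
    (trans (cong₂ ℚ._+_ (ratio-* a e) (ratio-* b c)) (ratio-+ (a ℤ.* e) (b ℤ.* c)))

  embed-injective : ∀ {x y} → embed x ≡ embed y → x ≡ y
  embed-injective eq = cong₂ _,_ (ratio-injective (cong proj₁ eq)) (ratio-injective (cong proj₂ eq))

  normK-embed : ∀ x → normK (embed x) ≡ ratio (Z.norm x)
  normK-embed (a , b) = trans (cong₂ ℚ._+_ (ratio-* a a)
      (trans (cong ℚ.-_ (trans (cong (ratio d ℚ.*_) (ratio-* b b)) (ratio-* d (b ℤ.* b)))) (ratio-neg (d ℤ.* (b ℤ.* b)))))
    (ratio-+ (a ℤ.* a) (ℤ.- (d ℤ.* (b ℤ.* b))))

  open PowerClasses field-K using (_^_)
  open DiscreteField field-K using (*-identityʳ)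

  -- For w = u + v√d the trace U = 2u satisfies U² = 2(Re w² + N w). The norm and U are rational
  -- roots of monic integral equations, hence integers, although u itself may be a half-integer.
  square-root : ∀ z w → w ^ 2 ≡ embed z → ∃₂ λ n U → RootEquations 2 (Z.norm z) (proj₁ z) n U
  square-root z@(a , b) w@(u , v) eq = n₀ , U₀ , n₀²≡N , U₀²≡2a+2n₀
    where
    open ≡.≡-Reasoning
    n = normK w
    U = u ℚ.+ u
    w²≡z : w *K w ≡ embed z
    w²≡z = trans (cong (w *K_) (sym (*-identityʳ w))) eq
    re : u ℚ.* u ℚ.+ ratio d ℚ.* (v ℚ.* v) ≡ ratio a
    re = cong proj₁ w²≡z
    n² : n ℚ.* n ≡ ratio (Z.norm z)
    n² = trans (sym (K.norm-* w w)) (trans (cong normK w²≡z) (normK-embed z))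
    n-integral : ∃ λ m → n ≡ ratio m
    n-integral = integral n (Z.norm z) (+ 0) (trans (solveℚ 1 (λ n → n :* (n :* n) := (n :* n) :* n :+ :0) refl n) (cong (λ z → z ℚ.* n ℚ.+ 0ℚ) n²))
    n₀ = proj₁ n-integral
    n₀²≡N : n₀ ℤ.* n₀ ≡ Z.norm z
    n₀²≡N = ratio-injective (trans (sym (ratio-* n₀ n₀)) (trans (cong₂ ℚ._*_ (sym (proj₂ n-integral)) (sym (proj₂ n-integral))) n²))
    U² : U ℚ.* U ≡ ratio (+ 2 ℤ.* (a ℤ.+ n₀))
    U² = begin
      U ℚ.* U
        ≡⟨ solveℚ 3 (λ u v s → (u :+ u) :* (u :+ u) := (:1 :+ :1) :* ((u :* u :+ s :* (v :* v)) :+ (u :* u :- s :* (v :* v)))) refl u v (ratio d) ⟩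
      ratio (+ 2) ℚ.* ((u ℚ.* u ℚ.+ ratio d ℚ.* (v ℚ.* v)) ℚ.+ n)
        ≡⟨ cong₂ (λ z w → ratio (+ 2) ℚ.* (z ℚ.+ w)) re (proj₂ n-integral) ⟩
      ratio (+ 2) ℚ.* (ratio a ℚ.+ ratio n₀)
        ≡⟨ trans (cong (ratio (+ 2) ℚ.*_) (ratio-+ a n₀)) (ratio-* (+ 2) (a ℤ.+ n₀)) ⟩
      ratio (+ 2 ℤ.* (a ℤ.+ n₀)) ∎
    U-integral : ∃ λ m → U ≡ ratio m
    U-integral = integral U (+ 2 ℤ.* (a ℤ.+ n₀)) (+ 0) (trans (solveℚ 1 (λ n → n :* (n :* n) := (n :* n) :* n :+ :0) refl U) (cong (λ z → z ℚ.* U ℚ.+ 0ℚ) U²))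
    U₀ = proj₁ U-integral
    U₀²≡2a+2n₀ : U₀ ℤ.* U₀ ≡ + 2 ℤ.* (a ℤ.+ n₀)
    U₀²≡2a+2n₀ = ratio-injective (trans (sym (ratio-* U₀ U₀)) (trans (cong₂ ℚ._*_ (sym (proj₂ U-integral)) (sym (proj₂ U-integral))) U²))

  -- With n and U the norm and the trace of w, the trace of w³ is U³ - 3nU, and it equals 2a. Both n
  -- and U are again rational roots of monic integral equations.
  cube-root : ∀ z w → w ^ 3 ≡ embed z → ∃₂ λ n U → RootEquations 3 (Z.norm z) (proj₁ z) n U
  cube-root z@(a , b) w@(u , v) eq = n₀ , U₀ , n₀³≡N , U₀³
    where
    open ≡.≡-Reasoning
    n = normK w
    U = u ℚ.+ u
    w³≡z : w *K (w *K w) ≡ embed z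
    w³≡z = trans (cong (λ x → w *K (w *K x)) (sym (*-identityʳ w))) eq
    re : u ℚ.* (u ℚ.* u ℚ.+ ratio d ℚ.* (v ℚ.* v)) ℚ.+ ratio d ℚ.* (v ℚ.* (u ℚ.* v ℚ.+ v ℚ.* u)) ≡ ratio a
    re = cong proj₁ w³≡z
    n³ : n ℚ.* (n ℚ.* n) ≡ ratio (Z.norm z)
    n³ = trans (cong (n ℚ.*_) (sym (K.norm-* w w))) (trans (sym (K.norm-* w (w *K w))) (trans (cong normK w³≡z) (normK-embed z)))
    n-integral : ∃ λ m → n ≡ ratio m
    n-integral = integral n (+ 0) (Z.norm z) (trans n³ (solveℚ 2 (λ n c → c := :0 :* n :+ c) refl n (ratio (Z.norm z))))
    n₀ = proj₁ n-integral
    n₀³≡N : n₀ ℤ.* (n₀ ℤ.* n₀) ≡ Z.norm z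
    n₀³≡N = ratio-injective (begin
      ratio (n₀ ℤ.* (n₀ ℤ.* n₀))                ≡⟨ trans (sym (ratio-* n₀ (n₀ ℤ.* n₀))) (cong (ratio n₀ ℚ.*_) (sym (ratio-* n₀ n₀))) ⟩
      ratio n₀ ℚ.* (ratio n₀ ℚ.* ratio n₀)      ≡⟨ cong (λ m → m ℚ.* (m ℚ.* m)) (proj₂ n-integral) ⟨
      n ℚ.* (n ℚ.* n)                           ≡⟨ n³ ⟩
      ratio (Z.norm z)                          ∎)
    U³ : U ℚ.* (U ℚ.* U) ≡ ratio (+ 3 ℤ.* n₀) ℚ.* U ℚ.+ ratio (+ 2 ℤ.* a)
    U³ = begin
      U ℚ.* (U ℚ.* U)
        ≡⟨ solveℚ 3 (λ u v s → (u :+ u) :* ((u :+ u) :* (u :+ u))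
             := (:1 :+ :1 :+ :1) :* (u :* u :- s :* (v :* v)) :* (u :+ u) :+ (:1 :+ :1) :* (u :* (u :* u :+ s :* (v :* v)) :+ s :* (v :* (u :* v :+ v :* u)))) refl u v (ratio d) ⟩
      ratio (+ 3) ℚ.* n ℚ.* U ℚ.+ ratio (+ 2) ℚ.* (u ℚ.* (u ℚ.* u ℚ.+ ratio d ℚ.* (v ℚ.* v)) ℚ.+ ratio d ℚ.* (v ℚ.* (u ℚ.* v ℚ.+ v ℚ.* u)))
        ≡⟨ cong₂ (λ z w → ratio (+ 3) ℚ.* z ℚ.* U ℚ.+ ratio (+ 2) ℚ.* w) (proj₂ n-integral) re ⟩
      ratio (+ 3) ℚ.* ratio n₀ ℚ.* U ℚ.+ ratio (+ 2) ℚ.* ratio a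
        ≡⟨ cong₂ (λ z w → z ℚ.* U ℚ.+ w) (ratio-* (+ 3) n₀) (ratio-* (+ 2) a) ⟩
      ratio (+ 3 ℤ.* n₀) ℚ.* U ℚ.+ ratio (+ 2 ℤ.* a) ∎
    U-integral : ∃ λ m → U ≡ ratio m
    U-integral = integral U (+ 3 ℤ.* n₀) (+ 2 ℤ.* a) U³
    U₀ = proj₁ U-integral
    U₀³ : U₀ ℤ.* (U₀ ℤ.* U₀) ≡ + 3 ℤ.* (n₀ ℤ.* U₀) ℤ.+ + 2 ℤ.* a
    U₀³ = ratio-injective (begin
      ratio (U₀ ℤ.* (U₀ ℤ.* U₀))                ≡⟨ trans (sym (ratio-* U₀ (U₀ ℤ.* U₀))) (cong (ratio U₀ ℚ.*_) (sym (ratio-* U₀ U₀))) ⟩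
      ratio U₀ ℚ.* (ratio U₀ ℚ.* ratio U₀)      ≡⟨ cong (λ m → m ℚ.* (m ℚ.* m)) (proj₂ U-integral) ⟨
      U ℚ.* (U ℚ.* U)                           ≡⟨ U³ ⟩
      ratio (+ 3 ℤ.* n₀) ℚ.* U ℚ.+ ratio (+ 2 ℤ.* a)
        ≡⟨ cong (λ m → ratio (+ 3 ℤ.* n₀) ℚ.* m ℚ.+ ratio (+ 2 ℤ.* a)) (proj₂ U-integral) ⟩
      ratio (+ 3 ℤ.* n₀) ℚ.* ratio U₀ ℚ.+ ratio (+ 2 ℤ.* a)
        ≡⟨ trans (cong (ℚ._+ ratio (+ 2 ℤ.* a)) (ratio-* (+ 3 ℤ.* n₀) U₀)) (ratio-+ (+ 3 ℤ.* n₀ ℤ.* U₀) (+ 2 ℤ.* a)) ⟩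
      ratio (+ 3 ℤ.* n₀ ℤ.* U₀ ℤ.+ + 2 ℤ.* a)
        ≡⟨ cong (λ z → ratio (z ℤ.+ + 2 ℤ.* a)) (ℤₚ.*-assoc (+ 3) n₀ U₀) ⟩
      ratio (+ 3 ℤ.* (n₀ ℤ.* U₀) ℤ.+ + 2 ℤ.* a) ∎)

  nonpowerᵇ : ℕ → List ℕ → ℤ × ℤ → Bool
  nonpowerᵇ ℓ [] z = false
  nonpowerᵇ ℓ (zero ∷ ms) z = nonpowerᵇ ℓ ms z
  nonpowerᵇ ℓ (suc m ∷ ms) z = unsolvableMod ℓ (suc m) (Z.norm z) (proj₁ z) ∨ nonpowerᵇ ℓ ms z

  nonpower : ∀ ℓ ms z → nonpowerᵇ ℓ ms z ≡ true → ∀ w → w ^ ℓ ≢ embed z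
  nonpower ℓ (zero ∷ ms) z check w eq = nonpower ℓ ms z check w eq
  nonpower ℓ (suc m ∷ ms) z check w eq with unsolvableMod ℓ (suc m) (Z.norm z) (proj₁ z) in e
  ... | false = nonpower ℓ ms z check w eq
  nonpower 0 (suc m ∷ ms) z check w eq | true with e
  ... | ()
  nonpower 1 (suc m ∷ ms) z check w eq | true with e
  ... | ()
  nonpower 2 (suc m ∷ ms) z check w eq | true = let n , U , h = square-root z w eq in unsolvableMod-sound 2 (suc m) (Z.norm z) (proj₁ z) e n U h
  nonpower 3 (suc m ∷ ms) z check w eq | true = let n , U , h = cube-root z w eq in unsolvableMod-sound 3 (suc m) (Z.norm z) (proj₁ z) e n U h
  nonpower (suc (suc (suc (suc _)))) (suc m ∷ ms) z check w eq | true with e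
  ... | ()

-- The abelian group of points and its Kummer relations

module CurvePoints (d : ℤ) (nonsquare : ∀ q → q ℚ.* q ≢ ratio d) (E : EllipticCurve d) where
  open Field d
  open QuadraticField d nonsquare public
  open EllipticCurve E
  open Curve E hiding (lincomb)
  open DiscreteField field-K hiding (Carrier)
  open CoordinateRing field-K A B using (f; On; Sum; Slope; chord; tangent; identityˡ; identityʳ; vertical; line; thirdX; 2#; 3#) public
  open AdditionClasses field-K A B using (On-sum)
  open ClassInjectivity field-K A B using (Sum-unique; Sum-comm; Sum-assoc)

  to : Point d → Pt (QF d)
  to O = O
  to (pt x y) = pt x y

  to-injective : ∀ {P Q} → to P ≡ to Q → P ≡ Q
  to-injective {O} {O} refl = refl
  to-injective {pt _ _} {pt _ _} refl = refl

  On-to : ∀ {P} → OnCurve P → On (to P)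
  On-to {O} _ = tt
  On-to {pt _ _} on = on

  OnCurve-to : ∀ {P} → On (to P) → OnCurve P
  OnCurve-to {O} _ = tt
  OnCurve-to {pt _ _} on = on

  -- The discriminant expression 4A³ + 27B² is a combination of f(x) and f′(x) with polynomial
  -- coefficients, so it would vanish at a double root.
  smooth : ∀ x → f x ≡ 0K → 3# *K (x *K x) +K A ≢ 0K
  smooth x fx≡0 dfx≡0 = nonsingular (begin
    fromℚ (+ 4 ℚ./ 1) *K (A *K (A *K A)) +K fromℚ (+ 27 ℚ./ 1) *K (B *K B)
      ≡⟨ solve 3 (λ A B x →
           let two = :1 :+ :1 ; three = :1 :+ :1 :+ :1 ; six = two :* three ; nine = three :* three ; nine′ = three :+ three :+ three in
           (two :+ two) :* (A :* (A :* A)) :+ (nine′ :+ nine′ :+ nine′) :* (B :* B)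
           := (x :* (x :* x) :+ (A :* x :+ B)) :* (three :* nine :* B :- two :* nine :* (A :* x))
              :+ (three :* (x :* x) :+ A) :* (two :* two :* (A :* A) :+ six :* (A :* (x :* x)) :- nine :* (B :* x))) refl A B x ⟩
    f x * (3# * (3# * 3#) * B - 2# * (3# * 3#) * (A * x)) + (3# * (x * x) + A) * W
      ≡⟨ cong₂ (λ z w → z * (3# * (3# * 3#) * B - 2# * (3# * 3#) * (A * x)) + w * W) fx≡0 dfx≡0 ⟩
    0K * (3# * (3# * 3#) * B - 2# * (3# * 3#) * (A * x)) + 0K * W
      ≡⟨ solve 2 (λ a b → :0 :* a :+ :0 :* b := :0) refl (3# * (3# * 3#) * B - 2# * (3# * 3#) * (A * x)) W ⟩
    0K ∎)
    where
    open ≡.≡-Reasoning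
    W = 2# * 2# * (A * A) + 2# * 3# * (A * (x * x)) - 3# * 3# * (B * x)

  eqK-true : ∀ {x y} → eqK x y ≡ true → x ≡ y
  eqK-true {a , b} {c , e} eq with a ℚₚ.≟ c | b ℚₚ.≟ e
  ... | yes refl | yes refl = refl
  eqK-true () | yes _ | no _
  eqK-true () | no _ | _

  eqK-false : ∀ {x y} → eqK x y ≡ false → x ≢ y
  eqK-false {a , b} eq refl with a ℚₚ.≟ a | b ℚₚ.≟ b
  eqK-false () refl | yes _ | yes _
  ... | yes _ | no b≢b = b≢b refl
  ... | no a≢a | _ = a≢a refl

  divide : ∀ x {y} → y ≢ 0K → (x /K y) * y ≡ x
  divide x {y} y≢0 = trans (solve 3 (λ x i y → x :* i :* y := (y :* i) :* x) refl x (invK y) y)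
    (trans (cong (_* x) (*-inverseʳ y≢0)) (*-identityˡ x))

  -- The doubling branch is entered whenever x₁ = x₂ and y₁ + y₂ is nonzero. The curve equation
  -- gives (y₁ + y₂)(y₁ - y₂) = 0, so the points do coincide there, and the divisor 2y₁ is nonzero.
  addP-Sum : ∀ P Q → OnCurve P → OnCurve Q → Sum (to P) (to Q) (to (addP P Q))
  addP-Sum O Q _ _ = identityˡ
  addP-Sum (pt _ _) O _ _ = identityʳ
  addP-Sum (pt x₁ y₁) (pt x₂ y₂) on₁ on₂ with eqK x₁ x₂ in e
  ... | false = line ((y₂ -K y₁) /K (x₂ -K x₁)) (chord (eqK-false e) (divide (y₂ -K y₁) λ z → eqK-false e (sym (x-y≡0⇒x≡y z))))
  ... | true with eqK (y₁ +K y₂) 0K in e′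
  ...   | true = subst (λ x → Sum (pt x₁ y₁) (pt x y₂) O) (eqK-true e) (vertical (eqK-true e′))
  ...   | false = line ((fromℚ (+ 3 ℚ./ 1) *K (x₁ *K x₁) +K A) /K (fromℚ (+ 2 ℚ./ 1) *K y₁)) (tangent (eqK-true e) y₁≡y₂ y₁≢0 (divide (fromℚ (+ 3 ℚ./ 1) *K (x₁ *K x₁) +K A) (*-≢0 {fromℚ (+ 2 ℚ./ 1)} 2≢0 y₁≢0)))
    where
    y₁≡y₂ : y₁ ≡ y₂
    y₁≡y₂ = x-y≡0⇒x≡y (*-cancelˡ-0 (eqK-false e′) (begin
      (y₁ + y₂) * (y₁ - y₂)      ≡⟨ solve 2 (λ a b → (a :+ b) :* (a :- b) := a :* a :- b :* b) refl y₁ y₂ ⟩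
      y₁ * y₁ - y₂ * y₂          ≡⟨ x≡y⇒x-y≡0 (trans on₁ (trans (cong f (eqK-true e)) (sym on₂))) ⟩
      0K                         ∎))
      where open ≡.≡-Reasoning
    y₁≢0 : y₁ ≢ 0K
    y₁≢0 z = eqK-false e′ (trans (cong₂ _+_ z (trans (sym y₁≡y₂) z)) (+-identityˡ 0K))

  -- Values of `addP` are obtained from this: a certificate names the slope and the sum, and the
  -- branches and inverses in `addP` stay unevaluated.
  addP-unique : ∀ {P Q R} → OnCurve P → OnCurve Q → Sum (to P) (to Q) (to R) → addP P Q ≡ R
  addP-unique {P} {Q} onP onQ s = to-injective (Sum-unique smooth (On-to onP) (On-to onQ) (addP-Sum P Q onP onQ) s)

  OnCurve-addP : ∀ {P Q} → OnCurve P → OnCurve Q → OnCurve (addP P Q)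
  OnCurve-addP {P} {Q} onP onQ = OnCurve-to (On-sum (On-to onP) (On-to onQ) (addP-Sum P Q onP onQ))

  OnCurve-negP : ∀ {P} → OnCurve P → OnCurve (negP P)
  OnCurve-negP {O} _ = tt
  OnCurve-negP {pt x y} on = trans (solve 1 (λ y → (:- y) :* (:- y) := y :* y) refl y) on

  addP-inverse : ∀ P → OnCurve P → addP P (negP P) ≡ O
  addP-inverse O _ = refl
  addP-inverse (pt x y) on = addP-unique {pt x y} {pt x (-K y)} on (OnCurve-negP {pt x y} on) (vertical (-‿inverseʳ y))

  addP-comm : ∀ {P Q} → OnCurve P → OnCurve Q → addP P Q ≡ addP Q P
  addP-comm {P} {Q} onP onQ = to-injective (Sum-comm smooth (On-to onP) (On-to onQ) (addP-Sum P Q onP onQ) (addP-Sum Q P onQ onP))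

  addP-assoc : ∀ {P Q R} → OnCurve P → OnCurve Q → OnCurve R → addP (addP P Q) R ≡ addP P (addP Q R)
  addP-assoc {P} {Q} {R} onP onQ onR = to-injective (Sum-assoc smooth (On-to onP) (On-to onQ) (On-to onR)
    (addP-Sum P Q onP onQ) (addP-Sum (addP P Q) R (OnCurve-addP onP onQ) onR)
    (addP-Sum Q R onQ onR) (addP-Sum P (addP Q R) onP (OnCurve-addP onQ onR)))

  Pts : Set
  Pts = Σ (Point d) OnCurve

  addP-identityʳ : ∀ P → addP P O ≡ P
  addP-identityʳ O = refl
  addP-identityʳ (pt _ _) = refl

  -- The elements carry proofs because associativity is a statement about points of the curve;
  -- equality compares the points alone, so these proofs are never compared.
  group : AbelianGroup 0ℓ 0ℓ
  group = record
    { Carrier = Pts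
    ; _≈_ = λ P Q → proj₁ P ≡ proj₁ Q
    ; _∙_ = λ P Q → addP (proj₁ P) (proj₁ Q) , OnCurve-addP (proj₂ P) (proj₂ Q)
    ; ε = O , tt
    ; _⁻¹ = λ P → negP (proj₁ P) , OnCurve-negP (proj₂ P)
    ; isAbelianGroup = record
      { isGroup = record
        { isMonoid = record
          { isSemigroup = record
            { isMagma = record
              { isEquivalence = record { refl = refl ; sym = sym ; trans = trans }
              ; ∙-cong = cong₂ addP }
            ; assoc = λ P Q R → addP-assoc (proj₂ P) (proj₂ Q) (proj₂ R) }
          ; identity = (λ _ → refl) , (λ P → addP-identityʳ (proj₁ P)) }
        ; inverse = (λ P → trans (addP-comm (OnCurve-negP (proj₂ P)) (proj₂ P)) (addP-inverse (proj₁ P) (proj₂ P)))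
                  , (λ P → addP-inverse (proj₁ P) (proj₂ P))
        ; ⁻¹-cong = cong negP }
      ; comm = λ P Q → addP-comm (proj₂ P) (proj₂ Q) } }

  open IntegerMultiples group public
  open AbelianGroup group using () renaming (monoid to pts-monoid; _∙_ to _⊹_; ε to 0ₚ)
  open import Algebra.Properties.Monoid.Mult pts-monoid using () renaming (_×_ to _·_) public

  ·-mulℕ : ∀ n P → proj₁ (n · P) ≡ mulℕ n (proj₁ P)
  ·-mulℕ zero P = refl
  ·-mulℕ (suc n) P = cong (addP (proj₁ P)) (·-mulℕ n P)

  ·ℤ-mulℤ : ∀ a P → proj₁ (a ·ℤ P) ≡ mulℤ a (proj₁ P)
  ·ℤ-mulℤ (+ n) P = ·-mulℕ n P
  ·ℤ-mulℤ -[1+ n ] P = cong negP (·-mulℕ (suc n) P)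

  points : ∀ {k} → Vec Pts k → Vec (Point d) k
  points = Vec.map proj₁

  lincomb-points : ∀ {k} (as : Vec ℤ k) Ps → proj₁ (lincomb as Ps) ≡ Curve.lincomb E as (points Ps)
  lincomb-points [] [] = refl
  lincomb-points (a ∷ as) (P ∷ Ps) = cong₂ addP (·ℤ-mulℤ a P) (lincomb-points as Ps)

  points-on : ∀ {k} (Ps : Vec Pts k) → AllOnCurve (points Ps)
  points-on [] = []
  points-on (P ∷ Ps) = proj₂ P ∷ points-on Ps

  module _ {ℓ} (κ : KummerMaps.Kummer field-K A B ℓ) where
    open PowerClasses field-K
    open KummerMaps.Kummer κ

    χₚ : Pts → QF d
    χₚ P = χ (to (proj₁ P))

    χₚ-+ : ∀ P Q → χₚ (P ⊹ Q) ≈[ ℓ ] χₚ P * χₚ Q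
    χₚ-+ P Q = ≈-sym (χ-sum (On-to (proj₂ P)) (On-to (proj₂ Q)) (addP-Sum (proj₁ P) (proj₁ Q) (proj₂ P) (proj₂ Q)))

    χₚ-· : ∀ n P → χₚ (n · P) ≈[ ℓ ] χₚ P ^ n
    χₚ-· zero P = ≈-reflexive χ-O
    χₚ-· (suc n) P = ≈-trans (χₚ-+ P (n · P)) (≈-* (≈-reflexive {a = χₚ P} refl) (χₚ-· n P))

    powerProduct : ∀ {k} → Vec ℕ k → Vec (QF d) k → QF d
    powerProduct [] [] = 1K
    powerProduct (r ∷ rs) (x ∷ xs) = x ^ r * powerProduct rs xs

    χₚ-lincombℕ : ∀ {k} (rs : Vec ℕ k) Ps → χₚ (lincombℕ rs Ps) ≈[ ℓ ] powerProduct rs (Vec.map χₚ Ps)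
    χₚ-lincombℕ [] [] = ≈-reflexive χ-O
    χₚ-lincombℕ (r ∷ rs) (P ∷ Ps) = ≈-trans (χₚ-+ (r · P) (lincombℕ rs Ps)) (≈-* (χₚ-· r P) (χₚ-lincombℕ rs Ps))

    -- A combination splits as R + ℓS with the residues as coefficients of R. The map is trivial on
    -- ℓS and on the whole relation, hence on R.
    relation-power : .{{_ : ℕ.NonZero ℓ}} → ∀ {k} (cs : Vec ℤ k) Ps → proj₁ (lincomb cs Ps) ≡ O →
                     ∃ λ w → w ^ ℓ ≡ powerProduct (residues ℓ cs) (Vec.map χₚ Ps)
    relation-power cs Ps eq = ≈1⇒power (≈-trans (≈-sym (χₚ-lincombℕ (residues ℓ cs) Ps)) (≈-trans trivial (≈-reflexive χ-O)))
      where
      R = lincombℕ (residues ℓ cs) Ps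
      S = lincomb (quotients ℓ cs) Ps
      ℓS≈1 : χₚ (ℓ · S) ≈[ ℓ ] 1K
      ℓS≈1 = ≈-trans (χₚ-· ℓ S) (power≈1 (χ-≢0 (to (proj₁ S)) (On-to (proj₂ S))))
      trivial : χₚ R ≈[ ℓ ] χ O
      trivial = ≈-trans (≈-reflexive (sym (*-identityʳ _))) (≈-trans (≈-* (≈-reflexive {a = χₚ R} refl) (≈-sym ℓS≈1))
        (≈-trans (≈-sym (χₚ-+ R (ℓ · S))) (≈-reflexive (cong (λ z → χ (to z)) (trans (sym (lincomb-split ℓ cs Ps)) eq)))))

-- Boolean tests for nonsquares, squarefree numbers and integer pairs

∧-true : ∀ {a b} → a ∧ b ≡ true → a ≡ true × b ≡ true
∧-true {true} {true} _ = refl , refl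

∨-true : ∀ {a b} → a ∨ b ≡ true → a ≡ true ⊎ b ≡ true
∨-true {true} _ = inj₁ refl
∨-true {false} eq = inj₂ eq

does-true : ∀ {X : Set} (dec : Dec X) → does dec ≡ true → X
does-true (yes x) _ = x

does-false : ∀ {X : Set} (dec : Dec X) → does dec ≡ false → ¬ X
does-false (no ¬x) _ = ¬x

not-true : ∀ {b} → not b ≡ true → b ≡ false
not-true {false} _ = refl

nonsquareModᵇ : ℕ → ℤ → Bool
nonsquareModᵇ zero d = false
nonsquareModᵇ m@(suc _) d = allBelow m λ n → not (congruentᵇ m (n ℕ.* n) (d ℤD.%ℕ m))

nonsquareMod : ∀ m d → nonsquareModᵇ m d ≡ true → ∀ n → n ℤ.* n ≢ d
nonsquareMod m@(suc _) d check n eq with allBelow-sound m _ check (n ℤD.%ℕ m) (ℤD.n%ℕd<d n m)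
... | h rewrite cong (ℕ._≡ᵇ 0) (Congruence.distance m ((n ℤD.%ℕ m) ℕ.* (n ℤD.%ℕ m)) (d ℤD.%ℕ m)
      (subst (λ z → Congruence._≡ₘ_ m z (+ (d ℤD.%ℕ m))) (sym (ℤₚ.pos-* (n ℤD.%ℕ m) (n ℤD.%ℕ m)))
        (Congruence.≡ₘ-trans-sym m (Congruence.≡ₘ-* m (Congruence.residue m n) (Congruence.residue m n)) (Congruence.residue m d) eq))) with h
...   | ()

-- From q² = d follows q³ = dq, so q is an integer and its residue modulo m decides.
nonsquareℚ : ∀ m d → nonsquareModᵇ m d ≡ true → ∀ q → q ℚ.* q ≢ ratio d
nonsquareℚ m d check q eq = nonsquareMod m d check n (ratio-injective (trans (sym (ratio-* n n)) (trans (cong₂ ℚ._*_ (sym q≡n) (sym q≡n)) eq)))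
  where
  open ℚ-Solver using (_:*_; _:+_; _:=_; :0) renaming (solve to solveℚ)
  q-integral : ∃ λ n → q ≡ ratio n
  q-integral = integral q d (+ 0) (trans (solveℚ 1 (λ n → n :* (n :* n) := (n :* n) :* n :+ :0) refl q) (cong (λ z → z ℚ.* q ℚ.+ 0ℚ) eq))
  n = proj₁ q-integral
  q≡n = proj₂ q-integral

-- p²k = D forces p < b or k < c as soon as D < b²c.
squarefreeᵇ : List ℕ → ℕ → ℕ → ℕ → Bool
squarefreeᵇ ms D b c = (D ℕ.<ᵇ b ℕ.* b ℕ.* c)
  ∧ allBelow b noSquareDivisor ∧ allBelow c noSquareQuotient
  where
  noSquareDivisor noSquareQuotient : ℕ → Bool
  noSquareDivisor (suc (suc p)) = not ((D ℕ.% (suc (suc p) ℕ.* suc (suc p))) ℕ.≡ᵇ 0)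
  noSquareDivisor _ = true
  noSquareQuotient zero = not (D ℕ.≡ᵇ 0)
  noSquareQuotient k@(suc _) = not ((D ℕ.% k) ℕ.≡ᵇ 0) ∨ any (λ m → nonsquareModᵇ m (+ (D ℕ./ k))) ms

squarefree : ∀ ms D b c → squarefreeᵇ ms D b c ≡ true → ∀ p → Prime p → ¬ (p ℕ.* p) ℕ∣.∣ D
squarefree ms D b c check p p-prime p²∣D = go p (ℕ.nonTrivial⇒n>1 p {{prime⇒nonTrivial p-prime}}) p²∣D
  where
  parts : (D ℕ.<ᵇ b ℕ.* b ℕ.* c) ≡ true × _
  parts = ∧-true {D ℕ.<ᵇ b ℕ.* b ℕ.* c} check
  halves = ∧-true (proj₂ parts)
  anyNonsquare : ∀ ms k → any (λ m → nonsquareModᵇ m (+ k)) ms ≡ true → ∀ p → p ℕ.* p ≢ k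
  anyNonsquare (m ∷ ms) k eq p p²≡k with ∨-true {nonsquareModᵇ m (+ k)} eq
  ... | inj₁ h = nonsquareMod m (+ k) h (+ p) (trans (sym (ℤₚ.pos-* p p)) (cong +_ p²≡k))
  ... | inj₂ h = anyNonsquare ms k h p p²≡k
  go : ∀ p → 1 ℕ.< p → ¬ (p ℕ.* p) ℕ∣.∣ D
  go (suc (suc p)) (s≤s (s≤s z≤n)) p²∣D@(ℕ∣.divides k D≡kp²) with suc (suc p) ℕₚ.<? b
  ... | yes p<b with allBelow-sound b _ (proj₁ halves) (suc (suc p)) p<b
  ...   | h rewrite ℕ∣.n∣m⇒m%n≡0 D (suc (suc p) ℕ.* suc (suc p)) p²∣D with h
  ...     | ()
  go (suc (suc p)) _ p²∣D@(ℕ∣.divides k D≡kp²) | no p≮b = absurd k k<c D≡kp²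
    where
    P = suc (suc p)
    k<c : k ℕ.< c
    k<c = ℕₚ.≰⇒> λ c≤k → ℕₚ.<⇒≱ (ℕₚ.<ᵇ⇒< D (b ℕ.* b ℕ.* c) (subst Bool.T (sym (proj₁ parts)) tt)) (begin
      b ℕ.* b ℕ.* c    ≤⟨ ℕₚ.*-mono-≤ (ℕₚ.*-mono-≤ (ℕₚ.≮⇒≥ p≮b) (ℕₚ.≮⇒≥ p≮b)) c≤k ⟩
      P ℕ.* P ℕ.* k    ≡⟨ ℕₚ.*-comm (P ℕ.* P) k ⟩
      k ℕ.* (P ℕ.* P)  ≡⟨ D≡kp² ⟨
      D                ∎)
      where open ℕₚ.≤-Reasoning
    absurd : ∀ k → k ℕ.< c → D ≡ k ℕ.* (P ℕ.* P) → ⊥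
    absurd zero 0<c D≡0 with trans (sym (allBelow-sound c _ (proj₂ halves) zero 0<c)) (cong (λ z → not (z ℕ.≡ᵇ 0)) D≡0)
    ... | ()
    absurd k@(suc _) k<c D≡ with ∨-true {not ((D ℕ.% k) ℕ.≡ᵇ 0)} (allBelow-sound c _ (proj₂ halves) k k<c)
    ... | inj₂ h = anyNonsquare ms (D ℕ./ k) h P (sym (trans (cong (ℕ._/ k) (trans D≡ (ℕₚ.*-comm k (P ℕ.* P)))) (ℕD.m*n/n≡m (P ℕ.* P) k)))
    ... | inj₁ h with trans (sym h) (cong (λ z → not (z ℕ.≡ᵇ 0)) (ℕ∣.n∣m⇒m%n≡0 D k (ℕ∣.divides (P ℕ.* P) (trans D≡ (ℕₚ.*-comm k (P ℕ.* P))))))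
    ...   | ()

squarefreeNonUnit : ∀ ms d b c → d ≢ + 0 → d ≢ + 1 → squarefreeᵇ ms ∣ d ∣ b c ≡ true → SquarefreeNonUnit d
squarefreeNonUnit ms d b c d≢0 d≢1 check = record { d≢0 = d≢0 ; d≢1 = d≢1 ; sqfree = squarefree ms ∣ d ∣ b c check }

allResidues : ∀ ℓ k → (Vec ℕ k → Bool) → Bool
allResidues ℓ zero p = p []
allResidues ℓ (suc k) p = allBelow ℓ λ r → allResidues ℓ k λ rs → p (r ∷ rs)

allResidues-sound : ∀ ℓ .{{_ : ℕ.NonZero ℓ}} {k} p → allResidues ℓ k p ≡ true → ∀ (cs : Vec ℤ k) → p (Vec.map (ℤD._%ℕ ℓ) cs) ≡ true
allResidues-sound ℓ p eq [] = eq
allResidues-sound ℓ p eq (c ∷ cs) = allResidues-sound ℓ (λ rs → p (c ℤD.%ℕ ℓ ∷ rs))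
  (allBelow-sound ℓ _ eq (c ℤD.%ℕ ℓ) (ℤD.n%ℕd<d c ℓ)) cs

isZeroᵇ : ∀ {k} → Vec ℕ k → Bool
isZeroᵇ [] = true
isZeroᵇ (r ∷ rs) = (r ℕ.≡ᵇ 0) ∧ isZeroᵇ rs

ℤ² : Set
ℤ² = ℤ × ℤ

-- Stdlib's decision procedures for products match on equality proofs, which are unary in the size of
-- the numbers; these only compare with the built-in equality of ℕ.
_≡ℤᵇ_ : ℤ → ℤ → Bool
(+ m) ≡ℤᵇ (+ n) = m ℕ.≡ᵇ n
-[1+ m ] ≡ℤᵇ -[1+ n ] = m ℕ.≡ᵇ n
_ ≡ℤᵇ _ = false

≡ℤᵇ-sound : ∀ i j → Bool.T (i ≡ℤᵇ j) → i ≡ j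
≡ℤᵇ-sound (+ m) (+ n) h = cong +_ (ℕₚ.≡ᵇ⇒≡ m n h)
≡ℤᵇ-sound -[1+ m ] -[1+ n ] h = cong -[1+_] (ℕₚ.≡ᵇ⇒≡ m n h)

≡ℤᵇ-refl : ∀ i → Bool.T (i ≡ℤᵇ i)
≡ℤᵇ-refl (+ m) = ℕₚ.≡⇒≡ᵇ m m refl
≡ℤᵇ-refl -[1+ m ] = ℕₚ.≡⇒≡ᵇ m m refl

×-dec′ : {X Y : Set} → ((x x′ : X) → Dec (x ≡ x′)) → ((y y′ : Y) → Dec (y ≡ y′)) → (p q : X × Y) → Dec (p ≡ q)
×-dec′ dec dec′ (x , y) (x′ , y′) = map′ (λ (e , e′) → cong₂ _,_ e e′) (λ e → cong proj₁ e , cong proj₂ e) (dec x x′ ×-dec dec′ y y′)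

infix 4 _≟²_
_≟²_ : (x y : ℤ²) → Dec (x ≡ y)
_≟²_ = ×-dec′ decℤ decℤ
  where
  decℤ : (i j : ℤ) → Dec (i ≡ j)
  decℤ i j = map′ (≡ℤᵇ-sound i j) (λ { refl → ≡ℤᵇ-refl i }) (T? (i ≡ℤᵇ j))

-- Certificates over ℤ[√d] for sums, orders and independence

module Certificates (d : ℤ) (nonsquare : ∀ q → q ℚ.* q ≢ ratio d) (E : EllipticCurve d)
  (A₀ B₀ : ℤ²)
  (A≡ : EllipticCurve.A E ≡ (ratio (proj₁ A₀) , ratio (proj₂ A₀)))
  (B≡ : EllipticCurve.B E ≡ (ratio (proj₁ B₀) , ratio (proj₂ B₀))) where
  open Field d
  open CurvePoints d nonsquare E
  open EllipticCurve E
  open Curve E hiding (lincomb)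
  open DiscreteField field-K hiding (Carrier; _+_; _*_; -_; _-_)
  open Z using (_⊕_; _⊛_; ⊝_)

  infixl 6 _⊖_
  _⊖_ : ℤ² → ℤ² → ℤ²
  x ⊖ y = x ⊕ (⊝ y)

  0² : ℤ²
  0² = + 0 , + 0

  f₀ : ℤ² → ℤ²
  f₀ x = x ⊛ (x ⊛ x) ⊕ (A₀ ⊛ x ⊕ B₀)

  df₀ : ℤ² → ℤ²
  df₀ x = (+ 3 , + 0) ⊛ (x ⊛ x) ⊕ A₀

  embed-f : ∀ x → f (embed x) ≡ embed (f₀ x)
  embed-f x = trans (cong₂ _+K_ (trans (cong (embed x *K_) (embed-* x x)) (embed-* x (x ⊛ x)))
      (trans (cong₂ (λ a b → a *K embed x +K b) A≡ B≡) (trans (cong (_+K embed B₀) (embed-* A₀ x)) (embed-+ (A₀ ⊛ x) B₀))))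
    (embed-+ (x ⊛ (x ⊛ x)) (A₀ ⊛ x ⊕ B₀))

  embed-df : ∀ x → 3# *K (embed x *K embed x) +K A ≡ embed (df₀ x)
  embed-df x = trans (cong₂ _+K_ (trans (cong (3# *K_) (embed-* x x)) (embed-* (+ 3 , + 0) (x ⊛ x))) A≡) (embed-+ ((+ 3 , + 0) ⊛ (x ⊛ x)) A₀)

  embed-≢ : ∀ {x y} → x ≢ y → embed x ≢ embed y
  embed-≢ ne eq = ne (embed-injective eq)

  embedPt : ℤ² × ℤ² → Point d
  embedPt (x , y) = pt (embed x) (embed y)

  On₀ : ℤ² × ℤ² → Set
  On₀ (x , y) = y ⊛ y ≡ f₀ x

  on : ∀ P → On₀ P → OnCurve (embedPt P)
  on (x , y) eq = trans (embed-* y y) (trans (cong embed eq) (sym (embed-f x)))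

  third : ℤ² → ℤ² × ℤ² → ℤ² × ℤ² → ℤ² × ℤ²
  third l (x₁ , y₁) (x₂ , y₂) = x₃ , l ⊛ (x₁ ⊖ x₃) ⊖ y₁
    where x₃ = (l ⊛ l ⊖ x₁) ⊖ x₂

  embed-thirdX : ∀ l x₁ x₂ → thirdX (embed l) (embed x₁) (embed x₂) ≡ embed ((l ⊛ l ⊖ x₁) ⊖ x₂)
  embed-thirdX l x₁ x₂ = trans (cong (_-K embed x₂) (trans (cong (_-K embed x₁) (embed-* l l)) (embed-- (l ⊛ l) x₁))) (embed-- (l ⊛ l ⊖ x₁) x₂)

  embed-third : ∀ l P Q → pt (thirdX (embed l) (embed (proj₁ P)) (embed (proj₁ Q)))
      (embed l *K (embed (proj₁ P) -K thirdX (embed l) (embed (proj₁ P)) (embed (proj₁ Q))) -K embed (proj₂ P)) ≡ to (embedPt (third l P Q))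
  embed-third l (x₁ , y₁) (x₂ , y₂) = cong₂ pt (embed-thirdX l x₁ x₂)
    (trans (cong (λ z → embed l *K (embed x₁ -K z) -K embed y₁) (embed-thirdX l x₁ x₂))
    (trans (cong (λ z → embed l *K z -K embed y₁) (embed-- x₁ x₃))
    (trans (cong (_-K embed y₁) (embed-* l (x₁ ⊖ x₃))) (embed-- (l ⊛ (x₁ ⊖ x₃)) y₁))))
    where x₃ = (l ⊛ l ⊖ x₁) ⊖ x₂

  chord-sum : ∀ l P Q → On₀ P → On₀ Q → proj₁ P ≢ proj₁ Q → l ⊛ (proj₁ Q ⊖ proj₁ P) ≡ proj₂ Q ⊖ proj₂ P →
              addP (embedPt P) (embedPt Q) ≡ embedPt (third l P Q)
  chord-sum l P Q onP onQ ne eq = addP-unique {embedPt P} {embedPt Q} {embedPt (third l P Q)} (on P onP) (on Q onQ)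
    (subst (Sum (to (embedPt P)) (to (embedPt Q))) (embed-third l P Q) (line (embed l) (chord (embed-≢ ne)
      (trans (cong (embed l *K_) (embed-- (proj₁ Q) (proj₁ P))) (trans (embed-* l (proj₁ Q ⊖ proj₁ P)) (trans (cong embed eq) (sym (embed-- (proj₂ Q) (proj₂ P)))))))))

  tangent-sum : ∀ l P → On₀ P → proj₂ P ≢ 0² → l ⊛ ((+ 2 , + 0) ⊛ proj₂ P) ≡ df₀ (proj₁ P) →
                addP (embedPt P) (embedPt P) ≡ embedPt (third l P P)
  tangent-sum l P onP ne eq = addP-unique {embedPt P} {embedPt P} {embedPt (third l P P)} (on P onP) (on P onP)
    (subst (Sum (to (embedPt P)) (to (embedPt P))) (embed-third l P P) (line (embed l) (tangent refl refl (embed-≢ ne)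
      (trans (cong (embed l *K_) (embed-* (+ 2 , + 0) (proj₂ P))) (trans (embed-* l ((+ 2 , + 0) ⊛ proj₂ P)) (trans (cong embed eq) (sym (embed-df (proj₁ P)))))))))

  vertical-sum : ∀ P Q → On₀ P → On₀ Q → proj₁ P ≡ proj₁ Q → proj₂ P ⊕ proj₂ Q ≡ 0² → addP (embedPt P) (embedPt Q) ≡ O
  vertical-sum P Q onP onQ refl eq = addP-unique {embedPt P} {embedPt Q} {O} (on P onP) (on Q onQ)
    (vertical (trans (embed-+ (proj₂ P) (proj₂ Q)) (cong embed eq)))

  onᵇ : ℤ² × ℤ² → Bool
  onᵇ (x , y) = does (y ⊛ y ≟² f₀ x)

  _≟ₚ_ : (P Q : ℤ² × ℤ²) → Dec (P ≡ Q)
  _≟ₚ_ = ×-dec′ _≟²_ _≟²_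

  -- The slope of the chord from T to kT together with (k+1)T.
  Step : Set
  Step = ℤ² × (ℤ² × ℤ²)

  stepᵇ : ℤ² × ℤ² → ℤ² × ℤ² → Step → Bool
  stepᵇ T M (l , M′) = onᵇ M ∧ not (does (proj₁ T ≟² proj₁ M)) ∧ does (l ⊛ (proj₁ M ⊖ proj₁ T) ≟² (proj₂ M ⊖ proj₂ T))
    ∧ does (third l T M ≟ₚ M′)

  step-sound : ∀ T M s → On₀ T → stepᵇ T M s ≡ true → addP (embedPt T) (embedPt M) ≡ embedPt (proj₂ s)
  step-sound T M (l , M′) onT check =
    let c₁ , rest = ∧-true {onᵇ M} check
        c₂ , rest′ = ∧-true {not (does (proj₁ T ≟² proj₁ M))} rest
        c₃ , c₄ = ∧-true {does (l ⊛ (proj₁ M ⊖ proj₁ T) ≟² (proj₂ M ⊖ proj₂ T))} rest′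
    in trans (chord-sum l T M onT (does-true (_ ≟² _) c₁) (does-false (proj₁ T ≟² proj₁ M) (not-true c₂)) (does-true (_ ≟² _) c₃))
         (cong embedPt (does-true (third l T M ≟ₚ M′) c₄))

  pathᵇ : ℤ² × ℤ² → ℤ² × ℤ² → List Step → Bool
  pathᵇ T M [] = true
  pathᵇ T M (s ∷ ss) = stepᵇ T M s ∧ pathᵇ T (proj₂ s) ss

  path : ℤ² × ℤ² → List Step → ℤ² × ℤ²
  path M [] = M
  path M (s ∷ ss) = path (proj₂ s) ss

  path-sound : ∀ T M ss k → On₀ T → mulℕ k (embedPt T) ≡ embedPt M → pathᵇ T M ss ≡ true →
               mulℕ (length ss ℕ.+ k) (embedPt T) ≡ embedPt (path M ss)
  path-sound T M [] k onT eq _ = eq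
  path-sound T M (s ∷ ss) k onT eq check =
    let c₁ , c₂ = ∧-true {stepᵇ T M s} check
    in trans (cong (λ j → mulℕ j (embedPt T)) (sym (ℕₚ.+-suc (length ss) k)))
         (path-sound T (proj₂ s) ss (suc k) onT (trans (cong (addP (embedPt T)) eq) (step-sound T M s onT c₁)) c₂)

  -- Every multiple listed on the path is an affine point. This makes the order of T exact.
  path-nonzero : ∀ T M ss k → On₀ T → mulℕ k (embedPt T) ≡ embedPt M → pathᵇ T M ss ≡ true →
                 ∀ j → k ℕ.≤ j → j ℕ.≤ length ss ℕ.+ k → mulℕ j (embedPt T) ≢ O
  path-nonzero T M [] k onT eq _ j k≤j j≤k jT≡O with ℕₚ.≤-antisym k≤j j≤k
  ... | refl with trans (sym eq) jT≡O
  ...   | ()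
  path-nonzero T M (s ∷ ss) k onT eq check j k≤j j≤ jT≡O with k ℕₚ.≟ j
  ... | yes refl with trans (sym eq) jT≡O
  ...   | ()
  path-nonzero T M (s ∷ ss) k onT eq check j k≤j j≤ jT≡O | no k≢j =
    let c₁ , c₂ = ∧-true {stepᵇ T M s} check
    in path-nonzero T (proj₂ s) ss (suc k) onT (trans (cong (addP (embedPt T)) eq) (step-sound T M s onT c₁)) c₂ j
         (ℕₚ.≤∧≢⇒< k≤j k≢j) (subst (j ℕ.≤_) (sym (ℕₚ.+-suc (length ss) k)) j≤) jT≡O

  -- Only 2T comes from a tangent. All further multiples come from chords, for which `stepᵇ` checks
  -- that T and kT differ in x.
  startᵇ : ℤ² × ℤ² → Step → Bool
  startᵇ T (l , M) = onᵇ T ∧ not (does (proj₂ T ≟² 0²)) ∧ does (l ⊛ ((+ 2 , + 0) ⊛ proj₂ T) ≟² df₀ (proj₁ T)) ∧ does (third l T T ≟ₚ M)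

  start-sound : ∀ T s → startᵇ T s ≡ true → On₀ T × mulℕ 2 (embedPt T) ≡ embedPt (proj₂ s)
  start-sound T (l , M) check =
    let c₁ , rest = ∧-true {onᵇ T} check
        c₂ , rest′ = ∧-true {not (does (proj₂ T ≟² 0²))} rest
        c₃ , c₄ = ∧-true {does (l ⊛ ((+ 2 , + 0) ⊛ proj₂ T) ≟² df₀ (proj₁ T))} rest′
    in does-true (_ ≟² _) c₁ , trans (tangent-sum l T (does-true (_ ≟² _) c₁) (does-false (proj₂ T ≟² 0²) (not-true c₂)) (does-true (_ ≟² _) c₃))
         (cong embedPt (does-true (third l T T ≟ₚ M) c₄))

  -- T has order 3 + length ss; s holds the slope of the tangent at T and the point 2T.
  orderᵇ : ℤ² × ℤ² → Step → List Step → Bool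
  orderᵇ T s ss = startᵇ T s ∧ pathᵇ T (proj₂ s) ss
    ∧ onᵇ (path (proj₂ s) ss) ∧ does (proj₁ T ≟² proj₁ (path (proj₂ s) ss))
    ∧ does (proj₂ T ⊕ proj₂ (path (proj₂ s) ss) ≟² 0²)

  module Order (T : ℤ² × ℤ²) (s : Step) (ss : List Step) (check : orderᵇ T s ss ≡ true) where
    private
      M = proj₂ s
      c₁ = ∧-true {startᵇ T s} check
      c₂ = ∧-true {pathᵇ T M ss} (proj₂ c₁)
      c₃ = ∧-true {onᵇ (path M ss)} (proj₂ c₂)
      c₄ = ∧-true {does (proj₁ T ≟² proj₁ (path M ss))} (proj₂ c₃)

    onT : On₀ T
    onT = proj₁ (start-sound T s (proj₁ c₁))

    twice : mulℕ 2 (embedPt T) ≡ embedPt M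
    twice = proj₂ (start-sound T s (proj₁ c₁))

    -- The path starts at 2T and ends at -T; one more addition of T is vertical.
    killed : mulℕ (suc (length ss ℕ.+ 2)) (embedPt T) ≡ O
    killed = trans (cong (addP (embedPt T)) (path-sound T M ss 2 onT twice (proj₁ c₂)))
      (vertical-sum T (path M ss) onT (does-true (_ ≟² _) (proj₁ c₃)) (does-true (_ ≟² _) (proj₁ c₄)) (does-true (_ ≟² _) (proj₂ c₄)))

    minimal : ∀ k → k ℕ.< suc (length ss ℕ.+ 2) → mulℕ k (embedPt T) ≡ O → k ≡ 0
    minimal 0 _ _ = refl
    minimal 1 _ ()
    minimal (suc (suc k)) (s≤s k≤) eq = ⊥-elim (path-nonzero T M ss 2 onT twice (proj₁ c₂) (suc (suc k)) (s≤s (s≤s z≤n)) k≤ eq)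

    multiple : ∀ ss′ → pathᵇ T M ss′ ≡ true → mulℕ (length ss′ ℕ.+ 2) (embedPt T) ≡ embedPt (path M ss′)
    multiple ss′ = path-sound T M ss′ 2 onT twice

  -- `value` mirrors χ on pairs of integers, so that the nonpower test runs without evaluating
  -- decisions about rationals.
  record KummerData (ℓ : ℕ) : Set where
    field
      kummer : KummerMaps.Kummer field-K A B ℓ
      value : ℤ² × ℤ² → ℤ²
      value-sound : ∀ P → On₀ P → KummerMaps.Kummer.χ kummer (to (embedPt P)) ≡ embed (value P)

  pow : ℤ² → ℕ → ℤ²
  pow x zero = + 1 , + 0
  pow x (suc n) = x ⊛ pow x n

  powProduct : ∀ {k} → Vec ℕ k → Vec ℤ² k → ℤ²
  powProduct [] [] = + 1 , + 0
  powProduct (r ∷ rs) (x ∷ xs) = pow x r ⊛ powProduct rs xs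

  -- The map and the modulus that refute a relation may vary with the residue vector; every nonzero
  -- vector has to be refuted by at least one pair.
  independentᵇ : ∀ {k} ℓ → List ℕ → List (KummerData ℓ) → Vec (ℤ² × ℤ²) k → Bool
  independentᵇ {k} ℓ ms κs Qs = allResidues ℓ k λ rs →
    isZeroᵇ rs ∨ any (λ κ → nonpowerᵇ ℓ ms (powProduct rs (Vec.map (KummerData.value κ) Qs))) κs

  data AllOn₀ : ∀ {k} → Vec (ℤ² × ℤ²) k → Set where
    [] : AllOn₀ []
    _∷_ : ∀ {k P} {Ps : Vec (ℤ² × ℤ²) k} → On₀ P → AllOn₀ Ps → AllOn₀ (P ∷ Ps)

  pts : ∀ {k} {Qs : Vec (ℤ² × ℤ²) k} → AllOn₀ Qs → Vec Pts k
  pts [] = []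
  pts (_∷_ {P = P} onP ons) = (embedPt P , on P onP) ∷ pts ons

  open PowerClasses field-K using (_^_)

  embed-pow : ∀ x n → embed x ^ n ≡ embed (pow x n)
  embed-pow x zero = refl
  embed-pow x (suc n) = trans (cong (embed x *K_) (embed-pow x n)) (embed-* x (pow x n))

  module _ {ℓ} (κ : KummerData ℓ) where
    open KummerData κ
    embed-powProduct : ∀ {k} (rs : Vec ℕ k) {Qs} (ons : AllOn₀ Qs) →
      powerProduct kummer rs (Vec.map (χₚ kummer) (pts ons)) ≡ embed (powProduct rs (Vec.map value Qs))
    embed-powProduct [] [] = refl
    embed-powProduct (r ∷ rs) (_∷_ {P = P} onP ons) = trans
      (cong₂ _*K_ (trans (cong (_^ r) (value-sound P onP)) (embed-pow (value P) r)) (embed-powProduct rs ons))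
      (embed-* (pow (value P) r) (powProduct rs _))

  independent : ∀ {k} ℓ .{{_ : ℕ.NonZero ℓ}} ms κs {Qs : Vec (ℤ² × ℤ²) k} (ons : AllOn₀ Qs) →
    independentᵇ ℓ ms κs Qs ≡ true → ∀ cs → proj₁ (lincomb cs (pts ons)) ≡ O → AllZeroℕ ℓ (residues ℓ cs)
  independent ℓ ms κs {Qs} ons check cs relation
    with ∨-true {isZeroᵇ (residues ℓ cs)} (allResidues-sound ℓ _ check cs)
  ... | inj₁ z = zero-sound (residues ℓ cs) z
    where
    zero-sound : ∀ {k} (rs : Vec ℕ k) → isZeroᵇ rs ≡ true → AllZeroℕ ℓ rs
    zero-sound [] _ = []
    zero-sound (r ∷ rs) eq = let r≡0 , rs≡0 = ∧-true {r ℕ.≡ᵇ 0} eq in ℕₚ.≡ᵇ⇒≡ r 0 (subst Bool.T (sym r≡0) tt) ∷ zero-sound rs rs≡0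
  ... | inj₂ h = ⊥-elim (some κs h)
    where
    some : ∀ κs → any (λ κ → nonpowerᵇ ℓ ms (powProduct (residues ℓ cs) (Vec.map (KummerData.value κ) Qs))) κs ≡ true → ⊥
    some (κ ∷ κs) eq with ∨-true {nonpowerᵇ ℓ ms (powProduct (residues ℓ cs) (Vec.map (KummerData.value κ) Qs))} eq
    ... | inj₂ h = some κs h
    ... | inj₁ h = let w , w^ℓ = relation-power (KummerData.kummer κ) cs (pts ons) relation in
      nonpower ℓ ms _ h w (trans w^ℓ (embed-powProduct κ (residues ℓ cs) ons))

-- The descents for ℓ = 3 and ℓ = 2

module Subgroups (d : ℤ) (nonsquare : ∀ q → q ℚ.* q ≢ ratio d) (E : EllipticCurve d)
  (A₀ B₀ : ℤ²)
  (A≡ : EllipticCurve.A E ≡ (ratio (proj₁ A₀) , ratio (proj₂ A₀)))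
  (B≡ : EllipticCurve.B E ≡ (ratio (proj₁ B₀) , ratio (proj₂ B₀))) where
  open Field d
  open CurvePoints d nonsquare E
  open Certificates d nonsquare E A₀ B₀ A≡ B≡
  open EllipticCurve E
  open Curve E hiding (lincomb)
  open DiscreteField field-K hiding (Carrier; _+_; _*_; -_; _-_)
  open Z using (_⊕_; _⊛_; ⊝_)
  open KummerMaps field-K A B using (two-torsion; module Square)

  squareData : ∀ e → f₀ e ≡ 0² → df₀ e ≢ 0² → KummerData 2
  squareData e fe≡0 dfe≢0 = record { kummer = S.kummer ; value = value ; value-sound = λ P _ → sound P }
    where
    module S = Square (embed e) (trans (embed-f e) (cong embed fe≡0)) (λ z → embed-≢ dfe≢0 (trans (sym (embed-df e)) z))
    value : ℤ² × ℤ² → ℤ²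
    value (x , y) = if does (x ≟² e) then df₀ e else x ⊖ e
    sound : ∀ P → S.χ (to (embedPt P)) ≡ embed (value P)
    sound (x , y) = go (embed x ≟ embed e) (x ≟² e)
      where
      go : (d₁ : Dec (embed x ≡ embed e)) (d₂ : Dec (x ≡ e)) → S.χ′ d₁ ≡ embed (if does d₂ then df₀ e else x ⊖ e)
      go (yes _) (yes _) = embed-df e
      go (no _) (no _) = embed-- x e
      go (yes eq) (no x≢e) = ⊥-elim (x≢e (embed-injective eq))
      go (no ne) (yes x≡e) = ⊥-elim (ne (cong embed x≡e))

  record Flex (x₀ y₀ α : ℤ²) : Set where
    field
      on-curve : y₀ ⊛ y₀ ≡ f₀ x₀
      y₀≢0 : y₀ ≢ 0²
      slope : α ⊛ ((+ 2 , + 0) ⊛ y₀) ≡ df₀ x₀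
      flex : α ⊛ α ≡ (+ 3 , + 0) ⊛ x₀

  module FlexPoint {x₀ y₀ α : ℤ²} (flexPoint : Flex x₀ y₀ α) where
    open Flex flexPoint
    open CubeKummer field-K A B (embed x₀) (embed y₀) (embed α)

    on′ : embed y₀ *K embed y₀ ≡ f (embed x₀)
    on′ = trans (embed-* y₀ y₀) (trans (cong embed on-curve) (sym (embed-f x₀)))

    slope′ : embed α *K (2# *K embed y₀) ≡ 3# *K (embed x₀ *K embed x₀) +K A
    slope′ = trans (cong (embed α *K_) (embed-* (+ 2 , + 0) y₀)) (trans (embed-* α ((+ 2 , + 0) ⊛ y₀)) (trans (cong embed slope) (sym (embed-df x₀))))

    flex′ : embed α *K embed α ≡ 3# *K embed x₀
    flex′ = trans (embed-* α α) (trans (cong embed flex) (sym (embed-* (+ 3 , + 0) x₀)))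

    tangent′ = flex-tangent on′ (embed-≢ y₀≢0) slope′ flex′

    L₀ : ℤ² → ℤ²
    L₀ x = α ⊛ x ⊕ (y₀ ⊖ α ⊛ x₀)

    embed-L : ∀ x → L (embed x) ≡ embed (L₀ x)
    embed-L x = trans (cong₂ _+K_ (embed-* α x) (trans (cong (λ z → embed y₀ -K z) (embed-* α x₀)) (embed-- y₀ (α ⊛ x₀)))) (embed-+ (α ⊛ x) (y₀ ⊖ α ⊛ x₀))

    2y₀ : ℤ²
    2y₀ = (+ 2 , + 0) ⊛ y₀

    cubeData : KummerData 3
    cubeData = record { kummer = kummer (embed-≢ y₀≢0) tangent′ ; value = value ; value-sound = λ P _ → sound P }
      where
      value : ℤ² × ℤ² → ℤ²
      value (x , y) = if does (y ⊖ L₀ x ≟² 0²) then 2y₀ ⊛ 2y₀ else y ⊖ L₀ x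
      embed-v : ∀ x y → embed y -K L (embed x) ≡ embed (y ⊖ L₀ x)
      embed-v x y = trans (cong (λ z → embed y -K z) (embed-L x)) (embed-- y (L₀ x))
      sound : ∀ P → χ (embed-≢ y₀≢0) tangent′ (to (embedPt P)) ≡ embed (value P)
      sound (x , y) = go ((embed y -K L (embed x)) ≟ 0K) (y ⊖ L₀ x ≟² 0²)
        where
        go : (d₁ : Dec (embed y -K L (embed x) ≡ 0K)) (d₂ : Dec (y ⊖ L₀ x ≡ 0²)) →
             χ′ (embed-≢ y₀≢0) tangent′ d₁ ≡ embed (if does d₂ then 2y₀ ⊛ 2y₀ else y ⊖ L₀ x)
        go (yes _) (yes _) = trans (cong₂ _*K_ (embed-* (+ 2 , + 0) y₀) (embed-* (+ 2 , + 0) y₀)) (embed-* 2y₀ 2y₀)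
        go (no _) (no _) = embed-v x y
        go (yes eq) (no ne) = ⊥-elim (ne (embed-injective (trans (sym (embed-v x y)) eq)))
        go (no ne) (yes eq) = ⊥-elim (ne (trans (embed-v x y) (cong embed eq)))

    κ₀ : ℤ²
    κ₀ = (+ 8 , + 0) ⊛ (α ⊛ α ⊛ α) ⊖ (+ 54 , + 0) ⊛ y₀

    embed-κ : κ on′ (embed-≢ y₀≢0) slope′ flex′ ≡ embed κ₀
    embed-κ = trans (cong₂ _-K_
        (trans (cong₂ _*K_ (trans (cong (_*K 2#) (embed-* (+ 2 , + 0) (+ 2 , + 0))) (embed-* ((+ 2 , + 0) ⊛ (+ 2 , + 0)) (+ 2 , + 0))) (trans (cong (_*K embed α) (embed-* α α)) (embed-* (α ⊛ α) α))) (embed-* eight (α ⊛ α ⊛ α)))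
        (trans (cong (_*K embed y₀) (trans (cong (2# *K_) (trans (cong (_*K 3#) (embed-* (+ 3 , + 0) (+ 3 , + 0))) (embed-* ((+ 3 , + 0) ⊛ (+ 3 , + 0)) (+ 3 , + 0)))) (embed-* (+ 2 , + 0) ((+ 3 , + 0) ⊛ (+ 3 , + 0) ⊛ (+ 3 , + 0))))) (embed-* fiftyfour y₀)))
      (trans (embed-- (eight ⊛ (α ⊛ α ⊛ α)) (fiftyfour ⊛ y₀)) (cong embed (cong₂ _⊖_ (cong (_⊛ (α ⊛ α ⊛ α)) eight≡) (cong (_⊛ y₀) fiftyfour≡))))
      where
      eight = (+ 2 , + 0) ⊛ (+ 2 , + 0) ⊛ (+ 2 , + 0)
      fiftyfour = (+ 2 , + 0) ⊛ ((+ 3 , + 0) ⊛ (+ 3 , + 0) ⊛ (+ 3 , + 0))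
      rational : ∀ a b → (a , + 0) ⊛ (b , + 0) ≡ (a ℤ.* b , + 0)
      rational a b = cong₂ _,_ (trans (cong (λ z → a ℤ.* b ℤ.+ z) (ℤₚ.*-zeroʳ d)) (ℤₚ.+-identityʳ (a ℤ.* b))) (trans (ℤₚ.+-identityʳ (a ℤ.* + 0)) (ℤₚ.*-zeroʳ a))
      eight≡ : eight ≡ (+ 8 , + 0)
      eight≡ = trans (cong (_⊛ (+ 2 , + 0)) (rational (+ 2) (+ 2))) (rational (+ 4) (+ 2))
      fiftyfour≡ : fiftyfour ≡ (+ 54 , + 0)
      fiftyfour≡ = trans (cong ((+ 2 , + 0) ⊛_) (trans (cong (_⊛ (+ 3 , + 0)) (rational (+ 3) (+ 3))) (rational (+ 9) (+ 3)))) (rational (+ 2) (+ 27))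

    three-torsion′ : ∀ ms → nonpowerᵇ 3 ms κ₀ ≡ true → ∀ (S : Pts) → proj₁ (3 · S) ≡ O →
      proj₁ S ≡ O ⊎ proj₁ S ≡ embedPt (x₀ , y₀) ⊎ proj₁ S ≡ negP (embedPt (x₀ , y₀))
    three-torsion′ ms check (S , onS) eq = go (three-torsion on′ (embed-≢ y₀≢0) slope′ flex′
        (λ w h → nonpower 3 ms κ₀ check w (trans h embed-κ)) (On-to onS) (addP-Sum S S onS onS)
        (subst (Sum (to S) (to (addP S S))) (cong to (trans (cong (λ z → addP S (addP S z)) (sym (addP-identityʳ S))) eq))
          (addP-Sum S (addP S S) onS (OnCurve-addP onS onS))))
      where
      T₃ = embedPt (x₀ , y₀)
      go : to S ≡ to O ⊎ to S ≡ to T₃ ⊎ to S ≡ to (negP T₃) → S ≡ O ⊎ S ≡ T₃ ⊎ S ≡ negP T₃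
      go (inj₁ h) = inj₁ (to-injective h)
      go (inj₂ (inj₁ h)) = inj₂ (inj₁ (to-injective h))
      go (inj₂ (inj₂ h)) = inj₂ (inj₂ (to-injective h))

  private
    allZero : ∀ {k} {bs : Vec ℤ k} → IsZero bs → AllZero bs
    allZero [] = []
    allZero (refl ∷ z) = _∷_ (allZero z)

    lincomb-zero : ∀ {k} {bs : Vec ℤ k} Ps → IsZero bs → proj₁ (lincomb bs Ps) ≡ O
    lincomb-zero [] [] = refl
    lincomb-zero (P ∷ Ps) (refl ∷ z) = lincomb-zero Ps z

  -- `ls₀` is the initial stretch of the multiples of T that stops at the flex mT. Together with O
  -- and -mT it accounts for the whole 3-torsion, so the single generator T serves the descent.
  module CubeDescent {r} (T : ℤ² × ℤ²) (l : Step) (ls ls₀ : List Step) (order : orderᵇ T l ls ≡ true)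
    {x₀ y₀ α : ℤ²} (flexPoint : Flex x₀ y₀ α)
    (prefix : pathᵇ T (proj₂ l) ls₀ ≡ true) (T₃≡ : path (proj₂ l) ls₀ ≡ (x₀ , y₀))
    {Qs : Vec (ℤ² × ℤ²) r} (ons : AllOn₀ Qs) (ms : List ℕ)
    (noncube : nonpowerᵇ 3 ms (FlexPoint.κ₀ flexPoint) ≡ true)
    (indep : independentᵇ 3 ms (FlexPoint.cubeData flexPoint ∷ []) (T ∷ Qs) ≡ true)
    where
    open Order T l ls order
    open FlexPoint flexPoint

    n m : ℕ
    n = suc (length ls ℕ.+ 2)
    m = length ls₀ ℕ.+ 2

    Ts : Vec Pts 1
    Ts = (embedPt T , on T onT) ∷ []

    Ps : Vec Pts r
    Ps = pts ons

    mT : mulℕ m (embedPt T) ≡ embedPt (x₀ , y₀)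
    mT = trans (multiple ls₀ prefix) (cong embedPt T₃≡)

    torsion : ∀ S → proj₁ (3 · S) ≡ O → ∃ λ as → proj₁ S ≡ proj₁ (lincomb as Ts)
    torsion S eq = go (three-torsion′ ms noncube S eq)
      where
      go : proj₁ S ≡ O ⊎ proj₁ S ≡ embedPt (x₀ , y₀) ⊎ proj₁ S ≡ negP (embedPt (x₀ , y₀)) → ∃ λ as → proj₁ S ≡ proj₁ (lincomb as Ts)
      go (inj₁ h) = + 0 ∷ [] , h
      go (inj₂ (inj₁ h)) = + m ∷ [] , trans h (sym (trans (addP-identityʳ _) (trans (·-mulℕ m (embedPt T , on T onT)) mT)))
      go (inj₂ (inj₂ h)) = ℤ.- (+ m) ∷ [] , trans h (sym (trans (addP-identityʳ _) (trans (·ℤ-neg (+ m) (embedPt T , on T onT))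
            (cong negP (trans (·-mulℕ m (embedPt T , on T onT)) mT)))))

    open Descent 3 (s≤s (s≤s z≤n)) Ts Ps (independent 3 ms (cubeData ∷ []) (_∷_ {P = T} onT ons) indep) torsion

    subgroup : ContainsSubgroup (n ∷ []) r
    subgroup = record
      { Ts = points Ts ; Ps = points Ps ; Ts-on = points-on Ts ; Ps-on = points-on Ps
      ; Ts-order = killed ∷ []
      ; injective = λ as bs eq → inject as bs (trans (cong₂ addP (lincomb-points as Ts) (lincomb-points bs Ps)) eq) }
      where
      inject : ∀ as bs → addP (proj₁ (lincomb as Ts)) (proj₁ (lincomb bs Ps)) ≡ O → AllDiv (n ∷ []) as × AllZero bs
      inject (a ∷ []) bs eq = (order-divides n (embedPt T , on T onT) (trans (·-mulℕ n (embedPt T , on T onT)) killed)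
            (λ k k<n kT≡O → minimal k k<n (trans (sym (·-mulℕ k (embedPt T , on T onT))) kT≡O)) a aT≡O ∷ []) , allZero zero-bs
        where
        zero-bs : IsZero bs
        zero-bs = free-part-zero (a ∷ []) bs eq
        aT≡O : proj₁ (a ·ℤ (embedPt T , on T onT)) ≡ O
        aT≡O = trans (sym (addP-identityʳ _)) (trans (sym (addP-identityʳ _)) (trans (cong (addP (proj₁ (lincomb (a ∷ []) Ts))) (sym (lincomb-zero Ps zero-bs))) eq))

  record TwoTorsion (e₁ e₂ e₃ : ℤ²) : Set where
    field
      sum≡0 : e₁ ⊕ e₂ ⊕ e₃ ≡ 0²
      A₀≡ : A₀ ≡ e₁ ⊛ e₂ ⊕ (e₁ ⊕ e₂) ⊛ e₃
      B₀≡ : B₀ ≡ ⊝ (e₁ ⊛ e₂ ⊛ e₃)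
      root₁ : f₀ e₁ ≡ 0²
      root₂ : f₀ e₂ ≡ 0²
      simple₁ : df₀ e₁ ≢ 0²
      simple₂ : df₀ e₂ ≢ 0²
      e₁≢e₂ : e₁ ≢ e₂

  -- The values x - e₁, x - e₂, x - e₃ multiply to y², so modulo squares the third map is the
  -- product of the other two. The stretch `ls₀` stops at mT = (e₂ , 0), which spans the 2-torsion
  -- together with (e₁ , 0).
  module SquareDescent {r} {e₁ e₂ e₃ : ℤ²} (roots : TwoTorsion e₁ e₂ e₃)
    (T : ℤ² × ℤ²) (l : Step) (ls ls₀ : List Step) (order : orderᵇ T l ls ≡ true)
    (prefix : pathᵇ T (proj₂ l) ls₀ ≡ true) (T₂≡ : path (proj₂ l) ls₀ ≡ (e₂ , 0²))
    {Qs : Vec (ℤ² × ℤ²) r} (ons : AllOn₀ Qs) (ms : List ℕ)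
    (indep : independentᵇ 2 ms (squareData e₁ (TwoTorsion.root₁ roots) (TwoTorsion.simple₁ roots)
              ∷ squareData e₂ (TwoTorsion.root₂ roots) (TwoTorsion.simple₂ roots) ∷ []) ((e₁ , 0²) ∷ T ∷ Qs) ≡ true)
    where
    open Order T l ls order
    open TwoTorsion roots

    n m : ℕ
    n = suc (length ls ℕ.+ 2)
    m = length ls₀ ℕ.+ 2

    0²⊛0² : 0² ⊛ 0² ≡ 0²
    0²⊛0² = cong (_, + 0) (trans (ℤₚ.+-identityˡ (d ℤ.* + 0)) (ℤₚ.*-zeroʳ d))

    on₁ : On₀ (e₁ , 0²)
    on₁ = trans 0²⊛0² (sym root₁)

    on₂ : On₀ (e₂ , 0²)
    on₂ = trans 0²⊛0² (sym root₂)

    T₁ T₂ : Pts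
    T₁ = embedPt (e₁ , 0²) , on (e₁ , 0²) on₁
    T₂ = embedPt T , on T onT

    Ts : Vec Pts 2
    Ts = T₁ ∷ T₂ ∷ []

    Ps : Vec Pts r
    Ps = pts ons

    mT₂ : proj₁ (m · T₂) ≡ embedPt (e₂ , 0²)
    mT₂ = trans (·-mulℕ m T₂) (trans (multiple ls₀ prefix) (cong embedPt T₂≡))

    2T₁ : proj₁ (2 · T₁) ≡ O
    2T₁ = vertical-sum (e₁ , 0²) (e₁ , 0²) on₁ on₁ refl refl

    factorisation : ∀ x → f x ≡ (x -K embed e₁) *K (x -K embed e₂) *K (x -K embed e₃)
    factorisation x = begin
      x *K (x *K x) +K (A *K x +K B)
        ≡⟨ cong₂ (λ a b → x *K (x *K x) +K (a *K x +K b)) A≡′ B≡′ ⟩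
      x *K (x *K x) +K ((E₁ *K E₂ +K (E₁ +K E₂) *K E₃) *K x +K (-K (E₁ *K E₂ *K E₃)))
        ≡⟨ solve 4 (λ x a b c → x :* (x :* x) :+ ((a :* b :+ (a :+ b) :* c) :* x :+ (:- (a :* b :* c)))
             := (x :- a) :* (x :- b) :* (x :- c) :+ (a :+ b :+ c) :* (x :* x)) refl x E₁ E₂ E₃ ⟩
      (x -K E₁) *K (x -K E₂) *K (x -K E₃) +K (E₁ +K E₂ +K E₃) *K (x *K x)
        ≡⟨ cong (λ z → (x -K E₁) *K (x -K E₂) *K (x -K E₃) +K z *K (x *K x))
             (trans (cong (_+K E₃) (embed-+ e₁ e₂)) (trans (embed-+ (e₁ ⊕ e₂) e₃) (cong embed sum≡0))) ⟩
      (x -K E₁) *K (x -K E₂) *K (x -K E₃) +K 0K *K (x *K x)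
        ≡⟨ solve 2 (λ a b → a :+ :0 :* b := a) refl ((x -K E₁) *K (x -K E₂) *K (x -K E₃)) (x *K x) ⟩
      (x -K E₁) *K (x -K E₂) *K (x -K E₃) ∎
      where
      open ≡.≡-Reasoning
      E₁ = embed e₁
      E₂ = embed e₂
      E₃ = embed e₃
      A≡′ : A ≡ E₁ *K E₂ +K (E₁ +K E₂) *K E₃
      A≡′ = trans A≡ (trans (cong embed A₀≡) (sym (trans (cong₂ _+K_ (embed-* e₁ e₂) (trans (cong (_*K E₃) (embed-+ e₁ e₂)) (embed-* (e₁ ⊕ e₂) e₃)))
        (embed-+ (e₁ ⊛ e₂) ((e₁ ⊕ e₂) ⊛ e₃)))))
      B≡′ : B ≡ -K (E₁ *K E₂ *K E₃)
      B≡′ = trans B≡ (trans (cong embed B₀≡) (sym (trans (cong -K_ (trans (cong (_*K E₃) (embed-* e₁ e₂)) (embed-* (e₁ ⊛ e₂) e₃))) (embed-neg (e₁ ⊛ e₂ ⊛ e₃)))))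

    root : ∀ x → f x ≡ 0K → x ≡ embed e₁ ⊎ x ≡ embed e₂ ⊎ x ≡ embed e₃
    root x fx≡0 = go ((x -K embed e₁) ≟ 0K) ((x -K embed e₂) ≟ 0K)
      where
      go : Dec (x -K embed e₁ ≡ 0K) → Dec (x -K embed e₂ ≡ 0K) → x ≡ embed e₁ ⊎ x ≡ embed e₂ ⊎ x ≡ embed e₃
      go (yes h) _ = inj₁ (x-y≡0⇒x≡y h)
      go (no _) (yes h) = inj₂ (inj₁ (x-y≡0⇒x≡y h))
      go (no h₁) (no h₂) = inj₂ (inj₂ (x-y≡0⇒x≡y (*-cancelˡ-0 (*-≢0 h₁ h₂) (trans (sym (factorisation x)) fx≡0))))

    -- The chord is y = 0, of slope 0, and its third intersection -e₁ - e₂ is e₃ because the roots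
    -- sum to zero.
    T₁+mT₂ : addP (embedPt (e₁ , 0²)) (embedPt (e₂ , 0²)) ≡ pt (embed e₃) 0K
    T₁+mT₂ = trans (chord-sum 0² (e₁ , 0²) (e₂ , 0²) on₁ on₂ e₁≢e₂ (0²⊛ (e₂ ⊖ e₁)))
        (cong₂ pt (cong embed x₃≡e₃) (cong embed (cong (_⊖ 0²) (0²⊛ (e₁ ⊖ ((0² ⊛ 0² ⊖ e₁) ⊖ e₂))))))
      where
      module ZR = Algebra.Bundles.CommutativeRing Z.commutativeRing
      module ZS = IntegerSolver Z.commutativeRing
      0²⊛ : ∀ x → 0² ⊛ x ≡ 0²
      0²⊛ = ZR.zeroˡ
      x₃≡e₃ : (0² ⊛ 0² ⊖ e₁) ⊖ e₂ ≡ e₃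
      x₃≡e₃ = trans (ZS.solve 3 (λ a b c → (ZS.:0 ZS.:* ZS.:0 ZS.:- a) ZS.:- b ZS.:= c ZS.:- (a ZS.:+ b ZS.:+ c)) refl e₁ e₂ e₃)
        (trans (cong (e₃ ⊖_) sum≡0) (ZS.solve 1 (λ c → c ZS.:- ZS.:0 ZS.:= c) refl e₃))

    torsion : ∀ S → proj₁ (2 · S) ≡ O → ∃ λ as → proj₁ S ≡ proj₁ (lincomb as Ts)
    torsion (S , onS) eq = go (two-torsion (On-to onS) (subst (Sum (to S) (to S)) (cong to (trans (cong (addP S) (sym (addP-identityʳ S))) eq)) (addP-Sum S S onS onS)))
      where
      case : ∀ x → S ≡ pt x 0K → x ≡ embed e₁ ⊎ x ≡ embed e₂ ⊎ x ≡ embed e₃ → ∃ λ as → S ≡ proj₁ (lincomb as Ts)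
      go : to S ≡ to O ⊎ (∃ λ x → to S ≡ to (pt x 0K) × f x ≡ 0K) → ∃ λ as → S ≡ proj₁ (lincomb as Ts)
      go (inj₁ h) = + 0 ∷ + 0 ∷ [] , to-injective h
      go (inj₂ (x , h , fx≡0)) = case x (to-injective h) (root x fx≡0)
      case _ h (inj₁ refl) = + 1 ∷ + 0 ∷ [] , h
      case _ h (inj₂ (inj₁ refl)) = + 0 ∷ + m ∷ [] , trans h (sym (trans (addP-identityʳ _) mT₂))
      case _ h (inj₂ (inj₂ refl)) = + 1 ∷ + m ∷ [] , trans h (sym (trans (cong (addP (embedPt (e₁ , 0²))) (trans (addP-identityʳ _) mT₂)) T₁+mT₂))

    relation = independent 2 ms (squareData e₁ root₁ simple₁ ∷ squareData e₂ root₂ simple₂ ∷ []) (_∷_ {P = e₁ , 0²} on₁ (_∷_ {P = T} onT ons)) indep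

    open Descent 2 (s≤s (s≤s z≤n)) Ts Ps relation torsion

    subgroup : ContainsSubgroup (2 ∷ n ∷ []) r
    subgroup = record
      { Ts = points Ts ; Ps = points Ps ; Ts-on = points-on Ts ; Ps-on = points-on Ps
      ; Ts-order = 2T₁ ∷ killed ∷ []
      ; injective = λ as bs eq → inject as bs (trans (cong₂ addP (lincomb-points as Ts) (lincomb-points bs Ps)) eq) }
      where
      inject : ∀ as bs → addP (proj₁ (lincomb as Ts)) (proj₁ (lincomb bs Ps)) ≡ O → AllDiv (2 ∷ n ∷ []) as × AllZero bs
      inject (a ∷ b ∷ []) bs eq = (%ℕ≡0⇒∣ 2 a a-even ∷ order-divides n T₂ (trans (·-mulℕ n T₂) killed)
            (λ k k<n kT≡O → minimal k k<n (trans (sym (·-mulℕ k T₂)) kT≡O)) b bT≡O ∷ []) , allZero zero-bs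
        where
        zero-bs : IsZero bs
        zero-bs = free-part-zero (a ∷ b ∷ []) bs eq
        first : ∀ {k} {c} {cs : Vec ℤ k} → AllZeroℕ 2 (residues 2 (c ∷ cs)) → c ℤD.%ℕ 2 ≡ 0
        first (h ∷ _) = h
        -- Independence modulo 2 is applied to the original relation. Once `a` is even, aT₁ is O and
        -- b is a relation of T₂ alone.
        a-even : a ℤD.%ℕ 2 ≡ 0
        a-even = first {c = a} {cs = b ∷ bs} (relation (a ∷ b ∷ bs) (trans (lincomb-++ (a ∷ b ∷ []) bs Ts Ps) eq))
        aT₁≡O : proj₁ (a ·ℤ T₁) ≡ O
        aT₁≡O = trans (cong (λ z → proj₁ (z ·ℤ T₁)) (exact 2 a a-even)) (·ℤ-killed 2 T₁ 2T₁ (a ℤD./ℕ 2))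
        bT≡O : proj₁ (b ·ℤ T₂) ≡ O
        bT≡O = trans (sym (addP-identityʳ _)) (trans (sym (cong (λ z → addP z (addP (proj₁ (b ·ℤ T₂)) O)) aT₁≡O))
          (trans (sym (addP-identityʳ _)) (trans (cong (addP (proj₁ (lincomb (a ∷ b ∷ []) Ts))) (sym (lincomb-zero Ps zero-bs))) eq)))

-- Integral Weierstrass equations and the four curves

integralCurve : ∀ d → (∀ q → q ℚ.* q ≢ ratio d) → (A₀ B₀ : ℤ²) →
  does (Quadratic._⊕_ ℤₚ.+-*-isCommutativeRing d
         (Quadratic._⊛_ ℤₚ.+-*-isCommutativeRing d (+ 4 , + 0) (Quadratic._⊛_ ℤₚ.+-*-isCommutativeRing d A₀ (Quadratic._⊛_ ℤₚ.+-*-isCommutativeRing d A₀ A₀)))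
         (Quadratic._⊛_ ℤₚ.+-*-isCommutativeRing d (+ 27 , + 0) (Quadratic._⊛_ ℤₚ.+-*-isCommutativeRing d B₀ B₀)) ≟² (+ 0 , + 0)) ≡ false →
  EllipticCurve d
integralCurve d nonsquare A₀ B₀ check = weierstrass (embed A₀) (embed B₀) λ eq → does-false (_ ≟² _) check (embed-injective {(+ 4 , + 0) Z.⊛ (A₀ Z.⊛ (A₀ Z.⊛ A₀)) Z.⊕ (+ 27 , + 0) Z.⊛ (B₀ Z.⊛ B₀)} {+ 0 , + 0} (trans (sym (trans
    (cong₂ _+K_ (trans (cong (fromℚ (+ 4 ℚ./ 1) *K_) (trans (cong (embed A₀ *K_) (embed-* A₀ A₀)) (embed-* A₀ (A₀ Z.⊛ A₀)))) (embed-* (+ 4 , + 0) (A₀ Z.⊛ (A₀ Z.⊛ A₀))))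
                (trans (cong (fromℚ (+ 27 ℚ./ 1) *K_) (embed-* B₀ B₀)) (embed-* (+ 27 , + 0) (B₀ Z.⊛ B₀))))
    (embed-+ ((+ 4 , + 0) Z.⊛ (A₀ Z.⊛ (A₀ Z.⊛ A₀))) ((+ 27 , + 0) Z.⊛ (B₀ Z.⊛ B₀))))) eq))
  where
  open Field d
  open QuadraticField d nonsquare
module Z15 where
  d : ℤ
  d = -[1+ 6 ]

  nonsquare : ∀ q → q ℚ.* q ≢ ratio d
  nonsquare = nonsquareℚ 3 d refl

  A₀ B₀ : ℤ²
  A₀ = (-[1+ 71090 ] , + 64152)
  B₀ = (-[1+ 3022433 ] , + 26727192)

  T₀ : ℤ² × ℤ²
  T₀ = ((+ 423 , -[1+ 131 ]) , (-[1+ 1511 ] , -[1+ 2807 ]))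

  l : ℤ² × (ℤ² × ℤ²)
  l = ((+ 45 , + 6) , ((+ 927 , + 804) , (+ 18144 , -[1+ 42335 ])))

  ls₀ ls₁ ls : List (ℤ² × (ℤ² × ℤ²))
  ls₀ = ((-[1+ 38 ] , -[1+ 5 ]) , ((-[1+ 80 ] , -[1+ 203 ]) , (-[1+ 15119 ] , -[1+ 3023 ])))
    ∷ ((+ 24 , -[1+ 2 ]) , ((+ 171 , + 192) , (+ 756 , -[1+ 5723 ])))
    ∷ ((-[1+ 8 ] , + 0) , ((-[1+ 512 ] , -[1+ 59 ]) , (-[1+ 6911 ] , + 3456)))
    ∷ []
  -- The chord through T and kT also contains -(k+1)T = (14 - k)T, so the slopes recur in reverse
  -- order, and the points recur with opposite sign.
  ls₁ = ((+ 9 , -[1+ 5 ]) , ((-[1+ 80 ] , + 84) , (-[1+ 3023 ] , -[1+ 2159 ])))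
    ∷ ((+ 3 , + 0) , ((-[1+ 332 ] , + 48) , (+ 3780 , + 2268)))
    ∷ ((+ 3 , -[1+ 5 ]) , ((-[1+ 332 ] , + 48) , (-[1+ 3779 ] , -[1+ 2267 ])))
    ∷ ((+ 3 , + 0) , ((-[1+ 80 ] , + 84) , (+ 3024 , + 2160)))
    ∷ ((+ 9 , -[1+ 5 ]) , ((-[1+ 512 ] , -[1+ 59 ]) , (+ 6912 , -[1+ 3455 ])))
    ∷ ((-[1+ 8 ] , + 0) , ((+ 171 , + 192) , (-[1+ 755 ] , + 5724)))
    ∷ ((+ 24 , -[1+ 2 ]) , ((-[1+ 80 ] , -[1+ 203 ]) , (+ 15120 , + 3024)))
    ∷ ((-[1+ 38 ] , -[1+ 5 ]) , ((+ 927 , + 804) , (-[1+ 18143 ] , + 42336)))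
    ∷ ((+ 45 , + 6) , ((+ 423 , -[1+ 131 ]) , (+ 1512 , + 2808)))
    ∷ []
  ls = ls₀ List.++ ls₁

  Qs : Vec (ℤ² × ℤ²) 1
  Qs = ((+ 639 , -[1+ 59 ]) , (+ 13824 , + 0)) ∷ []

  E : EllipticCurve d
  E = integralCurve d nonsquare A₀ B₀ refl

  open Subgroups d nonsquare E A₀ B₀ refl refl
  open Certificates d nonsquare E A₀ B₀ refl refl

  x₀ y₀ α : ℤ²
  -- The flex is 5T, of order 3, and α is the slope of its tangent.
  x₀ = (-[1+ 512 ] , -[1+ 59 ])
  y₀ = (-[1+ 6911 ] , + 3456)
  α = (+ 6 , -[1+ 14 ])

  flexPoint : Flex x₀ y₀ α
  flexPoint = record { on-curve = refl ; y₀≢0 = λ () ; slope = refl ; flex = refl }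

  open CubeDescent T₀ l ls ls₀ refl flexPoint refl refl {Qs} (refl ∷ []) (5 ∷ 13 ∷ []) refl refl public using (subgroup)

  realizable : Realizable (15 ∷ []) 1
  realizable = d , squarefreeNonUnit (4 ∷ []) d 2 2 (λ ()) (λ ()) refl , E , subgroup

module Z18 where
  d : ℤ
  d = + 26521

  nonsquare : ∀ q → q ℚ.* q ≢ ratio d
  nonsquare = nonsquareℚ 7 d refl

  A₀ B₀ : ℤ²
  A₀ = (-[1+ 119743158435108987311 ] , -[1+ 647113115071330559 ])
  B₀ = (+ 660249139764918065131548614016 , + 3925671986023723972787973120)

  T₀ : ℤ² × ℤ²
  T₀ = ((+ 7609248012 , -[1+ 17232479 ]) , (+ 213499934058240 , -[1+ 4833568131839 ]))

  l : ℤ² × (ℤ² × ℤ²)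
  l = ((+ 145674 , -[1+ 59 ]) , ((+ 6097893852 , + 16984080) , (+ 61112515111200 , -[1+ 241576279199 ])))

  ls₀ ls₁ ls : List (ℤ² × (ℤ² × ℤ²))
  ls₀ = ((+ 136854 , + 60) , ((+ 5117351052 , + 16670880) , (+ 73577071872000 , + 343271520000)))
    ∷ ((+ 177390 , + 336) , ((+ 21734727852 , + 119767680) , (-[1+ 3940034900644799 ] , -[1+ 24215051476799 ])))
    ∷ ((-[1+ 39395 ] , -[1+ 989 ]) , ((-[1+ 1798698947 ] , -[1+ 24531119 ]) , (-[1+ 775766971619999 ] , -[1+ 4767836579999 ])))
    ∷ ((+ 107004 , -[1+ 89 ]) , ((+ 5854127052 , + 22502880) , (+ 69148962576000 , + 423764784000)))
    ∷ []
  ls₁ = ((+ 136284 , + 90) , ((+ 5324773692 , + 19260720) , (+ 10732110020640 , + 65731551840)))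
    ∷ ((+ 142140 , + 126) , ((+ 7690805292 , + 33791040) , (-[1+ 395595027351359 ] , -[1+ 2429191218239 ])))
    ∷ ((+ 47847 , -[1+ 452 ]) , ((-[1+ 7568370005 ] , -[1+ 59907941 ]) , (+ 0 , + 0)))
    ∷ ((+ 47847 , -[1+ 452 ]) , ((+ 7690805292 , + 33791040) , (+ 395595027351360 , + 2429191218240)))
    ∷ ((+ 142140 , + 126) , ((+ 5324773692 , + 19260720) , (-[1+ 10732110020639 ] , -[1+ 65731551839 ])))
    ∷ ((+ 136284 , + 90) , ((+ 5854127052 , + 22502880) , (-[1+ 69148962575999 ] , -[1+ 423764783999 ])))
    ∷ ((+ 107004 , -[1+ 89 ]) , ((-[1+ 1798698947 ] , -[1+ 24531119 ]) , (+ 775766971620000 , + 4767836580000)))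
    ∷ ((-[1+ 39395 ] , -[1+ 989 ]) , ((+ 21734727852 , + 119767680) , (+ 3940034900644800 , + 24215051476800)))
    ∷ ((+ 177390 , + 336) , ((+ 5117351052 , + 16670880) , (-[1+ 73577071871999 ] , -[1+ 343271519999 ])))
    ∷ ((+ 136854 , + 60) , ((+ 6097893852 , + 16984080) , (-[1+ 61112515111199 ] , + 241576279200)))
    ∷ ((+ 145674 , -[1+ 59 ]) , ((+ 7609248012 , -[1+ 17232479 ]) , (-[1+ 213499934058239 ] , + 4833568131840)))
    ∷ []
  ls = ls₀ List.++ ls₁

  Qs : Vec (ℤ² × ℤ²) 2
  Qs = ((+ 1160452236 , -[1+ 6308063 ]) , (+ 563378692290048 , + 3459426527232)) ∷ ((+ 333954468444 , -[1+ 1994881391 ]) , (-[1+ 267342112723491359 ] , + 1642011075833760)) ∷ []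

  E : EllipticCurve d
  E = integralCurve d nonsquare A₀ B₀ refl

  open Subgroups d nonsquare E A₀ B₀ refl refl
  open Certificates d nonsquare E A₀ B₀ refl refl

  x₀ y₀ α : ℤ²
  -- The flex is 6T, of order 3.
  x₀ = (+ 5854127052 , + 22502880)
  y₀ = (+ 69148962576000 , + 423764784000)
  α = (+ 125016 , + 270)

  flexPoint : Flex x₀ y₀ α
  flexPoint = record { on-curve = refl ; y₀≢0 = λ () ; slope = refl ; flex = refl }

  open CubeDescent T₀ l ls ls₀ refl flexPoint refl refl {Qs} (refl ∷ refl ∷ []) (7 ∷ 13 ∷ 19 ∷ []) refl refl public using (subgroup)

  realizable : Realizable (18 ∷ []) 2
  realizable = d , squarefreeNonUnit (7 ∷ 3 ∷ []) d 30 30 (λ ()) (λ ()) refl , E , subgroup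

module Z2Z10 where
  d : ℤ
  -- The curve and its point T of order 10 are rational, but only one root `e₂` of the cubic is. K
  -- is the field where the other two, conjugate, roots appear and complete the 2-torsion.
  d = + 55325286553

  nonsquare : ∀ q → q ℚ.* q ≢ ratio d
  nonsquare = nonsquareℚ 5 d refl

  A₀ B₀ : ℤ²
  A₀ = (-[1+ 2021509679134382759390170150644301007748874154195711 ] , + 0)
  B₀ = (+ 29922519534320146168817543114504858785297333562262587784386985441442342723584 , + 0)

  T₀ : ℤ² × ℤ²
  T₀ = ((-[1+ 38470132294562092463942351 ] , + 0) , (-[1+ 225291700992153419455870479951544319999 ] , + 0))

  l : ℤ² × (ℤ² × ℤ²)
  l = ((-[1+ 5367138573011 ] , + 0) , ((+ 105746441051037472582636848 , + 0) , (+ 999322034662935103709535440751584870400 , + 0)))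

  ls₀ ls₁ ls : List (ℤ² × (ℤ² × ℤ²))
  ls₀ = ((+ 8491491007212 , + 0) , ((+ 4829110769086886117318448 , + 0) , (-[1+ 142383432101908450301134805429308569599 ] , + 0)))
    ∷ ((+ 1914774093588 , + 0) , ((+ 37307381354950953329337648 , + 0) , (+ 80194880979554779279461631530055680000 , + 0)))
    ∷ ((+ 4031361907500 , + 0) , ((+ 17414629768853177690854704 , + 0) , (+ 0 , + 0)))
    ∷ []
  ls₁ = ((+ 4031361907500 , + 0) , ((+ 37307381354950953329337648 , + 0) , (-[1+ 80194880979554779279461631530055679999 ] , + 0)))
    ∷ ((+ 1914774093588 , + 0) , ((+ 4829110769086886117318448 , + 0) , (+ 142383432101908450301134805429308569600 , + 0)))
    ∷ ((+ 8491491007212 , + 0) , ((+ 105746441051037472582636848 , + 0) , (-[1+ 999322034662935103709535440751584870399 ] , + 0)))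
    ∷ ((-[1+ 5367138573011 ] , + 0) , ((-[1+ 38470132294562092463942351 ] , + 0) , (+ 225291700992153419455870479951544320000 , + 0)))
    ∷ []
  ls = ls₀ List.++ ls₁

  Qs : Vec (ℤ² × ℤ²) 4
  -- All four points are rational, and so are their values x - e₂, to which the test is blind. A
  -- relation among T and these points is therefore refuted through `e₁`.
  Qs = ((+ 36728599566670708710673200 , + 0) , (+ 72262123538983903290435701042598524928 , + 0)) ∷ ((-[1+ 51062476632948011905493711 ] , + 0) , (-[1+ 2589916639371965204093775438272593919 ] , + 0)) ∷ ((+ 34330120759398866654649648 , + 0) , (+ 31366524104769963969228543249613824000 , + 0)) ∷ ((+ 240802572339507963341882433 , + 0) , (-[1+ 3675090008980816261650875619362132881694 ] , + 0)) ∷ []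

  E : EllipticCurve d
  E = integralCurve d nonsquare A₀ B₀ refl

  open Subgroups d nonsquare E A₀ B₀ refl refl
  open Certificates d nonsquare E A₀ B₀ refl refl

  e₁ e₂ e₃ : ℤ²
  e₁ = (-[1+ 8707314884426588845427351 ] , + 180076219714593225000)
  e₂ = (+ 17414629768853177690854704 , + 0)
  e₃ = (-[1+ 8707314884426588845427351 ] , -[1+ 180076219714593224999 ])

  roots : TwoTorsion e₁ e₂ e₃
  roots = record { sum≡0 = refl ; A₀≡ = refl ; B₀≡ = refl ; root₁ = refl ; root₂ = refl ; simple₁ = λ () ; simple₂ = λ () ; e₁≢e₂ = λ () }

  open SquareDescent roots T₀ l ls ls₀ refl refl refl {Qs} (refl ∷ refl ∷ refl ∷ refl ∷ []) (7 ∷ 17 ∷ 23 ∷ 29 ∷ 53 ∷ []) refl public using (subgroup)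

  realizable : Realizable (2 ∷ 10 ∷ []) 4
  -- 3811 is the least b with d < b³, which balances the search for small p against that for small
  -- quotients d/p². The listed moduli show that no quotient that arises is a square.
  realizable = d , squarefreeNonUnit (5 ∷ 4 ∷ 3 ∷ 13 ∷ 8 ∷ []) d 3811 3811 (λ ()) (λ ()) refl , E , subgroup

module Z2Z12 where
  d : ℤ
  -- For s = 19/8, (s² - 1)(s² + 3) = 297 · 553 / 64² and 297 · 553 = 3² · 18249. Now N = s² and M =
  -- (a/2)²(s² - 1)(s² + 3) are squares in K, so (0 , 0) becomes divisible by 2 and the order 6
  -- grows to 12.
  d = + 18249

  nonsquare : ∀ q → q ℚ.* q ≢ ratio d
  nonsquare = nonsquareℚ 23 d refl

  A₀ B₀ : ℤ²
  -- Scaling by u = 135 + √d multiplies x by u² and turns a rational value a into au². The equations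
  -- of a square root then become U² = 4a · 135² or U² = 4ad, so they test whether a or ad is a
  -- square. The norm of u is -24.
  A₀ = (-[1+ 83750784307956306700000789671348624866537901911 ] , -[1+ 619968104908657892569944991648068384354392519 ])
  B₀ = (+ 12658524247131583207370554787495715004148657647782204701498489504449216 , + 93705167698221781168067323402413563391627470065525301442881752895040)

  T₀ : ℤ² × ℤ²
  T₀ = ((+ 144624684758415193563902 , + 1070589568379885550810) , (-[1+ 16335806945537952538759926041932799 ] , -[1+ 120926381313304701429906781209599 ]))

  l : ℤ² × (ℤ² × ℤ²)
  l = ((-[1+ 638794110140 ] , -[1+ 4730095314 ]) , ((+ 527108052656287990319102 , + 3901934918495305077210) , (+ 505064271159252249680483676489600000 , + 3738755901301291723837209160320000)))

  ls₀ ls₁ ls : List (ℤ² × (ℤ² × ℤ²))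
  ls₀ = ((+ 681458372793 , + 5046594047) , ((+ 257420342746194010213886 , + 1905563047955730498522) , (-[1+ 137426867326341739566396047458050047 ] , -[1+ 1017307183532332391324496644235263 ])))
    ∷ ((-[1+ 536795094428 ] , -[1+ 3973301298 ]) , ((+ 174203157405807533039102 , + 1289544675647530677210) , (+ 48089552660106629474719278489600000 , + 355984592587072042631717560320000)))
    ∷ ((+ 1088991950409 , + 8062303535) , ((+ 2053274098954226021274302 , + 15199433058710634563610) , (-[1+ 4140930333162120701183691543097372799 ] , -[1+ 30653381367392045616965850401289599 ])))
    ∷ ((-[1+ 1080551594924 ] , -[1+ 7998069474 ]) , ((+ 137065351183406799298046 , + 1014630827973894714330) , (+ 0 , + 0)))
    ∷ []
  ls₁ = ((-[1+ 1080551594924 ] , -[1+ 7998069474 ]) , ((+ 2053274098954226021274302 , + 15199433058710634563610) , (+ 4140930333162120701183691543097372800 , + 30653381367392045616965850401289600)))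
    ∷ ((+ 1088991950409 , + 8062303535) , ((+ 174203157405807533039102 , + 1289544675647530677210) , (-[1+ 48089552660106629474719278489599999 ] , -[1+ 355984592587072042631717560319999 ])))
    ∷ ((-[1+ 536795094428 ] , -[1+ 3973301298 ]) , ((+ 257420342746194010213886 , + 1905563047955730498522) , (+ 137426867326341739566396047458050048 , + 1017307183532332391324496644235264)))
    ∷ ((+ 681458372793 , + 5046594047) , ((+ 527108052656287990319102 , + 3901934918495305077210) , (-[1+ 505064271159252249680483676489599999 ] , -[1+ 3738755901301291723837209160319999 ])))
    ∷ ((-[1+ 638794110140 ] , -[1+ 4730095314 ]) , ((+ 144624684758415193563902 , + 1070589568379885550810) , (+ 16335806945537952538759926041932800 , + 120926381313304701429906781209600)))
    ∷ []
  ls = ls₀ List.++ ls₁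

  Qs : Vec (ℤ² × ℤ²) 4
  -- Before scaling, the first two are rational points of the curve and the third comes from a
  -- rational point of its twist.
  Qs = ((+ 141864236095581687499262 , + 1050154733393843714010) , (+ 12577239594582281586028285237094400 , + 93103455226390061574051404052480)) ∷ ((+ 340197897339265358093822 , + 2518326267522115662810) , (+ 237871268576257303416070916783308800 , + 1760850370781993255080442375208960)) ∷ ((-[1+ 193602706860689920469697 ] , -[1+ 1433150486713447346789 ]) , (+ 89612539137536959218543960352060800 , + 663359949644294494568281280976000)) ∷ ((-[1+ 60996611503160631466497 ] , -[1+ 451529673367627543589 ]) , (-[1+ 104804056944076381384671159516057599 ] , -[1+ 775815690636239757255920353996799 ])) ∷ []

  E : EllipticCurve d
  E = integralCurve d nonsquare A₀ B₀ refl

  open Subgroups d nonsquare E A₀ B₀ refl refl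
  open Certificates d nonsquare E A₀ B₀ refl refl

  e₁ e₂ e₃ : ℤ²
  e₁ = (-[1+ 235221662474632684977147 ] , -[1+ 1741236192031332591539 ])
  e₂ = (+ 137065351183406799298046 , + 1014630827973894714330)
  e₃ = (+ 98156311291225885679102 , + 726605364057437877210)

  roots : TwoTorsion e₁ e₂ e₃
  roots = record { sum≡0 = refl ; A₀≡ = refl ; B₀≡ = refl ; root₁ = refl ; root₂ = refl ; simple₁ = λ () ; simple₂ = λ () ; e₁≢e₂ = λ () }

  open SquareDescent roots T₀ l ls ls₀ refl refl refl {Qs} (refl ∷ refl ∷ refl ∷ refl ∷ []) (13 ∷ 17 ∷ 23 ∷ 29 ∷ 41 ∷ 43 ∷ 71 ∷ []) refl public using (subgroup)

  realizable : Realizable (2 ∷ 12 ∷ []) 4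
  realizable = d , squarefreeNonUnit (23 ∷ 3 ∷ 4 ∷ []) d 27 27 (λ ()) (λ ()) refl , E , subgroup
theorem3p2 : Realizable (15 ∷ []) 1 × Realizable (18 ∷ []) 2 × Realizable (2 ∷ 10 ∷ []) 4 × Realizable (2 ∷ 12 ∷ []) 4
theorem3p2 = Z15.realizable , Z18.realizable , Z2Z10.realizable , Z2Z12.realizable
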